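{- Let $CP_3(n)$ be defined by $\sum_{n\ge 0} CP_3(n)q^n = \dfrac{f_3^6f_6^6}{f_1^2f_2^2}$. Then for all integers $n\ge 0$, \[ CP_3(24n+11)\equiv 0\pmod{48},\qquad CP_3(24n+23)\equiv 0\pmod{96}. \]
   Context: For $|q|<1$ and integer $m\ge 1$, $f_m := (q^m;q^m)_\infty=\prod_{n\ge1}(1-q^{mn})$. $CP_3(n)$ is the number of $3$-core cubic bipartitions of $n$, defined by the generating function $\sum_{n\ge0}CP_3(n)q^n = \frac{f_3^6f_6^6}{f_1^2f_2^2}$. -}

module Defs where

open import Data.Nat using (ℕ; zero; suc; _∸_; _≡ᵇ_)
open import Data.Integer using (ℤ; 0ℤ; 1ℤ; -_) renaming (_+_ to _+ℤ_; _*_ to _*ℤ_)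
open import Data.List using (List; []; _∷_; upTo; map; foldr; reverse; length; lookup)
open import Data.Bool using (if_then_else_)

Series : Set
Series = ℕ → ℤ

sumℤ : List ℤ → ℤ
sumℤ = foldr _+ℤ_ 0ℤ

_⊛_ : Series → Series → Series
(a ⊛ b) n = sumℤ (map (λ k → a k *ℤ b (n ∸ k)) (upTo (suc n)))

infixl 7 _⊛_

oneS : Series
oneS zero = 1ℤ
oneS (suc _) = 0ℤ

oneMinusQ^ : ℕ → Series
oneMinusQ^ d n = if n ≡ᵇ 0 then 1ℤ +ℤ (if d ≡ᵇ 0 then - 1ℤ else 0ℤ)
                 else (if n ≡ᵇ d then - 1ℤ else 0ℤ)

partialEta : ℕ → ℕ → Series
partialEta m zero = oneS
partialEta m (suc N) = partialEta m N ⊛ oneMinusQ^ (m Data.Nat.* suc N)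

-- f_m = (q^m;q^m)_∞ = ∏_{k≥1} (1 - q^{mk}).  For m ≥ 1 the n-th coefficient
-- of the infinite product equals that of the partial product up to k = n
-- (factors with mk > n do not affect coefficients of degree ≤ n).
f : ℕ → Series
f m n = partialEta m n n

_^S_ : Series → ℕ → Series
a ^S zero = oneS
a ^S suc k = a ⊛ (a ^S k)

-- Multiplicative inverse of a series with constant term 1:
-- b_0 = 1, b_n = - Σ_{k=1}^{n} a_k b_{n-k}.
-- invList a n = [b_n, b_{n-1}, ..., b_0]
private
  lookupD : List ℤ → ℕ → ℤ
  lookupD [] _ = 0ℤ
  lookupD (x ∷ xs) zero = x
  lookupD (x ∷ xs) (suc i) = lookupD xs i

invList : Series → ℕ → List ℤ
invList a zero = 1ℤ ∷ []
invList a (suc n) =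
  let prev = invList a n   -- prev = [b_n, ..., b_0]; b_j = lookupD prev (n - j)
      bn+1 = - sumℤ (map (λ k → a (suc k) *ℤ lookupD prev k) (upTo (suc n)))
  in bn+1 ∷ prev

-- inverse series (meaningful when a 0 = 1)
inv : Series → Series
inv a n = lookupD (invList a n) 0

CP3gen : Series
CP3gen = ((f 3 ^S 6) ⊛ (f 6 ^S 6)) ⊛ inv ((f 1 ^S 2) ⊛ (f 2 ^S 2))

CP3 : ℕ → ℤ
CP3 = CP3gen

{-# OPTIONS --safe #-}
-- Let c(q) = f₃³/f₁, so that the generating function is c(q)² c(q²)². Multiplying the theta series ∑ q^(3i²-2i) and ∑ (-1)^j q^(3j²)
-- and splitting by the parity of j - i gives, through the Jacobi triple product, the 2-dissection c(q) = E(q) + q c(q⁴) with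
-- E = f₄³f₆²/(f₂²f₁₂). Hence CP₃(2m+1) is twice the coefficient of q^(2m) in K = c(q²)² E c(q⁴) = f₄²f₆⁸f₁₂²/f₂⁴.
-- Modulo 3, K = (f₄²/f₂) f₆⁷f₁₂², and by Gauss the exponents in f₄²/f₂ = ∑ q^(4i²+2i) are never 1 mod 3.
-- For 2-powers, K = f₁₂⁶ φ(q⁶)⁴/φ(q²)² with φ(q) = ∑ (-1)^i q^(i²) = 1 + 2h(q), which modulo 16 is
-- f₁₂⁶ (1 - 4u + 8v) with u = h(q²) + h(q²)² and v = h(q⁶) + h(q⁶)²; at exponents 10 mod 12 only f₁₂⁶u contributes, and it is
-- controlled by the residues of squares and sums of two squares and by the coefficients of a square a² being even where a(n/2) = 0.
module Submission where

open import Defs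
open import Data.Nat using (ℕ; _+_; _*_)
open import Data.Integer using (+_)
open import Data.Integer.Divisibility using (_∣_)
open import Data.Product using (_×_)

open import Algebra.Bundles using (CommutativeRing)
open import Algebra.Solver.Ring.AlmostCommutativeRing using (fromCommutativeRing; _-Raw-AlmostCommutative⟶_)
import Algebra.Solver.Ring
open import Data.Bool using (true; false; if_then_else_)
open import Data.Empty using (⊥-elim)
open import Data.Integer using (ℤ; -[1+_]; 0ℤ; 1ℤ; -_; ∣_∣; _⊖_; +-*-rawRing) renaming (_+_ to _+ℤ_; _*_ to _*ℤ_)
import Data.Integer.Divisibility.Signed as ℤ∣
open import Data.Integer.Divisibility.Signed using () renaming (_∣_ to _∣ℤ_; divides to dividesℤ)
import Data.Integer.Properties as ℤ
import Data.Integer.Tactic.RingSolver as ℤ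
open import Data.List using (List; map; upTo)
open import Data.List.Properties using (map-applyUpTo; map-upTo; map-cong-local)
import Data.List.Relation.Unary.All as All
open import Data.List.Relation.Unary.All.Properties using (all-upTo)
open import Data.Maybe using (Maybe; just; nothing)
open import Data.Nat using (zero; suc; _∸_; _≤_; _<_; z≤n; s≤s; _≡ᵇ_; _/_; _%_; _≟_; _≤?_; NonZero; >-nonZero; >-nonZero⁻¹)
import Data.Nat.Divisibility as ℕ∣
open import Data.Nat.Divisibility using () renaming (_∣_ to _∣ℕ_; ∣m∣n⇒∣m+n to ∣ℕ-+; ∣m+n∣m⇒∣n to ∣ℕ-cancel; divides to dividesℕ)
open import Data.Nat.DivMod using (m≡m%n+[m/n]*n; [m+kn]%n≡m%n; m%n<n; m<n⇒m%n≡m; %-distribˡ-*; %-distribˡ-+)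
open import Data.Nat.Induction using (<-rec)
import Data.Nat.Properties as ℕ
open import Data.Nat.Tactic.RingSolver using (solve-∀)
open import Data.Product using (_,_; ∃; ∃₂; proj₁; proj₂)
open import Data.Sum using (_⊎_; inj₁; inj₂)
open import Function using (_∘_)
open import Level using (0ℓ)
open import Relation.Binary.PropositionalEquality using (_≡_; _≢_; _≗_; refl; sym; trans; cong; cong₂; subst; module ≡-Reasoning)
import Relation.Binary.Reasoning.Setoid
open import Relation.Nullary using (¬_; ¬?; yes; no)
open import Relation.Nullary.Decidable using (toWitness)

-- The two theta series are chosen for their product: ∑ q^(3i²-2i) = f₂²f₃f₁₂/(f₁f₄f₆) and ∑ (-1)^j
-- q^(3j²) = f₃²/f₆ multiply to c(q) times f₂²f₁₂/(f₄f₆²). That factor is a series in q², so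
-- splitting the product by parity splits c(q). The cross term of (E + q c(q⁴))² supplies one factor
-- 2; what remains is that K is divisible by 3 and by 8 at exponents 24n+10, and by 3 and by 16 at
-- exponents 24n+22. No limits occur. For each coefficient a truncation order M above its index is
-- fixed, and everything is an identity in a commutative ring with q^M = 0, where products and theta
-- series stabilise, the ring solver applies and every f_m is a unit; denominators are cleared and
-- units cancelled afterwards. A congruence modulo N is an equation with an explicit term N w, so
-- one ring serves both 3 and 16. Coefficients are read off through supports: a factor vanishes
-- outside a class of exponents, and exponents of a product are sums of exponents of its factors.

-- Infinite products and theta series become finite in a ring where q is nilpotent; the intended instance is ℤ[[q]]/(q^M).
module Nilpotent
  (R : CommutativeRing 0ℓ 0ℓ)
  (constants : +-*-rawRing -Raw-AlmostCommutative⟶ fromCommutativeRing R)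
  where

  open CommutativeRing R public
    using (Carrier; _≈_; setoid; +-cong; *-cong; -‿cong; *-assoc; *-comm; +-comm; +-assoc; +-identityˡ; +-identityʳ; distribˡ; zeroˡ; zeroʳ)
    renaming (_+_ to infixl 6 _⊕_; _*_ to infixl 7 _⊗_; -_ to infix 8 ⊝_; 0# to 𝟘; refl to ≈-refl; sym to ≈-sym; trans to ≈-trans; reflexive to ≈-reflexive)

  open _-Raw-AlmostCommutative⟶_ constants public using (⟦_⟧; 0-homo; 1-homo)

  -- The image of the integer 1 is used in place of the ring's own `1#`, so that it is
  -- definitionally what `con 1ℤ` denotes in the solver. The zero `𝟘` is the ring's own, hence the
  -- occasional detour through `0-homo`.
  𝟙 : Carrier
  𝟙 = ⟦ 1ℤ ⟧

  module ≈-Reasoning = Relation.Binary.Reasoning.Setoid setoid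

  ⟦⟧-≟ : ∀ c d → Maybe (⟦ c ⟧ ≈ ⟦ d ⟧)
  ⟦⟧-≟ c d with c ℤ.≟ d
  ... | yes refl = just ≈-refl
  ... | no _     = nothing

  module Solver = Algebra.Solver.Ring +-*-rawRing (fromCommutativeRing R) constants ⟦⟧-≟
  open Solver using (solve; _:=_; _:+_; _:*_; _:-_; :-_; con)

  *-congˡ : ∀ {a b c} → b ≈ c → a ⊗ b ≈ a ⊗ c
  *-congˡ = *-cong ≈-refl

  *-congʳ : ∀ {a b c} → b ≈ c → b ⊗ a ≈ c ⊗ a
  *-congʳ p = *-cong p ≈-refl

  +-congˡ : ∀ {a b c} → b ≈ c → a ⊕ b ≈ a ⊕ c
  +-congˡ = +-cong ≈-refl

  +-congʳ : ∀ {a b c} → b ≈ c → b ⊕ a ≈ c ⊕ a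
  +-congʳ p = +-cong p ≈-refl

  *-identityˡ : ∀ a → 𝟙 ⊗ a ≈ a
  *-identityˡ a = ≈-trans (*-congʳ 1-homo) (CommutativeRing.*-identityˡ R a)

  *-identityʳ : ∀ a → a ⊗ 𝟙 ≈ a
  *-identityʳ a = ≈-trans (*-comm a 𝟙) (*-identityˡ a)

  -- Powers, finite products and finite sums

  infixl 9 _^_
  _^_ : Carrier → ℕ → Carrier
  a ^ zero  = 𝟙
  a ^ suc n = a ⊗ a ^ n

  ^-+ : ∀ a m n → a ^ (m + n) ≈ a ^ m ⊗ a ^ n
  ^-+ a zero    n = ≈-sym (*-identityˡ (a ^ n))
  ^-+ a (suc m) n = ≈-trans (*-congˡ (^-+ a m n)) (≈-sym (*-assoc a (a ^ m) (a ^ n)))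

  ^-* : ∀ a m n → (a ^ m) ^ n ≈ a ^ (m * n)
  ^-* a m zero    = ≈-reflexive (cong (a ^_) (sym (ℕ.*-zeroʳ m)))
  ^-* a m (suc n) = begin
    a ^ m ⊗ (a ^ m) ^ n   ≈⟨ *-congˡ (^-* a m n) ⟩
    a ^ m ⊗ a ^ (m * n)   ≈⟨ ^-+ a m (m * n) ⟨
    a ^ (m + m * n)       ≡⟨ cong (a ^_) (ℕ.*-suc m n) ⟨
    a ^ (m * suc n)       ∎
    where open ≈-Reasoning

  ∏ : ℕ → (ℕ → Carrier) → Carrier
  ∏ zero    u = 𝟙
  ∏ (suc n) u = ∏ n u ⊗ u n

  ∏-cong : ∀ n {u v} → (∀ i → u i ≈ v i) → ∏ n u ≈ ∏ n v
  ∏-cong zero    p = ≈-refl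
  ∏-cong (suc n) p = *-cong (∏-cong n p) (p n)

  ∏-⊗ : ∀ n u v → ∏ n (λ i → u i ⊗ v i) ≈ ∏ n u ⊗ ∏ n v
  ∏-⊗ zero    u v = ≈-sym (*-identityˡ 𝟙)
  ∏-⊗ (suc n) u v = ≈-trans (*-congʳ (∏-⊗ n u v))
    (solve 4 (λ a b c d → (a :* b) :* (c :* d) := (a :* c) :* (b :* d)) ≈-refl (∏ n u) (∏ n v) (u n) (v n))

  ∏-1 : ∀ n → ∏ n (λ _ → 𝟙) ≈ 𝟙
  ∏-1 zero    = ≈-refl
  ∏-1 (suc n) = ≈-trans (*-identityʳ _) (∏-1 n)

  ∏-+ : ∀ m n u → ∏ (m + n) u ≈ ∏ m u ⊗ ∏ n (λ i → u (m + i))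
  ∏-+ m zero    u = ≈-trans (≈-reflexive (cong (λ k → ∏ k u) (ℕ.+-identityʳ m))) (≈-sym (*-identityʳ _))
  ∏-+ m (suc n) u = begin
    ∏ (m + suc n) u                               ≡⟨ cong (λ k → ∏ k u) (ℕ.+-suc m n) ⟩
    ∏ (m + n) u ⊗ u (m + n)                       ≈⟨ *-congʳ (∏-+ m n u) ⟩
    ∏ m u ⊗ ∏ n (λ i → u (m + i)) ⊗ u (m + n)     ≈⟨ *-assoc _ _ _ ⟩
    ∏ m u ⊗ ∏ (suc n) (λ i → u (m + i))           ∎
    where open ≈-Reasoning

  ∏-front : ∀ n u → ∏ (suc n) u ≈ u 0 ⊗ ∏ n (λ i → u (suc i))
  ∏-front n u = ≈-trans (∏-+ 1 n u) (*-congʳ (*-identityˡ (u 0)))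

  ∏-comm : ∀ m n (u : ℕ → ℕ → Carrier) → ∏ m (λ i → ∏ n (u i)) ≈ ∏ n (λ j → ∏ m (λ i → u i j))
  ∏-comm m zero    u = ∏-1 m
  ∏-comm m (suc n) u = ≈-trans (∏-⊗ m (λ i → ∏ n (u i)) (λ i → u i n)) (*-congʳ (∏-comm m n u))

  ∏-blocks : ∀ n k u → ∏ (n * k) u ≈ ∏ n (λ i → ∏ k (λ j → u (i * k + j)))
  ∏-blocks zero    k u = ≈-refl
  ∏-blocks (suc n) k u = begin
    ∏ (k + n * k) u                            ≡⟨ cong (λ l → ∏ l u) (ℕ.+-comm k (n * k)) ⟩
    ∏ (n * k + k) u                            ≈⟨ ∏-+ (n * k) k u ⟩
    ∏ (n * k) u ⊗ ∏ k (λ j → u (n * k + j))    ≈⟨ *-congʳ (∏-blocks n k u) ⟩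
    ∏ (suc n) (λ i → ∏ k (λ j → u (i * k + j))) ∎
    where open ≈-Reasoning

  ∑ : ℕ → (ℕ → Carrier) → Carrier
  ∑ zero    g = 𝟘
  ∑ (suc n) g = ∑ n g ⊕ g n

  ∑-cong : ∀ n {g h} → (∀ i → g i ≈ h i) → ∑ n g ≈ ∑ n h
  ∑-cong zero    p = ≈-refl
  ∑-cong (suc n) p = +-cong (∑-cong n p) (p n)

  ∑-cong< : ∀ n {g h} → (∀ i → i < n → g i ≈ h i) → ∑ n g ≈ ∑ n h
  ∑-cong< zero    p = ≈-refl
  ∑-cong< (suc n) p = +-cong (∑-cong< n (λ i l → p i (ℕ.m<n⇒m<1+n l))) (p n ℕ.≤-refl)

  ∑-⊕ : ∀ n g h → ∑ n (λ i → g i ⊕ h i) ≈ ∑ n g ⊕ ∑ n h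
  ∑-⊕ zero    g h = ≈-sym (+-identityˡ 𝟘)
  ∑-⊕ (suc n) g h = ≈-trans (+-congʳ (∑-⊕ n g h))
    (solve 4 (λ a b c d → (a :+ b) :+ (c :+ d) := (a :+ c) :+ (b :+ d)) ≈-refl (∑ n g) (∑ n h) (g n) (h n))

  ∑-0 : ∀ n → ∑ n (λ _ → 𝟘) ≈ 𝟘
  ∑-0 zero    = ≈-refl
  ∑-0 (suc n) = ≈-trans (+-identityʳ _) (∑-0 n)

  ∑-distribˡ : ∀ n c g → c ⊗ ∑ n g ≈ ∑ n (λ i → c ⊗ g i)
  ∑-distribˡ zero    c g = zeroʳ c
  ∑-distribˡ (suc n) c g = ≈-trans (distribˡ c (∑ n g) (g n)) (+-congʳ (∑-distribˡ n c g))

  ∑-comm : ∀ m n (g : ℕ → ℕ → Carrier) → ∑ m (λ i → ∑ n (g i)) ≈ ∑ n (λ j → ∑ m (λ i → g i j))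
  ∑-comm m zero    g = ∑-0 m
  ∑-comm m (suc n) g = ≈-trans (∑-⊕ m (λ i → ∑ n (g i)) (λ i → g i n)) (+-congʳ (∑-comm m n g))

  ∑-+ : ∀ m n g → ∑ (m + n) g ≈ ∑ m g ⊕ ∑ n (λ i → g (m + i))
  ∑-+ m zero    g = ≈-trans (≈-reflexive (cong (λ k → ∑ k g) (ℕ.+-identityʳ m))) (≈-sym (+-identityʳ _))
  ∑-+ m (suc n) g = begin
    ∑ (m + suc n) g                               ≡⟨ cong (λ k → ∑ k g) (ℕ.+-suc m n) ⟩
    ∑ (m + n) g ⊕ g (m + n)                       ≈⟨ +-congʳ (∑-+ m n g) ⟩
    ∑ m g ⊕ ∑ n (λ i → g (m + i)) ⊕ g (m + n)     ≈⟨ +-assoc _ _ _ ⟩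
    ∑ m g ⊕ ∑ (suc n) (λ i → g (m + i))           ∎
    where open ≈-Reasoning

  ∑-front : ∀ n g → ∑ (suc n) g ≈ g 0 ⊕ ∑ n (λ i → g (suc i))
  ∑-front n g = ≈-trans (∑-+ 1 n g) (+-congʳ (+-identityˡ (g 0)))

  geometric : ∀ x n → (𝟙 ⊕ ⊝ x) ⊗ ∑ n (x ^_) ≈ 𝟙 ⊕ ⊝ x ^ n
  geometric x zero    = ≈-trans (zeroʳ _) (≈-sym (CommutativeRing.-‿inverseʳ R 𝟙))
  geometric x (suc n) = begin
    (𝟙 ⊕ ⊝ x) ⊗ (∑ n (x ^_) ⊕ x ^ n)                   ≈⟨ distribˡ _ _ _ ⟩
    (𝟙 ⊕ ⊝ x) ⊗ ∑ n (x ^_) ⊕ (𝟙 ⊕ ⊝ x) ⊗ x ^ n         ≈⟨ +-congʳ (geometric x n) ⟩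
    (𝟙 ⊕ ⊝ x ^ n) ⊕ (𝟙 ⊕ ⊝ x) ⊗ x ^ n                  ≈⟨ solve 2 (λ x y → (con 1ℤ :+ :- y) :+ (con 1ℤ :+ :- x) :* y := con 1ℤ :+ :- (x :* y)) ≈-refl x (x ^ n) ⟩
    𝟙 ⊕ ⊝ x ^ suc n                                    ∎
    where open ≈-Reasoning

  -- Bilateral sums of finitely supported functions

  -- Sums over the integers in [-n, n).
  ∑ℤ : ℕ → (ℤ → Carrier) → Carrier
  ∑ℤ n g = ∑ n (λ i → g (+ i) ⊕ g -[1+ i ])

  VanishesFrom : ℕ → (ℤ → Carrier) → Set
  VanishesFrom n g = ∀ i → n ≤ ∣ i ∣ → g i ≈ 𝟘

  ∑ℤ-cong : ∀ n {g h} → (∀ i → g i ≈ h i) → ∑ℤ n g ≈ ∑ℤ n h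
  ∑ℤ-cong n p = ∑-cong n (λ i → +-cong (p (+ i)) (p -[1+ i ]))

  ∑ℤ-cong≤ : ∀ n {g h} → (∀ i → ∣ i ∣ ≤ n → g i ≈ h i) → ∑ℤ n g ≈ ∑ℤ n h
  ∑ℤ-cong≤ n p = ∑-cong< n (λ i i<n → +-cong (p (+ i) (ℕ.<⇒≤ i<n)) (p -[1+ i ] i<n))

  ∑ℤ-⊕ : ∀ n g h → ∑ℤ n (λ i → g i ⊕ h i) ≈ ∑ℤ n g ⊕ ∑ℤ n h
  ∑ℤ-⊕ n g h = ≈-trans
    (∑-cong n (λ i → solve 4 (λ a b c d → (a :+ b) :+ (c :+ d) := (a :+ c) :+ (b :+ d)) ≈-refl (g (+ i)) (h (+ i)) (g -[1+ i ]) (h -[1+ i ])))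
    (∑-⊕ n _ _)

  ∑ℤ-distribˡ : ∀ n c g → c ⊗ ∑ℤ n g ≈ ∑ℤ n (λ i → c ⊗ g i)
  ∑ℤ-distribˡ n c g = ≈-trans (∑-distribˡ n c _) (∑-cong n (λ i → distribˡ c _ _))

  ∑ℤ-⊗ : ∀ m n g h → ∑ℤ m g ⊗ ∑ℤ n h ≈ ∑ℤ m (λ i → ∑ℤ n (λ j → g i ⊗ h j))
  ∑ℤ-⊗ m n g h = begin
    ∑ℤ m g ⊗ ∑ℤ n h                        ≈⟨ *-comm _ _ ⟩
    ∑ℤ n h ⊗ ∑ℤ m g                        ≈⟨ ∑ℤ-distribˡ m _ g ⟩
    ∑ℤ m (λ i → ∑ℤ n h ⊗ g i)              ≈⟨ ∑ℤ-cong m (λ i → ≈-trans (*-comm _ _) (∑ℤ-distribˡ n (g i) h)) ⟩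
    ∑ℤ m (λ i → ∑ℤ n (λ j → g i ⊗ h j))    ∎
    where open ≈-Reasoning

  ∑ℤ-comm : ∀ m n (g : ℤ → ℤ → Carrier) → ∑ℤ m (λ i → ∑ℤ n (g i)) ≈ ∑ℤ n (λ j → ∑ℤ m (λ i → g i j))
  ∑ℤ-comm m n g = begin
    ∑ m (λ i → ∑ℤ n (g (+ i)) ⊕ ∑ℤ n (g -[1+ i ]))
      ≈⟨ ∑-cong m (λ i → ∑ℤ-⊕ n (g (+ i)) (g -[1+ i ])) ⟨
    ∑ m (λ i → ∑ n (λ j → (g (+ i) (+ j) ⊕ g -[1+ i ] (+ j)) ⊕ (g (+ i) -[1+ j ] ⊕ g -[1+ i ] -[1+ j ])))
      ≈⟨ ∑-comm m n _ ⟩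
    ∑ n (λ j → ∑ m (λ i → (g (+ i) (+ j) ⊕ g -[1+ i ] (+ j)) ⊕ (g (+ i) -[1+ j ] ⊕ g -[1+ i ] -[1+ j ])))
      ≈⟨ ∑-cong n (λ j → ∑-⊕ m _ _) ⟩
    ∑ℤ n (λ j → ∑ℤ m (λ i → g i j)) ∎
    where open ≈-Reasoning

  ∑ℤ-stable : ∀ {m n g} → VanishesFrom m g → m ≤ n → ∑ℤ n g ≈ ∑ℤ m g
  ∑ℤ-stable {m} {n} {g} v m≤n = begin
    ∑ℤ n g                 ≡⟨ cong (λ k → ∑ℤ k g) (ℕ.m+[n∸m]≡n m≤n) ⟨
    ∑ℤ (m + (n ∸ m)) g     ≈⟨ ∑-+ m (n ∸ m) _ ⟩
    ∑ℤ m g ⊕ ∑ (n ∸ m) (λ i → g (+ (m + i)) ⊕ g -[1+ m + i ])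
      ≈⟨ +-congˡ (≈-trans (∑-cong (n ∸ m) (λ i → ≈-trans (+-cong (v (+ (m + i)) (ℕ.m≤m+n m i))
           (v -[1+ m + i ] (ℕ.m≤n⇒m≤1+n (ℕ.m≤m+n m i)))) (+-identityʳ 𝟘))) (∑-0 (n ∸ m))) ⟩
    ∑ℤ m g ⊕ 𝟘             ≈⟨ +-identityʳ _ ⟩
    ∑ℤ m g                 ∎
    where open ≈-Reasoning

  VanishesFrom-shift : ∀ {n g} c → VanishesFrom n g → VanishesFrom (n + ∣ c ∣) (λ i → g (i +ℤ c))
  VanishesFrom-shift {n} c v i n+c≤i = v (i +ℤ c) (ℕ.+-cancelʳ-≤ ∣ c ∣ _ _ (begin
    n + ∣ c ∣                       ≤⟨ n+c≤i ⟩
    ∣ i ∣                           ≡⟨ cong ∣_∣ (cancel i c) ⟩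
    ∣ i +ℤ c +ℤ - c ∣               ≤⟨ ℤ.∣i+j∣≤∣i∣+∣j∣ (i +ℤ c) (- c) ⟩
    ∣ i +ℤ c ∣ + ∣ - c ∣            ≡⟨ cong (λ k → ∣ i +ℤ c ∣ + k) (ℤ.∣-i∣≡∣i∣ c) ⟩
    ∣ i +ℤ c ∣ + ∣ c ∣              ∎))
    where
    open ℕ.≤-Reasoning
    cancel : ∀ i c → i ≡ i +ℤ c +ℤ - c
    cancel = ℤ.solve-∀

  -- Translation by one moves the window [-n, n) to (-n, n]; adding the missing end on each side
  -- gives the sum over [-n, n]. Stated without subtraction and without any vanishing.
  ∑ℤ-telescope : ∀ n g → ∑ℤ n (λ i → g (1ℤ +ℤ i)) ⊕ g (- (+ n)) ≈ ∑ℤ n g ⊕ g (+ n)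
  ∑ℤ-telescope zero    g = ≈-refl
  ∑ℤ-telescope (suc n) g = begin
    ∑ℤ n g′ ⊕ (g (+ suc n) ⊕ g (1ℤ +ℤ -[1+ n ])) ⊕ g -[1+ n ]
      ≡⟨ cong (λ k → ∑ℤ n g′ ⊕ (g (+ suc n) ⊕ g k) ⊕ g -[1+ n ]) (suc-neg n) ⟩
    ∑ℤ n g′ ⊕ (g (+ suc n) ⊕ g (- (+ n))) ⊕ g -[1+ n ]
      ≈⟨ solve 4 (λ a b c d → a :+ (b :+ c) :+ d := (a :+ c) :+ d :+ b) ≈-refl (∑ℤ n g′) _ _ _ ⟩
    (∑ℤ n g′ ⊕ g (- (+ n))) ⊕ g -[1+ n ] ⊕ g (+ suc n)
      ≈⟨ +-congʳ (+-congʳ (∑ℤ-telescope n g)) ⟩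
    (∑ℤ n g ⊕ g (+ n)) ⊕ g -[1+ n ] ⊕ g (+ suc n)
      ≈⟨ +-congʳ (+-assoc _ _ _) ⟩
    ∑ℤ (suc n) g ⊕ g (+ suc n) ∎
    where
    open ≈-Reasoning
    g′ = λ i → g (1ℤ +ℤ i)
    suc-neg : ∀ n → 1ℤ +ℤ -[1+ n ] ≡ - (+ n)
    suc-neg zero    = refl
    suc-neg (suc n) = refl

  ∑ℤ-suc : ∀ {m n g} → VanishesFrom m g → m ≤ n → ∑ℤ n (λ i → g (1ℤ +ℤ i)) ≈ ∑ℤ n g
  ∑ℤ-suc {m} {n} {g} v m≤n = begin
    ∑ℤ n (λ i → g (1ℤ +ℤ i))                    ≈⟨ +-identityʳ _ ⟨
    ∑ℤ n (λ i → g (1ℤ +ℤ i)) ⊕ 𝟘                ≈⟨ +-congˡ (v (- (+ n)) (subst (m ≤_) (sym (ℤ.∣-i∣≡∣i∣ (+ n))) m≤n)) ⟨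
    ∑ℤ n (λ i → g (1ℤ +ℤ i)) ⊕ g (- (+ n))      ≈⟨ ∑ℤ-telescope n g ⟩
    ∑ℤ n g ⊕ g (+ n)                            ≈⟨ +-congˡ (v (+ n) m≤n) ⟩
    ∑ℤ n g ⊕ 𝟘                                  ≈⟨ +-identityʳ _ ⟩
    ∑ℤ n g                                      ∎
    where open ≈-Reasoning

  -- Each unit step is `∑ℤ-suc` for a function that is already translated, whose support has widened
  -- by the steps taken so far; the slack `m + ∣ c ∣ ≤ n` pays for all of them.
  ∑ℤ-shift : ∀ {m n g} c → VanishesFrom m g → m + ∣ c ∣ ≤ n → ∑ℤ n (λ i → g (i +ℤ c)) ≈ ∑ℤ n g
  ∑ℤ-shift {n = n} {g} (+ zero) v l = ∑ℤ-cong n (λ i → ≈-reflexive (cong g (ℤ.+-identityʳ i)))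
  ∑ℤ-shift {m} {n} {g} (+ suc c) v l = begin
    ∑ℤ n (λ i → g (i +ℤ + suc c))          ≈⟨ ∑ℤ-cong n (λ i → ≈-reflexive (cong g (assoc i (+ c)))) ⟩
    ∑ℤ n (λ i → g (1ℤ +ℤ i +ℤ + c))        ≈⟨ ∑ℤ-suc (VanishesFrom-shift (+ c) v) m+c≤n ⟩
    ∑ℤ n (λ i → g (i +ℤ + c))              ≈⟨ ∑ℤ-shift (+ c) v m+c≤n ⟩
    ∑ℤ n g                                 ∎
    where
    open ≈-Reasoning
    m+c≤n : m + c ≤ n
    m+c≤n = ℕ.≤-trans (ℕ.+-monoʳ-≤ m (ℕ.n≤1+n c)) l
    assoc : ∀ i c → i +ℤ (1ℤ +ℤ c) ≡ 1ℤ +ℤ i +ℤ c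
    assoc = ℤ.solve-∀
  ∑ℤ-shift {m} {n} {g} -[1+ c ] v l = shiftDown (suc c) l
    where
    open ≈-Reasoning
    assoc : ∀ i c → 1ℤ +ℤ i +ℤ (- 1ℤ +ℤ - c) ≡ i +ℤ - c
    assoc = ℤ.solve-∀
    shiftDown : ∀ c → m + c ≤ n → ∑ℤ n (λ i → g (i +ℤ - (+ c))) ≈ ∑ℤ n g
    shiftDown zero    l = ∑ℤ-cong n (λ i → ≈-reflexive (cong g (ℤ.+-identityʳ i)))
    shiftDown (suc c) l = begin
      ∑ℤ n (λ i → g (i +ℤ -[1+ c ]))              ≈⟨ ∑ℤ-suc (VanishesFrom-shift -[1+ c ] v) l ⟨
      ∑ℤ n (λ i → g (1ℤ +ℤ i +ℤ -[1+ c ]))        ≈⟨ ∑ℤ-cong n (λ i → ≈-reflexive (cong g (trans (cong (1ℤ +ℤ i +ℤ_) (ℤ.neg-distrib-+ 1ℤ (+ c))) (assoc i (+ c))))) ⟩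
      ∑ℤ n (λ i → g (i +ℤ - (+ c)))               ≈⟨ shiftDown c (ℕ.≤-trans (ℕ.+-monoʳ-≤ m (ℕ.n≤1+n c)) l) ⟩
      ∑ℤ n g                                      ∎

  -- The half-open window makes this exact: for i in [-n, n) the numbers 2i and 2i + 1 together run
  -- once through [-2n, 2n), with no boundary terms.
  ∑ℤ-parity : ∀ n g → ∑ℤ (n + n) g ≈ ∑ℤ n (λ i → g (i +ℤ i)) ⊕ ∑ℤ n (λ i → g (1ℤ +ℤ (i +ℤ i)))
  ∑ℤ-parity zero    g = ≈-sym (+-identityˡ 𝟘)
  ∑ℤ-parity (suc n) g = begin
    ∑ℤ (suc (n + suc n)) g
      ≡⟨ cong (λ k → ∑ℤ (suc k) g) (ℕ.+-suc n n) ⟩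
    ∑ℤ (n + n) g ⊕ (g (+ (n + n)) ⊕ g -[1+ n + n ]) ⊕ (g (+ suc (n + n)) ⊕ g -[1+ suc (n + n) ])
      ≈⟨ +-congʳ (+-congʳ (∑ℤ-parity n g)) ⟩
    (E ⊕ O) ⊕ (g (+ (n + n)) ⊕ g -[1+ n + n ]) ⊕ (g (+ suc (n + n)) ⊕ g -[1+ suc (n + n) ])
      ≈⟨ solve 6 (λ E O a b c d → (E :+ O) :+ (a :+ b) :+ (c :+ d) := (E :+ (a :+ d)) :+ (O :+ (c :+ b))) ≈-refl E O _ _ _ _ ⟩
    (E ⊕ (g (+ (n + n)) ⊕ g -[1+ suc (n + n) ])) ⊕ (O ⊕ (g (+ suc (n + n)) ⊕ g -[1+ n + n ])) ∎
    where
    open ≈-Reasoning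
    E = ∑ℤ n (λ i → g (i +ℤ i))
    O = ∑ℤ n (λ i → g (1ℤ +ℤ (i +ℤ i)))

  ∑-⊖ : ∀ n g → ∑ (n + n) (λ j → g (j ⊖ n)) ≈ ∑ℤ n g
  ∑-⊖ n g = begin
    ∑ (n + n) (λ j → g (j ⊖ n))                            ≈⟨ ∑-+ n n _ ⟩
    ∑ n (λ j → g (j ⊖ n)) ⊕ ∑ n (λ j → g (n + j ⊖ n))      ≈⟨ +-cong (negative n) (∑-cong n (λ j → ≈-reflexive (cong g (nonnegative n j)))) ⟩
    ∑ n (λ j → g -[1+ j ]) ⊕ ∑ n (λ j → g (+ j))           ≈⟨ +-comm _ _ ⟩
    ∑ n (λ j → g (+ j)) ⊕ ∑ n (λ j → g -[1+ j ])           ≈⟨ ∑-⊕ n _ _ ⟨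
    ∑ℤ n g                                                 ∎
    where
    open ≈-Reasoning
    nonnegative : ∀ n j → n + j ⊖ n ≡ + j
    nonnegative zero    j = refl
    nonnegative (suc n) j = trans (ℤ.[1+m]⊖[1+n]≡m⊖n (n + j) n) (nonnegative n j)
    negative : ∀ n → ∑ n (λ j → g (j ⊖ n)) ≈ ∑ n (λ j → g -[1+ j ])
    negative zero    = ≈-refl
    negative (suc n) = begin
      ∑ (suc n) (λ j → g (j ⊖ suc n))                     ≈⟨ ∑-front n _ ⟩
      g -[1+ n ] ⊕ ∑ n (λ j → g (suc j ⊖ suc n))          ≈⟨ +-congˡ (∑-cong n (λ j → ≈-reflexive (cong g (ℤ.[1+m]⊖[1+n]≡m⊖n j n)))) ⟩
      g -[1+ n ] ⊕ ∑ n (λ j → g (j ⊖ n))                  ≈⟨ +-congˡ (negative n) ⟩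
      g -[1+ n ] ⊕ ∑ n (λ j → g -[1+ j ])                 ≈⟨ +-comm _ _ ⟩
      ∑ (suc n) (λ j → g -[1+ j ])                        ∎

  -- Units and cancellation

  Unit : Carrier → Set
  Unit a = ∃ λ v → a ⊗ v ≈ 𝟙

  unit-⊗ : ∀ {a b} → Unit a → Unit b → Unit (a ⊗ b)
  unit-⊗ {a} {b} (v , av) (w , bw) = v ⊗ w , (begin
    a ⊗ b ⊗ (v ⊗ w)       ≈⟨ solve 4 (λ a b v w → a :* b :* (v :* w) := (a :* v) :* (b :* w)) ≈-refl a b v w ⟩
    (a ⊗ v) ⊗ (b ⊗ w)     ≈⟨ *-cong av bw ⟩
    𝟙 ⊗ 𝟙                 ≈⟨ *-identityˡ 𝟙 ⟩
    𝟙                     ∎)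
    where open ≈-Reasoning

  unit-∏ : ∀ n {u} → (∀ i → Unit (u i)) → Unit (∏ n u)
  unit-∏ zero    p = 𝟙 , *-identityˡ 𝟙
  unit-∏ (suc n) p = unit-⊗ (unit-∏ n p) (p n)

  unit-cancel : ∀ {a b c} → Unit a → a ⊗ b ≈ a ⊗ c → b ≈ c
  unit-cancel {a} {b} {c} (v , av) p = begin
    b              ≈⟨ *-identityˡ b ⟨
    𝟙 ⊗ b          ≈⟨ *-congʳ av ⟨
    a ⊗ v ⊗ b      ≈⟨ solve 3 (λ a v b → a :* v :* b := v :* (a :* b)) ≈-refl a v b ⟩
    v ⊗ (a ⊗ b)    ≈⟨ *-congˡ p ⟩
    v ⊗ (a ⊗ c)    ≈⟨ solve 3 (λ a v b → v :* (a :* b) := a :* v :* b) ≈-refl a v c ⟩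
    a ⊗ v ⊗ c      ≈⟨ *-congʳ av ⟩
    𝟙 ⊗ c          ≈⟨ *-identityˡ c ⟩
    c              ∎
    where open ≈-Reasoning

  -- Clears the denominator of a generating function given as `N ⊗ I`, where `I` inverts `D`;
  -- meanwhile numerator and denominator pass to their product forms `N′` and `D′`.
  quotient-* : ∀ {N D I N′ D′} → N ≈ N′ → D ≈ D′ → D ⊗ I ≈ 𝟙 → N ⊗ I ⊗ D′ ≈ N′
  quotient-* {N} {D} {I} {N′} {D′} N≈N′ D≈D′ DI≈𝟙 = begin
    N ⊗ I ⊗ D′       ≈⟨ *-cong (*-congʳ N≈N′) (≈-sym D≈D′) ⟩
    N′ ⊗ I ⊗ D       ≈⟨ solve 3 (λ n i d → n :* i :* d := n :* (d :* i)) ≈-refl N′ I D ⟩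
    N′ ⊗ (D ⊗ I)     ≈⟨ *-congˡ DI≈𝟙 ⟩
    N′ ⊗ 𝟙           ≈⟨ *-identityʳ N′ ⟩
    N′               ∎
    where open ≈-Reasoning

  -- Gaussian binomials and the finite triple product

  module Binomials (Q : Carrier) where

    pochhammer : ℕ → Carrier
    pochhammer n = ∏ n (λ i → 𝟙 ⊕ ⊝ Q ^ suc i)

    -- The Gaussian binomial coefficient, by the q-Pascal rule: for an arbitrary `Q` the quotient of
    -- Pochhammer symbols need not make sense.
    binomial : ℕ → ℕ → Carrier
    binomial n       zero    = 𝟙
    binomial zero    (suc k) = 𝟘
    binomial (suc n) (suc k) = binomial n k ⊕ Q ^ suc k ⊗ binomial n (suc k)

    binomial-zero : ∀ {n k} → n < k → binomial n k ≈ 𝟘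
    binomial-zero {zero}  {suc k} _       = ≈-refl
    binomial-zero {suc n} {suc k} (s≤s p) = begin
      binomial n k ⊕ Q ^ suc k ⊗ binomial n (suc k)    ≈⟨ +-cong (binomial-zero p) (*-congˡ (binomial-zero (ℕ.m≤n⇒m≤1+n p))) ⟩
      𝟘 ⊕ Q ^ suc k ⊗ 𝟘                                ≈⟨ +-identityˡ _ ⟩
      Q ^ suc k ⊗ 𝟘                                    ≈⟨ zeroʳ _ ⟩
      𝟘                                                ∎
      where open ≈-Reasoning

    binomial-diagonal : ∀ n → binomial n n ≈ 𝟙
    binomial-diagonal zero    = ≈-refl
    binomial-diagonal (suc n) = begin
      binomial n n ⊕ Q ^ suc n ⊗ binomial n (suc n)    ≈⟨ +-cong (binomial-diagonal n) (*-congˡ (binomial-zero {n} ℕ.≤-refl)) ⟩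
      𝟙 ⊕ Q ^ suc n ⊗ 𝟘                                ≈⟨ +-congˡ (zeroʳ _) ⟩
      𝟙 ⊕ 𝟘                                            ≈⟨ +-identityʳ 𝟙 ⟩
      𝟙                                                ∎
      where open ≈-Reasoning

    -- The factorial formula without division, with n = j + k to avoid subtraction. After the Pascal
    -- rule both summands contain the Pochhammer symbol of order n - 1, and (1 - x) + x(1 - y) = 1 -
    -- xy finishes, with x = Q^(j+1) and y = Q^(k+1).
    binomial-pochhammer : ∀ j k → binomial (j + k) j ⊗ (pochhammer j ⊗ pochhammer k) ≈ pochhammer (j + k)
    binomial-pochhammer zero    k = ≈-trans (*-identityˡ _) (*-identityˡ _)
    binomial-pochhammer (suc j) zero = begin
      binomial (suc j + 0) (suc j) ⊗ (pochhammer (suc j) ⊗ 𝟙)    ≈⟨ *-cong (≈-trans (≈-reflexive (cong (λ n → binomial n (suc j)) (ℕ.+-identityʳ (suc j)))) (binomial-diagonal (suc j))) (*-identityʳ _) ⟩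
      𝟙 ⊗ pochhammer (suc j)                                    ≈⟨ *-identityˡ _ ⟩
      pochhammer (suc j)                                        ≡⟨ cong pochhammer (ℕ.+-identityʳ (suc j)) ⟨
      pochhammer (suc j + 0)                                    ∎
      where open ≈-Reasoning
    binomial-pochhammer (suc j) (suc k) = begin
      (b₁ ⊕ x ⊗ b₂) ⊗ ((pochhammer j ⊗ (𝟙 ⊕ ⊝ x)) ⊗ (pochhammer k ⊗ (𝟙 ⊕ ⊝ y)))
        ≈⟨ solve 6 (λ b₁ b₂ x y p r → (b₁ :+ x :* b₂) :* ((p :* (con 1ℤ :+ :- x)) :* (r :* (con 1ℤ :+ :- y)))
              := (con 1ℤ :+ :- x) :* (b₁ :* (p :* (r :* (con 1ℤ :+ :- y)))) :+ x :* (con 1ℤ :+ :- y) :* (b₂ :* ((p :* (con 1ℤ :+ :- x)) :* r)))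
              ≈-refl b₁ b₂ x y (pochhammer j) (pochhammer k) ⟩
      (𝟙 ⊕ ⊝ x) ⊗ (b₁ ⊗ (pochhammer j ⊗ pochhammer (suc k))) ⊕ x ⊗ (𝟙 ⊕ ⊝ y) ⊗ (b₂ ⊗ (pochhammer (suc j) ⊗ pochhammer k))
        ≈⟨ +-cong (*-congˡ (binomial-pochhammer j (suc k)))
                  (*-congˡ (≈-trans (*-congʳ (≈-reflexive (cong (λ n → binomial n (suc j)) (ℕ.+-suc j k))))
                             (≈-trans (binomial-pochhammer (suc j) k) (≈-reflexive (cong pochhammer (sym (ℕ.+-suc j k))))))) ⟩
      (𝟙 ⊕ ⊝ x) ⊗ pochhammer (j + suc k) ⊕ x ⊗ (𝟙 ⊕ ⊝ y) ⊗ pochhammer (j + suc k)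
        ≈⟨ solve 3 (λ x y p → (con 1ℤ :+ :- x) :* p :+ x :* (con 1ℤ :+ :- y) :* p := p :* (con 1ℤ :+ :- (x :* y))) ≈-refl x y (pochhammer (j + suc k)) ⟩
      pochhammer (j + suc k) ⊗ (𝟙 ⊕ ⊝ (x ⊗ y))
        ≈⟨ *-congˡ (+-congˡ (-‿cong (^-+ Q (suc j) (suc k)))) ⟨
      pochhammer (suc j + suc k) ∎
      where
      open ≈-Reasoning
      x = Q ^ suc j
      y = Q ^ suc k
      b₁ = binomial (j + suc k) j
      b₂ = binomial (j + suc k) (suc j)

    -- x^k Q^(k choose 2)
    power : Carrier → ℕ → Carrier
    power x zero    = 𝟙
    power x (suc k) = x ⊗ Q ^ k ⊗ power x k

    power-Q : ∀ x k → power (x ⊗ Q) k ≈ Q ^ k ⊗ power x k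
    power-Q x zero    = ≈-sym (*-identityˡ 𝟙)
    power-Q x (suc k) = ≈-trans (*-congˡ (power-Q x k))
      (solve 4 (λ x Q a p → x :* Q :* a :* (a :* p) := Q :* a :* (x :* a :* p)) ≈-refl x Q (Q ^ k) (power x k))

    power-suc : ∀ x k → power x (suc k) ≈ x ⊗ power (x ⊗ Q) k
    power-suc x k = ≈-trans (*-assoc _ _ _) (*-congˡ (≈-sym (power-Q x k)))

    -- Splitting off the factor 1 + x leaves the same product at xQ. As `power (x ⊗ Q) k` is Q^k
    -- times `power x k`, the two resulting sums recombine by the Pascal rule.
    q-binomial-theorem : ∀ n x → ∏ n (λ i → 𝟙 ⊕ x ⊗ Q ^ i) ≈ ∑ (suc n) (λ k → power x k ⊗ binomial n k)
    q-binomial-theorem zero x = ≈-sym (≈-trans (+-identityˡ _) (*-identityˡ 𝟙))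
    q-binomial-theorem (suc n) x = begin
      ∏ (suc n) (λ i → 𝟙 ⊕ x ⊗ Q ^ i)
        ≈⟨ ∏-front n _ ⟩
      (𝟙 ⊕ x ⊗ 𝟙) ⊗ ∏ n (λ i → 𝟙 ⊕ x ⊗ (Q ⊗ Q ^ i))
        ≈⟨ *-cong (+-congˡ (*-identityʳ x)) (∏-cong n (λ i → +-congˡ (≈-sym (*-assoc x Q (Q ^ i))))) ⟩
      (𝟙 ⊕ x) ⊗ ∏ n (λ i → 𝟙 ⊕ x ⊗ Q ⊗ Q ^ i)
        ≈⟨ *-congˡ (q-binomial-theorem n (x ⊗ Q)) ⟩
      (𝟙 ⊕ x) ⊗ S
        ≈⟨ solve 2 (λ x S → (con 1ℤ :+ x) :* S := S :+ x :* S) ≈-refl x S ⟩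
      S ⊕ x ⊗ S
        ≈⟨ +-cong front (∑-distribˡ (suc n) x _) ⟩
      (𝟙 ⊗ 𝟙 ⊕ ∑ (suc n) (λ k → power (x ⊗ Q) (suc k) ⊗ binomial n (suc k))) ⊕ ∑ (suc n) (λ k → x ⊗ (power (x ⊗ Q) k ⊗ binomial n k))
        ≈⟨ ≈-trans (+-assoc _ _ _) (+-congˡ (≈-sym (∑-⊕ (suc n) _ _))) ⟩
      𝟙 ⊗ 𝟙 ⊕ ∑ (suc n) (λ k → power (x ⊗ Q) (suc k) ⊗ binomial n (suc k) ⊕ x ⊗ (power (x ⊗ Q) k ⊗ binomial n k))
        ≈⟨ +-congˡ (∑-cong (suc n) (λ k → ≈-trans (+-cong (*-congʳ (power-Q x (suc k))) (≈-trans (≈-sym (*-assoc _ _ _)) (*-congʳ (≈-sym (power-suc x k)))))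
             (solve 4 (λ Q p b₂ b₁ → Q :* p :* b₂ :+ p :* b₁ := p :* (b₁ :+ Q :* b₂)) ≈-refl (Q ^ suc k) (power x (suc k)) (binomial n (suc k)) (binomial n k)))) ⟩
      𝟙 ⊗ 𝟙 ⊕ ∑ (suc n) (λ k → power x (suc k) ⊗ binomial (suc n) (suc k))
        ≈⟨ ∑-front (suc n) _ ⟨
      ∑ (suc (suc n)) (λ k → power x k ⊗ binomial (suc n) k) ∎
      where
      open ≈-Reasoning
      S = ∑ (suc n) (λ k → power (x ⊗ Q) k ⊗ binomial n k)
      front : S ≈ 𝟙 ⊗ 𝟙 ⊕ ∑ (suc n) (λ k → power (x ⊗ Q) (suc k) ⊗ binomial n (suc k))
      front = begin
        S
          ≈⟨ ∑-front n _ ⟩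
        𝟙 ⊗ 𝟙 ⊕ ∑ n (λ k → power (x ⊗ Q) (suc k) ⊗ binomial n (suc k))
          ≈⟨ +-congˡ (≈-trans (+-congˡ (≈-trans (*-congˡ (binomial-zero {n} ℕ.≤-refl)) (zeroʳ _))) (+-identityʳ _)) ⟨
        𝟙 ⊗ 𝟙 ⊕ ∑ (suc n) (λ k → power (x ⊗ Q) (suc k) ⊗ binomial n (suc k)) ∎

    -- For xy = Q this is x^i Q^(i choose 2), also at negative i.
    monomial : Carrier → Carrier → ℤ → Carrier
    monomial x y (+ i)    = power x i
    monomial x y -[1+ i ] = power y (suc i)

    -- The monomial at i is xQ^(i-1) times the one at i - 1, and for i = j - b the factors collapse:
    -- yQ^b times xQ^(j-b-1) is Q^j. The recursion on j and b avoids negative powers of Q.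
    monomial-step : ∀ {x y} → x ⊗ y ≈ Q → ∀ j b → y ⊗ Q ^ b ⊗ monomial x y (j ⊖ b) ≈ Q ^ j ⊗ monomial x y (j ⊖ suc b)
    monomial-step {x} {y} xy zero zero = ≈-trans (*-comm _ _) (*-congˡ (≈-sym (*-identityʳ _)))
    monomial-step {x} {y} xy (suc j) zero = begin
      y ⊗ 𝟙 ⊗ (x ⊗ Q ^ j ⊗ power x j)       ≈⟨ *-congʳ (*-identityʳ y) ⟩
      y ⊗ (x ⊗ Q ^ j ⊗ power x j)           ≈⟨ solve 4 (λ x y a p → y :* (x :* a :* p) := x :* y :* a :* p) ≈-refl x y (Q ^ j) (power x j) ⟩
      x ⊗ y ⊗ Q ^ j ⊗ power x j             ≈⟨ *-congʳ (*-congʳ xy) ⟩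
      Q ^ suc j ⊗ power x j                 ∎
      where open ≈-Reasoning
    monomial-step {x} {y} xy zero (suc b) = ≈-sym (*-identityˡ _)
    monomial-step {x} {y} xy (suc j) (suc b) = begin
      y ⊗ (Q ⊗ Q ^ b) ⊗ monomial x y (suc j ⊖ suc b)      ≡⟨ cong (λ i → y ⊗ (Q ⊗ Q ^ b) ⊗ monomial x y i) (ℤ.[1+m]⊖[1+n]≡m⊖n j b) ⟩
      y ⊗ (Q ⊗ Q ^ b) ⊗ monomial x y (j ⊖ b)              ≈⟨ solve 4 (λ y Q a m → y :* (Q :* a) :* m := Q :* (y :* a :* m)) ≈-refl y Q (Q ^ b) _ ⟩
      Q ⊗ (y ⊗ Q ^ b ⊗ monomial x y (j ⊖ b))              ≈⟨ *-congˡ (monomial-step xy j b) ⟩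
      Q ⊗ (Q ^ j ⊗ monomial x y (j ⊖ suc b))              ≈⟨ *-assoc _ _ _ ⟨
      Q ^ suc j ⊗ monomial x y (j ⊖ suc b)                ≡⟨ cong (λ i → Q ^ suc j ⊗ monomial x y i) (ℤ.[1+m]⊖[1+n]≡m⊖n j (suc b)) ⟨
      Q ^ suc j ⊗ monomial x y (suc j ⊖ suc (suc b))      ∎
      where open ≈-Reasoning

    -- The usual derivation replaces x by xQ^(-b) in the q-binomial theorem, which is impossible for
    -- a nilpotent `Q`. Instead the factors in y are added one at a time: each lowers the index by
    -- `monomial-step`, and the Pascal rule absorbs the new sum.
    finite-triple-product : ∀ {x y} → x ⊗ y ≈ Q → ∀ a b →
      ∏ a (λ i → 𝟙 ⊕ x ⊗ Q ^ i) ⊗ ∏ b (λ i → 𝟙 ⊕ y ⊗ Q ^ i) ≈ ∑ (suc (b + a)) (λ j → monomial x y (j ⊖ b) ⊗ binomial (b + a) j)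
    finite-triple-product {x} {y} xy a zero    = ≈-trans (*-identityʳ _) (q-binomial-theorem a x)
    finite-triple-product {x} {y} xy a (suc b) = begin
      X ⊗ (Y ⊗ (𝟙 ⊕ y ⊗ Q ^ b))
        ≈⟨ solve 3 (λ X Y z → X :* (Y :* (con 1ℤ :+ z)) := z :* (X :* Y) :+ X :* Y) ≈-refl X Y (y ⊗ Q ^ b) ⟩
      y ⊗ Q ^ b ⊗ (X ⊗ Y) ⊕ X ⊗ Y
        ≈⟨ +-cong (*-congˡ (finite-triple-product xy a b)) (finite-triple-product xy a b) ⟩
      y ⊗ Q ^ b ⊗ ∑ (suc N) (λ j → m (j ⊖ b) ⊗ binomial N j) ⊕ ∑ (suc N) (λ j → m (j ⊖ b) ⊗ binomial N j)
        ≈⟨ +-congʳ (∑-distribˡ (suc N) _ _) ⟩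
      ∑ (suc N) (λ j → y ⊗ Q ^ b ⊗ (m (j ⊖ b) ⊗ binomial N j)) ⊕ ∑ (suc N) (λ j → m (j ⊖ b) ⊗ binomial N j)
        ≈⟨ +-congʳ (∑-cong (suc N) (λ j → ≈-trans (≈-sym (*-assoc _ _ _)) (*-congʳ (monomial-step xy j b)))) ⟩
      ∑ (suc N) (λ j → Q ^ j ⊗ m (j ⊖ suc b) ⊗ binomial N j) ⊕ ∑ (suc N) (λ j → m (j ⊖ b) ⊗ binomial N j)
        ≈⟨ +-congʳ (≈-trans (+-congˡ (≈-trans (*-congˡ (binomial-zero {N} ℕ.≤-refl)) (zeroʳ _))) (+-identityʳ _)) ⟨
      ∑ (suc (suc N)) (λ j → Q ^ j ⊗ m (j ⊖ suc b) ⊗ binomial N j) ⊕ ∑ (suc N) (λ j → m (j ⊖ b) ⊗ binomial N j)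
        ≈⟨ +-congʳ (∑-front (suc N) _) ⟩
      (𝟙 ⊗ m (0 ⊖ suc b) ⊗ 𝟙 ⊕ ∑ (suc N) (λ j → Q ^ suc j ⊗ m (suc j ⊖ suc b) ⊗ binomial N (suc j))) ⊕ ∑ (suc N) (λ j → m (j ⊖ b) ⊗ binomial N j)
        ≈⟨ ≈-trans (+-assoc _ _ _) (+-cong (*-congʳ (*-identityˡ _)) (≈-sym (∑-⊕ (suc N) _ _))) ⟩
      m (0 ⊖ suc b) ⊗ 𝟙 ⊕ ∑ (suc N) (λ j → Q ^ suc j ⊗ m (suc j ⊖ suc b) ⊗ binomial N (suc j) ⊕ m (j ⊖ b) ⊗ binomial N j)
        ≈⟨ +-congˡ (∑-cong (suc N) (λ j → ≈-trans
             (+-congˡ (*-congʳ (≈-reflexive (cong m (sym (ℤ.[1+m]⊖[1+n]≡m⊖n j b))))))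
             (solve 4 (λ p m b₂ b₁ → p :* m :* b₂ :+ m :* b₁ := m :* (b₁ :+ p :* b₂)) ≈-refl (Q ^ suc j) (m (suc j ⊖ suc b)) (binomial N (suc j)) (binomial N j)))) ⟩
      m (0 ⊖ suc b) ⊗ 𝟙 ⊕ ∑ (suc N) (λ j → m (suc j ⊖ suc b) ⊗ binomial (suc N) (suc j))
        ≈⟨ ∑-front (suc N) _ ⟨
      ∑ (suc (suc N)) (λ j → m (j ⊖ suc b) ⊗ binomial (suc N) j) ∎
      where
      open ≈-Reasoning
      N = b + a
      m = monomial x y
      X = ∏ a (λ i → 𝟙 ⊕ x ⊗ Q ^ i)
      Y = ∏ b (λ i → 𝟙 ⊕ y ⊗ Q ^ i)

  -- Infinite products when q^M = 0

  module Truncated (q : Carrier) (M : ℕ) (q^M≈0 : q ^ M ≈ 𝟘) where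

    q^-vanish : ∀ {n} → M ≤ n → q ^ n ≈ 𝟘
    q^-vanish {n} M≤n = begin
      q ^ n                   ≡⟨ cong (q ^_) (ℕ.m+[n∸m]≡n M≤n) ⟨
      q ^ (M + (n ∸ M))       ≈⟨ ^-+ q M (n ∸ M) ⟩
      q ^ M ⊗ q ^ (n ∸ M)     ≈⟨ *-congʳ q^M≈0 ⟩
      𝟘 ⊗ q ^ (n ∸ M)         ≈⟨ zeroˡ _ ⟩
      𝟘                       ∎
      where open ≈-Reasoning

    ∏-stable : ∀ {n} u → (∀ i → M ≤ i → u i ≈ 𝟙) → M ≤ n → ∏ n u ≈ ∏ M u
    ∏-stable {n} u p M≤n = begin
      ∏ n u                                          ≡⟨ cong (λ k → ∏ k u) (ℕ.m+[n∸m]≡n M≤n) ⟨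
      ∏ (M + (n ∸ M)) u                              ≈⟨ ∏-+ M (n ∸ M) u ⟩
      ∏ M u ⊗ ∏ (n ∸ M) (λ i → u (M + i))            ≈⟨ *-congˡ (≈-trans (∏-cong (n ∸ M) (λ i → p (M + i) (ℕ.m≤m+n M i))) (∏-1 (n ∸ M))) ⟩
      ∏ M u ⊗ 𝟙                                      ≈⟨ *-identityʳ _ ⟩
      ∏ M u                                          ∎
      where open ≈-Reasoning

    factor : Carrier → ℕ → ℕ → ℕ → Carrier
    factor s r m i = 𝟙 ⊕ s ⊗ q ^ (r + m * i)

    factor-tail : ∀ s r m .{{_ : NonZero m}} i → M ≤ i → factor s r m i ≈ 𝟙
    factor-tail s r m i M≤i = begin
      𝟙 ⊕ s ⊗ q ^ (r + m * i)   ≈⟨ +-congˡ (*-congˡ (q^-vanish (ℕ.≤-trans M≤i (ℕ.≤-trans (ℕ.m≤n*m i m) (ℕ.m≤n+m (m * i) r))))) ⟩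
      𝟙 ⊕ s ⊗ 𝟘                 ≈⟨ +-congˡ (zeroʳ s) ⟩
      𝟙 ⊕ 𝟘                     ≈⟨ +-identityʳ 𝟙 ⟩
      𝟙                         ∎
      where open ≈-Reasoning

    -- The product (-s q^r ; q^m)_∞.
    P : Carrier → ℕ → ℕ → Carrier
    P s r m = ∏ M (factor s r m)

    -- The truncated products have different lengths: `∏-stable` first extends the left one to M k
    -- factors, which then split by the residue of the index modulo k.
    P-dissect : ∀ k s r m .{{_ : NonZero k}} .{{_ : NonZero m}} → P s r m ≈ ∏ k (λ j → P s (r + m * j) (m * k))
    P-dissect k s r m = begin
      ∏ M (factor s r m)                                      ≈⟨ ∏-stable _ (factor-tail s r m) (ℕ.m≤m*n M k) ⟨
      ∏ (M * k) (factor s r m)                                ≈⟨ ∏-blocks M k _ ⟩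
      ∏ M (λ i → ∏ k (λ j → factor s r m (i * k + j)))        ≈⟨ ∏-comm M k _ ⟩
      ∏ k (λ j → ∏ M (λ i → factor s r m (i * k + j)))        ≈⟨ ∏-cong k (λ j → ∏-cong M (λ i → +-congˡ (*-congˡ (≈-reflexive (cong (q ^_) (regroup r m k i j)))))) ⟩
      ∏ k (λ j → P s (r + m * j) (m * k))                     ∎
      where
      open ≈-Reasoning
      regroup : ∀ r m k i j → r + m * (i * k + j) ≡ r + m * j + m * k * i
      regroup = solve-∀

    P-± : ∀ r m → P 𝟙 r m ⊗ P (⊝ 𝟙) r m ≈ P (⊝ 𝟙) (2 * r) (2 * m)
    P-± r m = ≈-trans (≈-sym (∏-⊗ M (factor 𝟙 r m) (factor (⊝ 𝟙) r m))) (∏-cong M (λ i → begin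
      factor 𝟙 r m i ⊗ factor (⊝ 𝟙) r m i
        ≈⟨ solve 1 (λ x → (con 1ℤ :+ con 1ℤ :* x) :* (con 1ℤ :+ :- con 1ℤ :* x) := con 1ℤ :+ :- con 1ℤ :* (x :* x)) ≈-refl (q ^ (r + m * i)) ⟩
      𝟙 ⊕ ⊝ 𝟙 ⊗ (q ^ (r + m * i) ⊗ q ^ (r + m * i))
        ≈⟨ +-congˡ (*-congˡ (≈-sym (^-+ q (r + m * i) (r + m * i)))) ⟩
      𝟙 ⊕ ⊝ 𝟙 ⊗ q ^ (r + m * i + (r + m * i))
        ≡⟨ cong (λ e → 𝟙 ⊕ ⊝ 𝟙 ⊗ q ^ e) (regroup r m i) ⟩
      factor (⊝ 𝟙) (2 * r) (2 * m) i ∎))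
      where
      open ≈-Reasoning
      regroup : ∀ r m i → r + m * i + (r + m * i) ≡ 2 * r + 2 * m * i
      regroup = solve-∀

    -- A nonzero `r` makes q^(r+mi) nilpotent of order at most M, so the geometric sum with M terms
    -- is an exact inverse.
    factor-unit : ∀ r m i .{{_ : NonZero r}} → Unit (factor (⊝ 𝟙) r m i)
    factor-unit r m i = ∑ M (x ^_) , (begin
      factor (⊝ 𝟙) r m i ⊗ ∑ M (x ^_)     ≈⟨ *-congʳ (+-congˡ (solve 1 (λ x → :- con 1ℤ :* x := :- x) ≈-refl x)) ⟩
      (𝟙 ⊕ ⊝ x) ⊗ ∑ M (x ^_)              ≈⟨ geometric x M ⟩
      𝟙 ⊕ ⊝ x ^ M                         ≈⟨ +-congˡ (-‿cong (≈-trans (^-* q (r + m * i) M) (q^-vanish M≤))) ⟩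
      𝟙 ⊕ ⊝ 𝟘                             ≈⟨ +-congˡ (-‿cong 0-homo) ⟨
      𝟙 ⊕ ⊝ ⟦ 0ℤ ⟧                        ≈⟨ solve 0 (con 1ℤ :+ :- con 0ℤ := con 1ℤ) ≈-refl ⟩
      𝟙                                   ∎)
      where
      open ≈-Reasoning
      x = q ^ (r + m * i)
      M≤ : M ≤ (r + m * i) * M
      M≤ = ℕ.≤-trans (ℕ.m≤n*m M r) (ℕ.*-monoˡ-≤ M (ℕ.m≤m+n r (m * i)))

    P-unit : ∀ r m .{{_ : NonZero r}} → Unit (P (⊝ 𝟙) r m)
    P-unit r m = unit-∏ M (λ i → factor-unit r m i)

    -- Theta series and the Jacobi triple product

    -- Exponent and term of ∑ᵢ sⁱ q^(m (i choose 2) + r i), where m = r + r′.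
    exponent : ℕ → ℕ → ℤ → ℕ
    exponent r r′ (+ zero)     = 0
    exponent r r′ (+ suc i)    = r + (r + r′) * i + exponent r r′ (+ i)
    exponent r r′ -[1+ zero ]  = r′
    exponent r r′ -[1+ suc i ] = r′ + (r + r′) * suc i + exponent r r′ -[1+ i ]

    θ : Carrier → ℕ → ℕ → ℤ → Carrier
    θ s r r′ i = s ^ ∣ i ∣ ⊗ q ^ exponent r r′ i

    ∣i∣≤exponent : ∀ r r′ .{{_ : NonZero r}} .{{_ : NonZero r′}} i → ∣ i ∣ ≤ exponent r r′ i
    ∣i∣≤exponent r r′ (+ zero)     = z≤n
    ∣i∣≤exponent r r′ (+ suc i)    = ℕ.+-mono-≤ (ℕ.≤-trans (>-nonZero⁻¹ r) (ℕ.m≤m+n r ((r + r′) * i))) (∣i∣≤exponent r r′ (+ i))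
    ∣i∣≤exponent r r′ -[1+ zero ]  = >-nonZero⁻¹ r′
    ∣i∣≤exponent r r′ -[1+ suc i ] = ℕ.+-mono-≤ (ℕ.≤-trans (>-nonZero⁻¹ r′) (ℕ.m≤m+n r′ ((r + r′) * suc i))) (∣i∣≤exponent r r′ -[1+ i ])

    θ-vanishes : ∀ s r r′ .{{_ : NonZero r}} .{{_ : NonZero r′}} → VanishesFrom M (θ s r r′)
    θ-vanishes s r r′ i M≤i = ≈-trans (*-congˡ (q^-vanish (ℕ.≤-trans M≤i (∣i∣≤exponent r r′ i)))) (zeroʳ _)

    monomial-θ : ∀ s r r′ i → Binomials.monomial (q ^ (r + r′)) (s ⊗ q ^ r) (s ⊗ q ^ r′) i ≈ θ s r r′ i
    monomial-θ s r r′ (+ i)    = positive i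
      where
      open Binomials (q ^ (r + r′))
      open ≈-Reasoning
      positive : ∀ i → power (s ⊗ q ^ r) i ≈ θ s r r′ (+ i)
      positive zero    = ≈-sym (*-identityˡ 𝟙)
      positive (suc i) = begin
        s ⊗ q ^ r ⊗ (q ^ (r + r′)) ^ i ⊗ power (s ⊗ q ^ r) i
          ≈⟨ *-cong (*-congˡ (^-* q (r + r′) i)) (positive i) ⟩
        s ⊗ q ^ r ⊗ q ^ ((r + r′) * i) ⊗ (s ^ i ⊗ q ^ exponent r r′ (+ i))
          ≈⟨ solve 5 (λ s t a b c → s :* a :* b :* (t :* c) := s :* t :* (a :* b :* c)) ≈-refl s (s ^ i) (q ^ r) (q ^ ((r + r′) * i)) (q ^ exponent r r′ (+ i)) ⟩
        s ^ suc i ⊗ (q ^ r ⊗ q ^ ((r + r′) * i) ⊗ q ^ exponent r r′ (+ i))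
          ≈⟨ *-congˡ (≈-trans (*-congʳ (≈-sym (^-+ q r ((r + r′) * i)))) (≈-sym (^-+ q (r + (r + r′) * i) (exponent r r′ (+ i))))) ⟩
        θ s r r′ (+ suc i) ∎
    monomial-θ s r r′ -[1+ i ] = negative i
      where
      open Binomials (q ^ (r + r′))
      open ≈-Reasoning
      negative : ∀ i → power (s ⊗ q ^ r′) (suc i) ≈ θ s r r′ -[1+ i ]
      negative zero    = solve 2 (λ s a → s :* a :* con 1ℤ :* con 1ℤ := s :* con 1ℤ :* a) ≈-refl s (q ^ r′)
      negative (suc i) = begin
        s ⊗ q ^ r′ ⊗ (q ^ (r + r′)) ^ suc i ⊗ power (s ⊗ q ^ r′) (suc i)
          ≈⟨ *-cong (*-congˡ (^-* q (r + r′) (suc i))) (negative i) ⟩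
        s ⊗ q ^ r′ ⊗ q ^ ((r + r′) * suc i) ⊗ (s ^ suc i ⊗ q ^ exponent r r′ -[1+ i ])
          ≈⟨ solve 5 (λ s t a b c → s :* a :* b :* (t :* c) := s :* t :* (a :* b :* c)) ≈-refl s (s ^ suc i) (q ^ r′) (q ^ ((r + r′) * suc i)) (q ^ exponent r r′ -[1+ i ]) ⟩
        s ^ suc (suc i) ⊗ (q ^ r′ ⊗ q ^ ((r + r′) * suc i) ⊗ q ^ exponent r r′ -[1+ i ])
          ≈⟨ *-congˡ (≈-trans (*-congʳ (≈-sym (^-+ q r′ ((r + r′) * suc i)))) (≈-sym (^-+ q (r′ + (r + r′) * suc i) (exponent r r′ -[1+ i ])))) ⟩
        θ s r r′ -[1+ suc i ] ∎

    module _ (s : Carrier) (s² : s ⊗ s ≈ 𝟙) (r r′ : ℕ) .{{_ : NonZero r}} .{{_ : NonZero r′}} where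
      private
        m = r + r′
        instance
          nonZero-m : NonZero m
          nonZero-m = >-nonZero (ℕ.≤-trans (>-nonZero⁻¹ r) (ℕ.m≤m+n r r′))
        E = P (⊝ 𝟙) m m
        x = s ⊗ q ^ r
        y = s ⊗ q ^ r′
        N = M + M
      open Binomials (q ^ m)
      open ≈-Reasoning

      pochhammer-stable : ∀ {n} → M ≤ n → pochhammer n ≈ E
      pochhammer-stable {n} M≤n = begin
        pochhammer n                ≈⟨ ∏-cong n (λ i → +-congˡ (≈-trans (-‿cong (≈-trans (^-* q m (suc i)) (≈-reflexive (cong (q ^_) (ℕ.*-suc m i)))))
                                         (solve 1 (λ x → :- x := :- con 1ℤ :* x) ≈-refl (q ^ (m + m * i))))) ⟩
        ∏ n (factor (⊝ 𝟙) m m)      ≈⟨ ∏-stable _ (factor-tail (⊝ 𝟙) m m) M≤n ⟩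
        E                           ∎

      -- All three Pochhammer symbols in the factorial formula have already stabilised to `E`, so E²
      -- times the binomial is E, and one unit cancels.
      binomial-limit : ∀ {j k} → M ≤ j → M ≤ k → E ⊗ binomial (j + k) j ≈ 𝟙
      binomial-limit {j} {k} M≤j M≤k = unit-cancel (P-unit m m) (begin
        E ⊗ (E ⊗ binomial (j + k) j)                               ≈⟨ solve 2 (λ e b → e :* (e :* b) := b :* (e :* e)) ≈-refl E (binomial (j + k) j) ⟩
        binomial (j + k) j ⊗ (E ⊗ E)                               ≈⟨ *-congˡ (*-cong (pochhammer-stable M≤j) (pochhammer-stable M≤k)) ⟨
        binomial (j + k) j ⊗ (pochhammer j ⊗ pochhammer k)         ≈⟨ binomial-pochhammer j k ⟩
        pochhammer (j + k)                                         ≈⟨ pochhammer-stable (ℕ.≤-trans M≤j (ℕ.m≤m+n j k)) ⟩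
        E                                                          ≈⟨ *-identityʳ E ⟨
        E ⊗ 𝟙                                                      ∎)

      monomial-vanishes : VanishesFrom M (monomial x y)
      monomial-vanishes i M≤i = ≈-trans (monomial-θ s r r′ i) (θ-vanishes s r r′ i M≤i)

      -- The choice N = 2M makes the cases exhaustive: for M ≤ j ≤ 3M both j and 4M - j are at least
      -- M and the binomial has its limit value; otherwise j is at distance at least M from N and
      -- the monomial is zero on both sides.
      jacobi-term : ∀ j → j ≤ N + N → E ⊗ (monomial x y (j ⊖ N) ⊗ binomial (N + N) j) ≈ monomial x y (j ⊖ N)
      jacobi-term j j≤2N with M ≤? j | j ≤? N + M
      ... | yes M≤j | yes j≤N+M = begin
        E ⊗ (μ ⊗ binomial (N + N) j)         ≈⟨ solve 3 (λ e μ b → e :* (μ :* b) := μ :* (e :* b)) ≈-refl E μ (binomial (N + N) j) ⟩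
        μ ⊗ (E ⊗ binomial (N + N) j)         ≡⟨ cong (λ n → μ ⊗ (E ⊗ binomial n j)) (ℕ.m+[n∸m]≡n j≤2N) ⟨
        μ ⊗ (E ⊗ binomial (j + k) j)         ≈⟨ *-congˡ (binomial-limit M≤j (ℕ.m+n≤o⇒m≤o∸n M (ℕ.≤-trans (ℕ.+-monoʳ-≤ M j≤N+M) (ℕ.≤-reflexive (regroup M))))) ⟩
        μ ⊗ 𝟙                                ≈⟨ *-identityʳ μ ⟩
        μ                                    ∎
        where
        μ = monomial x y (j ⊖ N)
        k = N + N ∸ j
        regroup : ∀ M → M + ((M + M) + M) ≡ (M + M) + (M + M)
        regroup = solve-∀
      ... | no M≰j | _ = ≈-trans (*-congˡ (≈-trans (*-congʳ μ≈0) (zeroˡ _))) (≈-trans (zeroʳ _) (≈-sym μ≈0))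
        where
        j≤M = ℕ.<⇒≤ (ℕ.≰⇒> M≰j)
        μ≈0 = monomial-vanishes (j ⊖ N) (subst (M ≤_) (sym (ℤ.∣⊖∣-≤ (ℕ.≤-trans j≤M (ℕ.m≤m+n M M)))) (ℕ.m+n≤o⇒m≤o∸n M (ℕ.+-monoʳ-≤ M j≤M)))
      ... | yes _ | no j≰N+M = ≈-trans (*-congˡ (≈-trans (*-congʳ μ≈0) (zeroˡ _))) (≈-trans (zeroʳ _) (≈-sym μ≈0))
        where
        N+M≤j = ℕ.<⇒≤ (ℕ.≰⇒> j≰N+M)
        μ≈0 = monomial-vanishes (j ⊖ N) (subst (M ≤_) (sym (trans (ℤ.∣m⊖n∣≡∣n⊖m∣ j N) (ℤ.∣⊖∣-≤ (ℕ.≤-trans (ℕ.m≤m+n N M) N+M≤j))))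
                (ℕ.m+n≤o⇒m≤o∸n M (subst (_≤ j) (ℕ.+-comm N M) N+M≤j)))

      jacobi : ∀ {n} → M ≤ n → ∑ℤ n (θ s r r′) ≈ P s r m ⊗ P s r′ m ⊗ P (⊝ 𝟙) m m
      jacobi {n} M≤n = begin
        ∑ℤ n (θ s r r′)
          ≈⟨ ∑ℤ-stable (θ-vanishes s r r′) M≤n ⟩
        ∑ℤ M (θ s r r′)
          ≈⟨ ∑ℤ-stable (θ-vanishes s r r′) (ℕ.m≤m+n M M) ⟨
        ∑ℤ N (θ s r r′)
          ≈⟨ ∑ℤ-cong N (monomial-θ s r r′) ⟨
        ∑ℤ N μ
          ≈⟨ ∑-⊖ N μ ⟨
        ∑ (N + N) (λ j → μ (j ⊖ N))
          -- The binomial sum has 2N + 1 terms, the window [-N, N) only 2N; the extra one, of index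
          -- N, is zero.
          ≈⟨ ≈-trans (+-congˡ (monomial-vanishes (N + N ⊖ N) (subst (M ≤_) (sym (cong ∣_∣ (trans (ℤ.⊖-≥ (ℕ.m≤m+n N N)) (cong +_ (ℕ.m+n∸n≡m N N))))) (ℕ.m≤m+n M M)))) (+-identityʳ _) ⟨
        ∑ (suc (N + N)) (λ j → μ (j ⊖ N))
          ≈⟨ ∑-cong< (suc (N + N)) (λ j j< → jacobi-term j (ℕ.≤-pred j<)) ⟨
        ∑ (suc (N + N)) (λ j → E ⊗ (μ (j ⊖ N) ⊗ binomial (N + N) j))
          ≈⟨ ∑-distribˡ (suc (N + N)) E _ ⟨
        E ⊗ ∑ (suc (N + N)) (λ j → μ (j ⊖ N) ⊗ binomial (N + N) j)
          ≈⟨ *-congˡ (finite-triple-product xy≈Q N N) ⟨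
        E ⊗ (∏ N (λ i → 𝟙 ⊕ x ⊗ (q ^ m) ^ i) ⊗ ∏ N (λ i → 𝟙 ⊕ y ⊗ (q ^ m) ^ i))
          ≈⟨ *-congˡ (*-cong (truncate r) (truncate r′)) ⟩
        E ⊗ (P s r m ⊗ P s r′ m)
          ≈⟨ *-comm _ _ ⟩
        P s r m ⊗ P s r′ m ⊗ E ∎
        where
        μ = monomial x y
        xy≈Q : x ⊗ y ≈ q ^ m
        xy≈Q = begin
          s ⊗ q ^ r ⊗ (s ⊗ q ^ r′)     ≈⟨ solve 3 (λ s a b → s :* a :* (s :* b) := s :* s :* (a :* b)) ≈-refl s (q ^ r) (q ^ r′) ⟩
          s ⊗ s ⊗ (q ^ r ⊗ q ^ r′)     ≈⟨ *-cong s² (≈-sym (^-+ q r r′)) ⟩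
          𝟙 ⊗ q ^ m                    ≈⟨ *-identityˡ _ ⟩
          q ^ m                        ∎
        truncate : ∀ r → ∏ N (λ i → 𝟙 ⊕ s ⊗ q ^ r ⊗ (q ^ m) ^ i) ≈ P s r m
        truncate r = begin
          ∏ N (λ i → 𝟙 ⊕ s ⊗ q ^ r ⊗ (q ^ m) ^ i)
            ≈⟨ ∏-cong N (λ i → +-congˡ (≈-trans (*-assoc _ _ _) (*-congˡ (≈-trans (*-congˡ (^-* q m i)) (≈-sym (^-+ q r (m * i))))))) ⟩
          ∏ N (factor s r m)
            ≈⟨ ∏-stable _ (factor-tail s r m) (ℕ.m≤m+n M M) ⟩
          P s r m ∎

    -- Theta series as eta quotients

    -- The paper's f_m.
    η : ℕ → Carrier
    η m = P (⊝ 𝟙) m m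

    η-unit : ∀ m .{{_ : NonZero m}} → Unit (η m)
    η-unit m = P-unit m m

    Θ : Carrier → ℕ → ℕ → Carrier
    Θ s r r′ = ∑ℤ M (θ s r r′)

    𝟙² : 𝟙 ⊗ 𝟙 ≈ 𝟙
    𝟙² = *-identityˡ 𝟙

    -𝟙² : ⊝ 𝟙 ⊗ ⊝ 𝟙 ≈ 𝟙
    -𝟙² = solve 0 (:- con 1ℤ :* :- con 1ℤ := con 1ℤ) ≈-refl

    jacobi⁺ : ∀ r r′ .{{_ : NonZero r}} .{{_ : NonZero r′}} → Θ 𝟙 r r′ ≈ P 𝟙 r (r + r′) ⊗ P 𝟙 r′ (r + r′) ⊗ η (r + r′)
    jacobi⁺ r r′ = jacobi 𝟙 𝟙² r r′ ℕ.≤-refl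

    jacobi⁻ : ∀ r r′ .{{_ : NonZero r}} .{{_ : NonZero r′}} → Θ (⊝ 𝟙) r r′ ≈ P (⊝ 𝟙) r (r + r′) ⊗ P (⊝ 𝟙) r′ (r + r′) ⊗ η (r + r′)
    jacobi⁻ r r′ = jacobi (⊝ 𝟙) -𝟙² r r′ ℕ.≤-refl

    P-dissect2 : ∀ s r m .{{_ : NonZero m}} → P s r m ≈ P s r (m + m) ⊗ P s (r + m) (m + m)
    P-dissect2 s r m = begin
      P s r m                                                       ≈⟨ P-dissect 2 s r m ⟩
      𝟙 ⊗ P s (r + m * 0) (m * 2) ⊗ P s (r + m * 1) (m * 2)         ≈⟨ *-congʳ (*-identityˡ _) ⟩
      P s (r + m * 0) (m * 2) ⊗ P s (r + m * 1) (m * 2)             ≡⟨ cong₂ _⊗_ (cong₂ (P s) (0th r m) (double m)) (cong₂ (P s) (1st r m) (double m)) ⟩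
      P s r (m + m) ⊗ P s (r + m) (m + m)                           ∎
      where
      open ≈-Reasoning
      0th : ∀ r m → r + m * 0 ≡ r
      0th = solve-∀
      1st : ∀ r m → r + m * 1 ≡ r + m
      1st = solve-∀
      double : ∀ m → m * 2 ≡ m + m
      double = solve-∀

    η-dissect2 : ∀ m .{{_ : NonZero m}} → η m ≈ P (⊝ 𝟙) m (m + m) ⊗ η (m + m)
    η-dissect2 m = P-dissect2 (⊝ 𝟙) m m

    P-dissect3 : ∀ s r m .{{_ : NonZero m}} → P s r m ≈ P s (r + m * 0) (m * 3) ⊗ P s (r + m * 1) (m * 3) ⊗ P s (r + m * 2) (m * 3)
    P-dissect3 s r m = ≈-trans (P-dissect 3 s r m) (*-congʳ (*-congʳ (*-identityˡ _)))

    -- Gauss's φ(-q^m) = f_m²/f_2m: for r = r′ the two Jacobi factors coincide, and each becomes f_m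
    -- after absorbing one f_2m.
    gauss-square : ∀ m .{{_ : NonZero m}} → Θ (⊝ 𝟙) m m ⊗ η (m + m) ≈ η m ⊗ η m
    gauss-square m = begin
      Θ (⊝ 𝟙) m m ⊗ η (m + m)       ≈⟨ *-congʳ (jacobi⁻ m m) ⟩
      p ⊗ p ⊗ η (m + m) ⊗ η (m + m) ≈⟨ solve 2 (λ p e → p :* p :* e :* e := (p :* e) :* (p :* e)) ≈-refl p (η (m + m)) ⟩
      (p ⊗ η (m + m)) ⊗ (p ⊗ η (m + m)) ≈⟨ *-cong (η-dissect2 m) (η-dissect2 m) ⟨
      η m ⊗ η m                     ∎
      where
      open ≈-Reasoning
      p = P (⊝ 𝟙) m (m + m)

    -- Gauss's ψ(q²) = f₄²/f₂: the exponents 4i² - 2i run once through the numbers n(n+1). The two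
    -- Jacobi factors merge into (-q²;q⁴)∞, which meets (q²;q⁴)∞ from f₂ and gives (q⁴;q⁸)∞.
    gauss-triangular : Θ 𝟙 2 6 ⊗ η 2 ≈ η 4 ⊗ η 4
    gauss-triangular = begin
      Θ 𝟙 2 6 ⊗ η 2
        ≈⟨ *-cong (jacobi⁺ 2 6) (η-dissect2 2) ⟩
      P 𝟙 2 8 ⊗ P 𝟙 6 8 ⊗ η 8 ⊗ (P (⊝ 𝟙) 2 4 ⊗ η 4)
        ≈⟨ *-congʳ (*-congʳ (P-dissect2 𝟙 2 4)) ⟨
      P 𝟙 2 4 ⊗ η 8 ⊗ (P (⊝ 𝟙) 2 4 ⊗ η 4)
        ≈⟨ solve 4 (λ a e b g → a :* e :* (b :* g) := (a :* b) :* e :* g) ≈-refl (P 𝟙 2 4) (η 8) (P (⊝ 𝟙) 2 4) (η 4) ⟩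
      (P 𝟙 2 4 ⊗ P (⊝ 𝟙) 2 4) ⊗ η 8 ⊗ η 4
        ≈⟨ *-congʳ (*-congʳ (P-± 2 4)) ⟩
      P (⊝ 𝟙) 4 8 ⊗ η 8 ⊗ η 4
        ≈⟨ *-congʳ (η-dissect2 4) ⟨
      η 4 ⊗ η 4 ∎
      where open ≈-Reasoning

    pentagonal : P (⊝ 𝟙) 4 12 ⊗ P (⊝ 𝟙) 8 12 ⊗ η 12 ≈ η 4
    pentagonal = ≈-sym (P-dissect3 (⊝ 𝟙) 4 4)

    -- The classes 2, 6, 10 modulo 12 make up (q²;q⁴)∞ = f₂/f₄, and class 6 alone is f₆/f₁₂.
    octagonal : P (⊝ 𝟙) 2 12 ⊗ P (⊝ 𝟙) 10 12 ⊗ (η 4 ⊗ η 6) ≈ η 2 ⊗ η 12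
    octagonal = begin
      a ⊗ c ⊗ (η 4 ⊗ η 6)             ≈⟨ *-congˡ (*-congˡ (η-dissect2 6)) ⟩
      a ⊗ c ⊗ (η 4 ⊗ (b ⊗ η 12))      ≈⟨ solve 5 (λ a b c e g → a :* c :* (e :* (b :* g)) := a :* b :* c :* e :* g) ≈-refl a b c (η 4) (η 12) ⟩
      a ⊗ b ⊗ c ⊗ η 4 ⊗ η 12          ≈⟨ *-congʳ (*-congʳ (P-dissect3 (⊝ 𝟙) 2 4)) ⟨
      P (⊝ 𝟙) 2 4 ⊗ η 4 ⊗ η 12        ≈⟨ *-congʳ (η-dissect2 2) ⟨
      η 2 ⊗ η 12                      ∎
      where
      open ≈-Reasoning
      a = P (⊝ 𝟙) 2 12
      b = P (⊝ 𝟙) 6 12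
      c = P (⊝ 𝟙) 10 12

    -- The factors 1 - x hidden in f₁ pair with the Jacobi factors 1 + x, turning the classes 1 and
    -- 5 modulo 6 into 2 and 10 modulo 12, where `octagonal` applies; class 3 of f₁ supplies f₃.
    octagonal⁺ : Θ 𝟙 1 5 ⊗ (η 1 ⊗ η 4 ⊗ η 6) ≈ η 2 ⊗ η 2 ⊗ η 3 ⊗ η 12
    octagonal⁺ = begin
      Θ 𝟙 1 5 ⊗ (η 1 ⊗ η 4 ⊗ η 6)
        ≈⟨ *-cong (jacobi⁺ 1 5) (*-congʳ (*-congʳ (≈-trans (η-dissect2 1) (*-congʳ (P-dissect3 (⊝ 𝟙) 1 2))))) ⟩
      P 𝟙 1 6 ⊗ P 𝟙 5 6 ⊗ η 6 ⊗ (P (⊝ 𝟙) 1 6 ⊗ P (⊝ 𝟙) 3 6 ⊗ P (⊝ 𝟙) 5 6 ⊗ η 2 ⊗ η 4 ⊗ η 6)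
        ≈⟨ solve 8 (λ a b c d e g h i → a :* b :* i :* (c :* d :* e :* g :* h :* i) := (d :* i) :* g :* ((a :* c) :* (b :* e) :* (h :* i)))
             ≈-refl (P 𝟙 1 6) (P 𝟙 5 6) (P (⊝ 𝟙) 1 6) (P (⊝ 𝟙) 3 6) (P (⊝ 𝟙) 5 6) (η 2) (η 4) (η 6) ⟩
      P (⊝ 𝟙) 3 6 ⊗ η 6 ⊗ η 2 ⊗ ((P 𝟙 1 6 ⊗ P (⊝ 𝟙) 1 6) ⊗ (P 𝟙 5 6 ⊗ P (⊝ 𝟙) 5 6) ⊗ (η 4 ⊗ η 6))
        ≈⟨ *-cong (*-congʳ (≈-sym (η-dissect2 3))) (*-congʳ (*-cong (P-± 1 6) (P-± 5 6))) ⟩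
      η 3 ⊗ η 2 ⊗ (P (⊝ 𝟙) 2 12 ⊗ P (⊝ 𝟙) 10 12 ⊗ (η 4 ⊗ η 6))
        ≈⟨ *-congˡ octagonal ⟩
      η 3 ⊗ η 2 ⊗ (η 2 ⊗ η 12)
        ≈⟨ solve 3 (λ a b c → a :* b :* (b :* c) := b :* b :* a :* c) ≈-refl (η 3) (η 2) (η 12) ⟩
      η 2 ⊗ η 2 ⊗ η 3 ⊗ η 12 ∎
      where open ≈-Reasoning

    -- The 2-dissection of f₃³/f₁

    sign-suc : ∀ i → (⊝ 𝟙) ^ ∣ 1ℤ +ℤ i ∣ ≈ ⊝ 𝟙 ⊗ (⊝ 𝟙) ^ ∣ i ∣
    sign-suc (+ i)        = ≈-refl
    sign-suc -[1+ zero ]  = solve 0 (con 1ℤ := :- con 1ℤ :* (:- con 1ℤ :* con 1ℤ)) ≈-refl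
    sign-suc -[1+ suc i ] = solve 1 (λ x → x := :- con 1ℤ :* (:- con 1ℤ :* x)) ≈-refl ((⊝ 𝟙) ^ suc i)

    sign-+ : ∀ i j → (⊝ 𝟙) ^ ∣ i +ℤ j ∣ ≈ (⊝ 𝟙) ^ ∣ i ∣ ⊗ (⊝ 𝟙) ^ ∣ j ∣
    sign-+ (+ i) j = nonnegative i
      where
      open ≈-Reasoning
      nonnegative : ∀ i → (⊝ 𝟙) ^ ∣ + i +ℤ j ∣ ≈ (⊝ 𝟙) ^ i ⊗ (⊝ 𝟙) ^ ∣ j ∣
      nonnegative zero    = ≈-trans (≈-reflexive (cong (λ k → (⊝ 𝟙) ^ ∣ k ∣) (ℤ.+-identityˡ j))) (≈-sym (*-identityˡ _))
      nonnegative (suc i) = begin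
        (⊝ 𝟙) ^ ∣ 1ℤ +ℤ + i +ℤ j ∣              ≡⟨ cong (λ k → (⊝ 𝟙) ^ ∣ k ∣) (ℤ.+-assoc 1ℤ (+ i) j) ⟩
        (⊝ 𝟙) ^ ∣ 1ℤ +ℤ (+ i +ℤ j) ∣            ≈⟨ sign-suc (+ i +ℤ j) ⟩
        ⊝ 𝟙 ⊗ (⊝ 𝟙) ^ ∣ + i +ℤ j ∣              ≈⟨ *-congˡ (nonnegative i) ⟩
        ⊝ 𝟙 ⊗ ((⊝ 𝟙) ^ i ⊗ (⊝ 𝟙) ^ ∣ j ∣)       ≈⟨ *-assoc _ _ _ ⟨
        (⊝ 𝟙) ^ suc i ⊗ (⊝ 𝟙) ^ ∣ j ∣           ∎
    sign-+ -[1+ i ] j = nonpositive (suc i)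
      where
      open ≈-Reasoning
      cancel : ∀ i j → 1ℤ +ℤ (- (1ℤ +ℤ i) +ℤ j) ≡ - i +ℤ j
      cancel = ℤ.solve-∀
      nonpositive : ∀ i → (⊝ 𝟙) ^ ∣ - (+ i) +ℤ j ∣ ≈ (⊝ 𝟙) ^ i ⊗ (⊝ 𝟙) ^ ∣ j ∣
      nonpositive zero    = ≈-trans (≈-reflexive (cong (λ k → (⊝ 𝟙) ^ ∣ k ∣) (ℤ.+-identityˡ j))) (≈-sym (*-identityˡ _))
      nonpositive (suc i) = begin
        (⊝ 𝟙) ^ ∣ k ∣                            ≈⟨ solve 1 (λ x → x := :- con 1ℤ :* (:- con 1ℤ :* x)) ≈-refl ((⊝ 𝟙) ^ ∣ k ∣) ⟩
        ⊝ 𝟙 ⊗ (⊝ 𝟙 ⊗ (⊝ 𝟙) ^ ∣ k ∣)             ≈⟨ *-congˡ (sign-suc k) ⟨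
        ⊝ 𝟙 ⊗ (⊝ 𝟙) ^ ∣ 1ℤ +ℤ k ∣               ≡⟨ cong (λ k → ⊝ 𝟙 ⊗ (⊝ 𝟙) ^ ∣ k ∣) (cancel (+ i) j) ⟩
        ⊝ 𝟙 ⊗ (⊝ 𝟙) ^ ∣ - (+ i) +ℤ j ∣          ≈⟨ *-congˡ (nonpositive i) ⟩
        ⊝ 𝟙 ⊗ ((⊝ 𝟙) ^ i ⊗ (⊝ 𝟙) ^ ∣ j ∣)       ≈⟨ *-assoc _ _ _ ⟨
        (⊝ 𝟙) ^ suc i ⊗ (⊝ 𝟙) ^ ∣ j ∣           ∎
        where k = - (+ suc i) +ℤ j

    𝟙^n≈𝟙 : ∀ n → 𝟙 ^ n ≈ 𝟙
    𝟙^n≈𝟙 zero    = ≈-refl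
    𝟙^n≈𝟙 (suc n) = ≈-trans (*-identityˡ _) (𝟙^n≈𝟙 n)

    -- Doubling removes the division in the binomial coefficient (i choose 2), so that identities
    -- between theta exponents at arbitrary integers become polynomial and can be left to the ring
    -- solver.
    2*exponent : ∀ r r′ i → + 2 *ℤ + exponent r r′ i ≡ (+ r +ℤ + r′) *ℤ i *ℤ i +ℤ (+ r +ℤ - (+ r′)) *ℤ i
    2*exponent r r′ (+ zero) = base (+ r) (+ r′)
      where
      base : ∀ r r′ → 0ℤ ≡ (r +ℤ r′) *ℤ 0ℤ *ℤ 0ℤ +ℤ (r +ℤ - r′) *ℤ 0ℤ
      base = ℤ.solve-∀
    2*exponent r r′ (+ suc i) = begin
      + 2 *ℤ + (r + (r + r′) * i + e)                          ≡⟨ cong (λ k → + 2 *ℤ (+ r +ℤ k +ℤ + e)) (ℤ.pos-* (r + r′) i) ⟩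
      + 2 *ℤ (+ r +ℤ (+ r +ℤ + r′) *ℤ + i +ℤ + e)              ≡⟨ ℤ.*-distribˡ-+ (+ 2) (+ r +ℤ (+ r +ℤ + r′) *ℤ + i) (+ e) ⟩
      + 2 *ℤ (+ r +ℤ (+ r +ℤ + r′) *ℤ + i) +ℤ + 2 *ℤ + e       ≡⟨ cong (+ 2 *ℤ (+ r +ℤ (+ r +ℤ + r′) *ℤ + i) +ℤ_) (2*exponent r r′ (+ i)) ⟩
      _                                                        ≡⟨ step (+ r) (+ r′) (+ i) ⟩
      (+ r +ℤ + r′) *ℤ + suc i *ℤ + suc i +ℤ (+ r +ℤ - (+ r′)) *ℤ + suc i ∎
      where
      open ≡-Reasoning
      e = exponent r r′ (+ i)
      step : ∀ r r′ i → + 2 *ℤ (r +ℤ (r +ℤ r′) *ℤ i) +ℤ ((r +ℤ r′) *ℤ i *ℤ i +ℤ (r +ℤ - r′) *ℤ i)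
                      ≡ (r +ℤ r′) *ℤ (1ℤ +ℤ i) *ℤ (1ℤ +ℤ i) +ℤ (r +ℤ - r′) *ℤ (1ℤ +ℤ i)
      step = ℤ.solve-∀
    2*exponent r r′ -[1+ zero ] = base (+ r) (+ r′)
      where
      base : ∀ r r′ → + 2 *ℤ r′ ≡ (r +ℤ r′) *ℤ - 1ℤ *ℤ - 1ℤ +ℤ (r +ℤ - r′) *ℤ - 1ℤ
      base = ℤ.solve-∀
    2*exponent r r′ -[1+ suc i ] = begin
      + 2 *ℤ + (r′ + (r + r′) * suc i + e)                          ≡⟨ cong (λ k → + 2 *ℤ (+ r′ +ℤ k +ℤ + e)) (ℤ.pos-* (r + r′) (suc i)) ⟩
      + 2 *ℤ (+ r′ +ℤ (+ r +ℤ + r′) *ℤ + suc i +ℤ + e)              ≡⟨ ℤ.*-distribˡ-+ (+ 2) (+ r′ +ℤ (+ r +ℤ + r′) *ℤ + suc i) (+ e) ⟩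
      + 2 *ℤ (+ r′ +ℤ (+ r +ℤ + r′) *ℤ + suc i) +ℤ + 2 *ℤ + e       ≡⟨ cong (+ 2 *ℤ (+ r′ +ℤ (+ r +ℤ + r′) *ℤ + suc i) +ℤ_) (2*exponent r r′ -[1+ i ]) ⟩
      _                                                             ≡⟨ step (+ r) (+ r′) (+ suc i) ⟩
      (+ r +ℤ + r′) *ℤ -[1+ suc i ] *ℤ -[1+ suc i ] +ℤ (+ r +ℤ - (+ r′)) *ℤ -[1+ suc i ] ∎
      where
      open ≡-Reasoning
      e = exponent r r′ -[1+ i ]
      step : ∀ r r′ i → + 2 *ℤ (r′ +ℤ (r +ℤ r′) *ℤ i) +ℤ ((r +ℤ r′) *ℤ - i *ℤ - i +ℤ (r +ℤ - r′) *ℤ - i)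
                      ≡ (r +ℤ r′) *ℤ - (1ℤ +ℤ i) *ℤ - (1ℤ +ℤ i) +ℤ (r +ℤ - r′) *ℤ - (1ℤ +ℤ i)
      step = ℤ.solve-∀

    -- Only the second series carries signs, and (-1)^(u+v) splits into a sign for each new
    -- variable; the rest of the change of variables is the exponent identity `eq`.
    rotate : ∀ {r₁ r₁′ r₂ r₂′} k i u v →
      exponent 1 5 i + exponent 3 3 (u +ℤ v) ≡ k + (exponent r₁ r₁′ u + exponent r₂ r₂′ v) →
      θ 𝟙 1 5 i ⊗ θ (⊝ 𝟙) 3 3 (u +ℤ v) ≈ q ^ k ⊗ (θ (⊝ 𝟙) r₁ r₁′ u ⊗ θ (⊝ 𝟙) r₂ r₂′ v)
    rotate {r₁} {r₁′} {r₂} {r₂′} k i u v eq = begin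
      𝟙 ^ ∣ i ∣ ⊗ q ^ e₁ ⊗ ((⊝ 𝟙) ^ ∣ u +ℤ v ∣ ⊗ q ^ e₂)
        ≈⟨ *-cong (*-congʳ (𝟙^n≈𝟙 ∣ i ∣)) (*-congʳ (sign-+ u v)) ⟩
      𝟙 ⊗ q ^ e₁ ⊗ ((⊝ 𝟙) ^ ∣ u ∣ ⊗ (⊝ 𝟙) ^ ∣ v ∣ ⊗ q ^ e₂)
        ≈⟨ solve 4 (λ x y s t → con 1ℤ :* x :* (s :* t :* y) := s :* t :* (x :* y)) ≈-refl (q ^ e₁) (q ^ e₂) ((⊝ 𝟙) ^ ∣ u ∣) ((⊝ 𝟙) ^ ∣ v ∣) ⟩
      (⊝ 𝟙) ^ ∣ u ∣ ⊗ (⊝ 𝟙) ^ ∣ v ∣ ⊗ (q ^ e₁ ⊗ q ^ e₂)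
        ≈⟨ *-congˡ (≈-sym (^-+ q e₁ e₂)) ⟩
      (⊝ 𝟙) ^ ∣ u ∣ ⊗ (⊝ 𝟙) ^ ∣ v ∣ ⊗ q ^ (e₁ + e₂)
        ≡⟨ cong (λ e → (⊝ 𝟙) ^ ∣ u ∣ ⊗ (⊝ 𝟙) ^ ∣ v ∣ ⊗ q ^ e) eq ⟩
      (⊝ 𝟙) ^ ∣ u ∣ ⊗ (⊝ 𝟙) ^ ∣ v ∣ ⊗ q ^ (k + (e₃ + e₄))
        ≈⟨ *-congˡ (≈-trans (^-+ q k (e₃ + e₄)) (*-congˡ (^-+ q e₃ e₄))) ⟩
      (⊝ 𝟙) ^ ∣ u ∣ ⊗ (⊝ 𝟙) ^ ∣ v ∣ ⊗ (q ^ k ⊗ (q ^ e₃ ⊗ q ^ e₄))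
        ≈⟨ solve 5 (λ k x y s t → s :* t :* (k :* (x :* y)) := k :* (s :* x :* (t :* y))) ≈-refl (q ^ k) (q ^ e₃) (q ^ e₄) ((⊝ 𝟙) ^ ∣ u ∣) ((⊝ 𝟙) ^ ∣ v ∣) ⟩
      q ^ k ⊗ (θ (⊝ 𝟙) r₁ r₁′ u ⊗ θ (⊝ 𝟙) r₂ r₂′ v) ∎
      where
      open ≈-Reasoning
      e₁ = exponent 1 5 i
      e₂ = exponent 3 3 (u +ℤ v)
      e₃ = exponent r₁ r₁′ u
      e₄ = exponent r₂ r₂′ v

    quadratic : ℕ → ℕ → ℤ → ℤ
    quadratic r r′ i = (+ r +ℤ + r′) *ℤ i *ℤ i +ℤ (+ r +ℤ - (+ r′)) *ℤ i

    exponent-rotate : ∀ {r₁ r₁′ r₂ r₂′} k i j u v →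
      quadratic 1 5 i +ℤ quadratic 3 3 j ≡ + 2 *ℤ + k +ℤ (quadratic r₁ r₁′ u +ℤ quadratic r₂ r₂′ v) →
      exponent 1 5 i + exponent 3 3 j ≡ k + (exponent r₁ r₁′ u + exponent r₂ r₂′ v)
    exponent-rotate {r₁} {r₁′} {r₂} {r₂′} k i j u v eq = ℤ.+-injective (ℤ.*-cancelˡ-≡ (+ 2) _ _ (begin
      + 2 *ℤ (+ exponent 1 5 i +ℤ + exponent 3 3 j)
        ≡⟨ ℤ.*-distribˡ-+ (+ 2) (+ exponent 1 5 i) (+ exponent 3 3 j) ⟩
      + 2 *ℤ + exponent 1 5 i +ℤ + 2 *ℤ + exponent 3 3 j
        ≡⟨ cong₂ _+ℤ_ (2*exponent 1 5 i) (2*exponent 3 3 j) ⟩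
      quadratic 1 5 i +ℤ quadratic 3 3 j
        ≡⟨ eq ⟩
      + 2 *ℤ + k +ℤ (quadratic r₁ r₁′ u +ℤ quadratic r₂ r₂′ v)
        ≡⟨ cong₂ (λ a b → + 2 *ℤ + k +ℤ (a +ℤ b)) (2*exponent r₁ r₁′ u) (2*exponent r₂ r₂′ v) ⟨
      + 2 *ℤ + k +ℤ (+ 2 *ℤ + exponent r₁ r₁′ u +ℤ + 2 *ℤ + exponent r₂ r₂′ v)
        ≡⟨ collect (+ k) (+ exponent r₁ r₁′ u) (+ exponent r₂ r₂′ v) ⟩
      + 2 *ℤ (+ k +ℤ (+ exponent r₁ r₁′ u +ℤ + exponent r₂ r₂′ v)) ∎))
      where
      open ≡-Reasoning
      collect : ∀ k a b → + 2 *ℤ k +ℤ (+ 2 *ℤ a +ℤ + 2 *ℤ b) ≡ + 2 *ℤ (k +ℤ (a +ℤ b))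
      collect = ℤ.solve-∀

    -- Substitute (i, j) = (u - v, u + v) or (u - v, u + v + 1) according to the parity of j - i.
    Θ-dissect : Θ 𝟙 1 5 ⊗ Θ (⊝ 𝟙) 3 3 ≈ Θ (⊝ 𝟙) 4 8 ⊗ Θ (⊝ 𝟙) 8 4 ⊕ q ⊗ (Θ (⊝ 𝟙) 10 2 ⊗ Θ (⊝ 𝟙) 2 10)
    Θ-dissect = begin
      Θ 𝟙 1 5 ⊗ Θ (⊝ 𝟙) 3 3
        ≈⟨ *-congˡ (∑ℤ-stable (θ-vanishes (⊝ 𝟙) 3 3) M≤B) ⟨
      ∑ℤ M (θ 𝟙 1 5) ⊗ ∑ℤ B (θ (⊝ 𝟙) 3 3)
        ≈⟨ ∑ℤ-⊗ M B (θ 𝟙 1 5) (θ (⊝ 𝟙) 3 3) ⟩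
      ∑ℤ M (λ i → ∑ℤ B (h i))
        -- The variable j is replaced by d = j - i, whose parity decides the case; as ∣i∣ ≤ M, the
        -- translated support stays inside the window of size B.
        ≈⟨ ∑ℤ-cong≤ M (λ i i≤M → ∑ℤ-shift i (λ j M≤j → h-vanishesʳ i j M≤j) (ℕ.+-mono-≤ M≤n (ℕ.≤-trans i≤M M≤n))) ⟨
      ∑ℤ M (λ i → ∑ℤ B (λ d → h i (d +ℤ i)))
        ≈⟨ ∑ℤ-comm M B (λ i d → h i (d +ℤ i)) ⟩
      ∑ℤ B (λ d → ∑ℤ M (λ i → h i (d +ℤ i)))
        ≈⟨ ∑ℤ-cong B (λ d → ≈-sym (∑ℤ-stable (diagonal-vanishes d) M≤B)) ⟩
      ∑ℤ B diagonal
        ≈⟨ ∑ℤ-parity n diagonal ⟩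
      ∑ℤ n (λ e → diagonal (e +ℤ e)) ⊕ ∑ℤ n (λ e → diagonal (1ℤ +ℤ (e +ℤ e)))
        ≈⟨ +-cong (∑ℤ-cong≤ n (λ e e≤n → ≈-trans (slide (e +ℤ e) e e≤n) (∑ℤ-cong B (even e))))
                  (∑ℤ-cong≤ n (λ e e≤n → ≈-trans (slide (1ℤ +ℤ (e +ℤ e)) e e≤n) (∑ℤ-cong B (odd e)))) ⟩
      ∑ℤ n (λ e → ∑ℤ B (λ u → θ (⊝ 𝟙) 4 8 u ⊗ θ (⊝ 𝟙) 8 4 e)) ⊕
      ∑ℤ n (λ e → ∑ℤ B (λ u → q ⊗ (θ (⊝ 𝟙) 10 2 u ⊗ θ (⊝ 𝟙) 2 10 (e +ℤ 1ℤ))))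
        ≈⟨ +-cong (≈-sym (product (θ (⊝ 𝟙) 4 8) (θ (⊝ 𝟙) 8 4)))
                  (≈-trans (≈-sym (≈-trans (∑ℤ-distribˡ n q (λ e → ∑ℤ B (oddTerm e))) (∑ℤ-cong n (λ e → ∑ℤ-distribˡ B q (oddTerm e))))) (*-congˡ (≈-sym (product (θ (⊝ 𝟙) 10 2) (λ e → θ (⊝ 𝟙) 2 10 (e +ℤ 1ℤ)))))) ⟩
      ∑ℤ B (θ (⊝ 𝟙) 4 8) ⊗ ∑ℤ n (θ (⊝ 𝟙) 8 4) ⊕
      q ⊗ (∑ℤ B (θ (⊝ 𝟙) 10 2) ⊗ ∑ℤ n (λ e → θ (⊝ 𝟙) 2 10 (e +ℤ 1ℤ)))
        ≈⟨ +-cong (*-cong (∑ℤ-stable (θ-vanishes (⊝ 𝟙) 4 8) M≤B) (∑ℤ-stable (θ-vanishes (⊝ 𝟙) 8 4) M≤n))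
                  (*-congˡ (*-cong (∑ℤ-stable (θ-vanishes (⊝ 𝟙) 10 2) M≤B)
                    (≈-trans (∑ℤ-shift 1ℤ (θ-vanishes (⊝ 𝟙) 2 10) (ℕ.≤-reflexive (ℕ.+-comm M 1))) (∑ℤ-stable (θ-vanishes (⊝ 𝟙) 2 10) M≤n)))) ⟩
      Θ (⊝ 𝟙) 4 8 ⊗ Θ (⊝ 𝟙) 8 4 ⊕ q ⊗ (Θ (⊝ 𝟙) 10 2 ⊗ Θ (⊝ 𝟙) 2 10) ∎
      where
      open ≈-Reasoning
      -- One more than M leaves room for the shift from e to e + 1 in the odd part.
      n = suc M
      B = n + n
      M≤n : M ≤ n
      M≤n = ℕ.n≤1+n M
      M≤B : M ≤ B
      M≤B = ℕ.≤-trans M≤n (ℕ.m≤m+n n n)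

      h : ℤ → ℤ → Carrier
      h i j = θ 𝟙 1 5 i ⊗ θ (⊝ 𝟙) 3 3 j
      h-vanishesʳ : ∀ i → VanishesFrom M (h i)
      h-vanishesʳ i j M≤j = ≈-trans (*-congˡ (θ-vanishes (⊝ 𝟙) 3 3 j M≤j)) (zeroʳ _)
      diagonal-vanishes : ∀ d → VanishesFrom M (λ i → h i (d +ℤ i))
      diagonal-vanishes d i M≤i = ≈-trans (*-congʳ (θ-vanishes 𝟙 1 5 i M≤i)) (zeroˡ _)
      diagonal : ℤ → Carrier
      diagonal d = ∑ℤ B (λ i → h i (d +ℤ i))

      slide : ∀ d e → ∣ e ∣ ≤ n → diagonal d ≈ ∑ℤ B (λ u → h (u +ℤ - e) (d +ℤ (u +ℤ - e)))
      slide d e e≤n = ≈-sym (∑ℤ-shift (- e) (diagonal-vanishes d) (ℕ.+-mono-≤ M≤n (subst (_≤ n) (sym (ℤ.∣-i∣≡∣i∣ e)) e≤n)))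

      oddTerm : ℤ → ℤ → Carrier
      oddTerm e u = θ (⊝ 𝟙) 10 2 u ⊗ θ (⊝ 𝟙) 2 10 (e +ℤ 1ℤ)

      product : ∀ g h → ∑ℤ B g ⊗ ∑ℤ n h ≈ ∑ℤ n (λ e → ∑ℤ B (λ u → g u ⊗ h e))
      product g h = ≈-trans (∑ℤ-⊗ B n g h) (∑ℤ-comm B n (λ u e → g u ⊗ h e))

      even : ∀ e u → h (u +ℤ - e) ((e +ℤ e) +ℤ (u +ℤ - e)) ≈ θ (⊝ 𝟙) 4 8 u ⊗ θ (⊝ 𝟙) 8 4 e
      even e u = begin
        h (u +ℤ - e) ((e +ℤ e) +ℤ (u +ℤ - e))        ≡⟨ cong (h (u +ℤ - e)) (index e u) ⟩
        h (u +ℤ - e) (u +ℤ e)                        ≈⟨ rotate 0 (u +ℤ - e) u e (exponent-rotate 0 (u +ℤ - e) (u +ℤ e) u e (identity u e)) ⟩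
        𝟙 ⊗ (θ (⊝ 𝟙) 4 8 u ⊗ θ (⊝ 𝟙) 8 4 e)          ≈⟨ *-identityˡ _ ⟩
        θ (⊝ 𝟙) 4 8 u ⊗ θ (⊝ 𝟙) 8 4 e                ∎
        where
        index : ∀ e u → (e +ℤ e) +ℤ (u +ℤ - e) ≡ u +ℤ e
        index = ℤ.solve-∀
        identity : ∀ u e → quadratic 1 5 (u +ℤ - e) +ℤ quadratic 3 3 (u +ℤ e) ≡ + 2 *ℤ 0ℤ +ℤ (quadratic 4 8 u +ℤ quadratic 8 4 e)
        -- `quadratic` at numerals computes its coefficients, so `expand` is the same statement up
        -- to reduction, in a form that the solver can parse.
        identity = expand
          where
          expand : ∀ u e → ((+ 6 *ℤ (u +ℤ - e) *ℤ (u +ℤ - e)) +ℤ - (+ 4) *ℤ (u +ℤ - e)) +ℤ (+ 6 *ℤ (u +ℤ e) *ℤ (u +ℤ e) +ℤ 0ℤ *ℤ (u +ℤ e))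
            ≡ 0ℤ +ℤ ((+ 12 *ℤ u *ℤ u +ℤ - (+ 4) *ℤ u) +ℤ (+ 12 *ℤ e *ℤ e +ℤ + 4 *ℤ e))
          expand = ℤ.solve-∀

      odd : ∀ e u → h (u +ℤ - e) ((1ℤ +ℤ (e +ℤ e)) +ℤ (u +ℤ - e)) ≈ q ⊗ (θ (⊝ 𝟙) 10 2 u ⊗ θ (⊝ 𝟙) 2 10 (e +ℤ 1ℤ))
      odd e u = begin
        h (u +ℤ - e) ((1ℤ +ℤ (e +ℤ e)) +ℤ (u +ℤ - e))             ≡⟨ cong (h (u +ℤ - e)) (index e u) ⟩
        h (u +ℤ - e) (u +ℤ (e +ℤ 1ℤ))                             ≈⟨ rotate 1 (u +ℤ - e) u (e +ℤ 1ℤ) (exponent-rotate 1 (u +ℤ - e) (u +ℤ (e +ℤ 1ℤ)) u (e +ℤ 1ℤ) (identity u e)) ⟩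
        q ⊗ 𝟙 ⊗ (θ (⊝ 𝟙) 10 2 u ⊗ θ (⊝ 𝟙) 2 10 (e +ℤ 1ℤ))         ≈⟨ *-congʳ (*-identityʳ q) ⟩
        q ⊗ (θ (⊝ 𝟙) 10 2 u ⊗ θ (⊝ 𝟙) 2 10 (e +ℤ 1ℤ))             ∎
        where
        index : ∀ e u → (1ℤ +ℤ (e +ℤ e)) +ℤ (u +ℤ - e) ≡ u +ℤ (e +ℤ 1ℤ)
        index = ℤ.solve-∀
        identity : ∀ u e → quadratic 1 5 (u +ℤ - e) +ℤ quadratic 3 3 (u +ℤ (e +ℤ 1ℤ)) ≡ + 2 *ℤ 1ℤ +ℤ (quadratic 10 2 u +ℤ quadratic 2 10 (e +ℤ 1ℤ))
        identity = expand
          where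
          expand : ∀ u e → ((+ 6 *ℤ (u +ℤ - e) *ℤ (u +ℤ - e)) +ℤ - (+ 4) *ℤ (u +ℤ - e)) +ℤ (+ 6 *ℤ (u +ℤ (e +ℤ 1ℤ)) *ℤ (u +ℤ (e +ℤ 1ℤ)) +ℤ 0ℤ *ℤ (u +ℤ (e +ℤ 1ℤ)))
            ≡ + 2 +ℤ ((+ 12 *ℤ u *ℤ u +ℤ + 8 *ℤ u) +ℤ (+ 12 *ℤ (e +ℤ 1ℤ) *ℤ (e +ℤ 1ℤ) +ℤ - (+ 8) *ℤ (e +ℤ 1ℤ)))
          expand = ℤ.solve-∀

    -- This is `Θ-dissect` multiplied by f₁f₄²f₆², which clears every denominator of the eta
    -- quotients involved.
    f₃³-dissect : η 3 ⊗ η 3 ⊗ η 3 ⊗ (η 2 ⊗ η 2 ⊗ η 12 ⊗ η 4) ≈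
      η 1 ⊗ (η 4 ⊗ η 4 ⊗ η 4 ⊗ η 4 ⊗ η 6 ⊗ η 6 ⊕ q ⊗ (η 12 ⊗ η 12 ⊗ η 12 ⊗ η 12 ⊗ η 2 ⊗ η 2))
    f₃³-dissect = begin
      η 3 ⊗ η 3 ⊗ η 3 ⊗ (η 2 ⊗ η 2 ⊗ η 12 ⊗ η 4)
        ≈⟨ solve 4 (λ b c d h → c :* c :* c :* (b :* b :* h :* d) := b :* b :* c :* h :* (c :* c) :* d) ≈-refl (η 2) (η 3) (η 4) (η 12) ⟩
      η 2 ⊗ η 2 ⊗ η 3 ⊗ η 12 ⊗ (η 3 ⊗ η 3) ⊗ η 4
        ≈⟨ *-congʳ (*-cong octagonal⁺ (gauss-square 3)) ⟨
      Θ 𝟙 1 5 ⊗ (η 1 ⊗ η 4 ⊗ η 6) ⊗ (Θ (⊝ 𝟙) 3 3 ⊗ η 6) ⊗ η 4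
        ≈⟨ solve 5 (λ j φ a d g → j :* (a :* d :* g) :* (φ :* g) :* d := a :* ((j :* φ) :* (d :* d :* (g :* g)))) ≈-refl (Θ 𝟙 1 5) (Θ (⊝ 𝟙) 3 3) (η 1) (η 4) (η 6) ⟩
      η 1 ⊗ ((Θ 𝟙 1 5 ⊗ Θ (⊝ 𝟙) 3 3) ⊗ (η 4 ⊗ η 4 ⊗ (η 6 ⊗ η 6)))
        ≈⟨ *-congˡ (*-congʳ (≈-trans Θ-dissect (+-cong (*-cong (≈-trans (jacobi⁻ 4 8) pentagonal) (≈-trans (jacobi⁻ 8 4) (≈-trans (*-congʳ (*-comm _ _)) pentagonal)))
             (*-congˡ (*-cong (≈-trans (jacobi⁻ 10 2) (*-congʳ (*-comm _ _))) (jacobi⁻ 2 10)))))) ⟩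
      η 1 ⊗ ((η 4 ⊗ η 4 ⊕ q ⊗ (T ⊗ η 12 ⊗ (T ⊗ η 12))) ⊗ (η 4 ⊗ η 4 ⊗ (η 6 ⊗ η 6)))
        ≈⟨ solve 6 (λ a d g h q t → a :* ((d :* d :+ q :* (t :* h :* (t :* h))) :* (d :* d :* (g :* g)))
                     := a :* (d :* d :* d :* d :* g :* g :+ q :* ((t :* (d :* g)) :* (t :* (d :* g)) :* (h :* h))))
             ≈-refl (η 1) (η 4) (η 6) (η 12) q T ⟩
      η 1 ⊗ (η 4 ⊗ η 4 ⊗ η 4 ⊗ η 4 ⊗ η 6 ⊗ η 6 ⊕ q ⊗ ((T ⊗ (η 4 ⊗ η 6)) ⊗ (T ⊗ (η 4 ⊗ η 6)) ⊗ (η 12 ⊗ η 12)))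
        ≈⟨ *-congˡ (+-congˡ (*-congˡ (*-congʳ (*-cong octagonal octagonal)))) ⟩
      η 1 ⊗ (η 4 ⊗ η 4 ⊗ η 4 ⊗ η 4 ⊗ η 6 ⊗ η 6 ⊕ q ⊗ ((η 2 ⊗ η 12) ⊗ (η 2 ⊗ η 12) ⊗ (η 12 ⊗ η 12)))
        ≈⟨ *-congˡ (+-congˡ (*-congˡ (solve 2 (λ b h → b :* h :* (b :* h) :* (h :* h) := h :* h :* h :* h :* b :* b) ≈-refl (η 2) (η 12)))) ⟩
      η 1 ⊗ (η 4 ⊗ η 4 ⊗ η 4 ⊗ η 4 ⊗ η 6 ⊗ η 6 ⊕ q ⊗ (η 12 ⊗ η 12 ⊗ η 12 ⊗ η 12 ⊗ η 2 ⊗ η 2)) ∎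
      where
      open ≈-Reasoning
      T = P (⊝ 𝟙) 2 12 ⊗ P (⊝ 𝟙) 10 12

    -- Theta squares modulo powers of 2, eta cubes modulo 3

    -- ∑_{i≥1} (-1)ⁱ q^(m i²)
    half : ℕ → Carrier
    half m = ∑ M (λ i → θ (⊝ 𝟙) m m (+ suc i))

    -- The terms at i and -i agree. The window [-M, M) lacks i = M, but that term is zero, and with
    -- it the two halves away from i = 0 become equal.
    Θ-half : ∀ m .{{_ : NonZero m}} → Θ (⊝ 𝟙) m m ≈ 𝟙 ⊕ ⟦ + 2 ⟧ ⊗ half m
    Θ-half m = begin
      Θ (⊝ 𝟙) m m
        ≈⟨ ∑-⊕ M (λ i → t (+ i)) (λ i → t -[1+ i ]) ⟩
      ∑ M (λ i → t (+ i)) ⊕ ∑ M (λ i → t -[1+ i ])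
        ≈⟨ +-cong (≈-trans (≈-sym (≈-trans (+-congˡ (θ-vanishes (⊝ 𝟙) m m (+ M) ℕ.≤-refl)) (+-identityʳ _))) (∑-front M (λ i → t (+ i))))
                  (∑-cong M (λ i → ≈-reflexive (cong (λ e → (⊝ 𝟙) ^ suc i ⊗ q ^ e) (symmetric i)))) ⟩
      𝟙 ⊗ 𝟙 ⊕ half m ⊕ half m
        ≈⟨ solve 1 (λ x → con 1ℤ :* con 1ℤ :+ x :+ x := con 1ℤ :+ con (+ 2) :* x) ≈-refl (half m) ⟩
      𝟙 ⊕ ⟦ + 2 ⟧ ⊗ half m ∎
      where
      open ≈-Reasoning
      t = θ (⊝ 𝟙) m m
      symmetric : ∀ i → exponent m m -[1+ i ] ≡ exponent m m (+ suc i)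
      symmetric zero    = base m
        where
        base : ∀ m → m ≡ m + (m + m) * 0 + 0
        base = solve-∀
      symmetric (suc i) = cong (_+_ (m + (m + m) * suc i)) (symmetric i)

    -- Factor by factor, (1 - x)³ = 1 - x³ + 3(x² - x); the multiples of 3 are collected along the
    -- product.
    η₂³-mod-3 : ∃ λ t → η 2 ⊗ η 2 ⊗ η 2 ≈ η 6 ⊕ ⟦ + 3 ⟧ ⊗ t
    η₂³-mod-3 = cubes M
      where
      open ≈-Reasoning
      cubes : ∀ n → ∃ λ t → ∏ n (factor (⊝ 𝟙) 2 2) ⊗ ∏ n (factor (⊝ 𝟙) 2 2) ⊗ ∏ n (factor (⊝ 𝟙) 2 2) ≈ ∏ n (factor (⊝ 𝟙) 6 6) ⊕ ⟦ + 3 ⟧ ⊗ t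
      cubes zero    = 𝟘 , ≈-trans (solve 0 (con 1ℤ :* con 1ℤ :* con 1ℤ := con 1ℤ :+ con (+ 3) :* con 0ℤ) ≈-refl) (+-congˡ (*-congˡ 0-homo))
      cubes (suc n) with cubes n
      ... | t , p³ = t′ , (begin
        p ⊗ (𝟙 ⊕ ⊝ 𝟙 ⊗ x) ⊗ (p ⊗ (𝟙 ⊕ ⊝ 𝟙 ⊗ x)) ⊗ (p ⊗ (𝟙 ⊕ ⊝ 𝟙 ⊗ x))
          ≈⟨ solve 2 (λ p x → let y = con 1ℤ :+ :- con 1ℤ :* x in p :* y :* (p :* y) :* (p :* y) := p :* p :* p :* (con 1ℤ :+ :- con 1ℤ :* (x :* x :* x) :+ con (+ 3) :* (x :* x :+ :- x))) ≈-refl p x ⟩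
        p ⊗ p ⊗ p ⊗ (𝟙 ⊕ ⊝ 𝟙 ⊗ (x ⊗ x ⊗ x) ⊕ ⟦ + 3 ⟧ ⊗ (x ⊗ x ⊕ ⊝ x))
          ≈⟨ *-cong p³ (+-congʳ (+-congˡ (*-congˡ cube))) ⟩
        (r ⊕ ⟦ + 3 ⟧ ⊗ t) ⊗ (z ⊕ ⟦ + 3 ⟧ ⊗ (x ⊗ x ⊕ ⊝ x))
          ≈⟨ solve 4 (λ r t z y → (r :+ con (+ 3) :* t) :* (z :+ con (+ 3) :* y) := r :* z :+ con (+ 3) :* (r :* y :+ t :* (z :+ con (+ 3) :* y))) ≈-refl r t z (x ⊗ x ⊕ ⊝ x) ⟩
        r ⊗ z ⊕ ⟦ + 3 ⟧ ⊗ t′ ∎)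
        where
        p = ∏ n (factor (⊝ 𝟙) 2 2)
        r = ∏ n (factor (⊝ 𝟙) 6 6)
        x = q ^ (2 + 2 * n)
        z = factor (⊝ 𝟙) 6 6 n
        t′ = r ⊗ (x ⊗ x ⊕ ⊝ x) ⊕ t ⊗ (z ⊕ ⟦ + 3 ⟧ ⊗ (x ⊗ x ⊕ ⊝ x))
        triple : ∀ n → 2 + 2 * n + (2 + 2 * n) + (2 + 2 * n) ≡ 6 + 6 * n
        triple = solve-∀
        cube : x ⊗ x ⊗ x ≈ q ^ (6 + 6 * n)
        cube = begin
          x ⊗ x ⊗ x                                             ≈⟨ *-congʳ (^-+ q (2 + 2 * n) (2 + 2 * n)) ⟨
          q ^ (2 + 2 * n + (2 + 2 * n)) ⊗ x                     ≈⟨ ^-+ q (2 + 2 * n + (2 + 2 * n)) (2 + 2 * n) ⟨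
          q ^ (2 + 2 * n + (2 + 2 * n) + (2 + 2 * n))           ≡⟨ cong (q ^_) (triple n) ⟩
          q ^ (6 + 6 * n)                                       ∎

    -- The series K and its forms modulo 16 and modulo 3

    module Dissection (ι₁ ι₂ ι₄ ι₁₂ : Carrier)
      (inv₁ : η 1 ⊗ ι₁ ≈ 𝟙) (inv₂ : η 2 ⊗ ι₂ ≈ 𝟙) (inv₄ : η 4 ⊗ ι₄ ≈ 𝟙) (inv₁₂ : η 12 ⊗ ι₁₂ ≈ 𝟙) where

      -- c(q), c(q²) and c(q⁴) for the generating function c = f₃³/f₁ of 3-cores, and the even part of c(q).
      C₁ C₂ C₄ E : Carrier
      C₁ = η 3 ⊗ η 3 ⊗ η 3 ⊗ ι₁
      C₂ = η 6 ⊗ η 6 ⊗ η 6 ⊗ ι₂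
      C₄ = η 12 ⊗ η 12 ⊗ η 12 ⊗ ι₄
      E  = η 4 ⊗ η 4 ⊗ η 4 ⊗ η 6 ⊗ η 6 ⊗ (ι₂ ⊗ ι₂ ⊗ ι₁₂)

      C₁-dissect : C₁ ≈ E ⊕ q ⊗ C₄
      C₁-dissect = unit-cancel (unit-⊗ (unit-⊗ (unit-⊗ (ι₂ , inv₂) (ι₂ , inv₂)) (ι₁₂ , inv₁₂)) (ι₄ , inv₄)) (begin
        η 2 ⊗ η 2 ⊗ η 12 ⊗ η 4 ⊗ (η 3 ⊗ η 3 ⊗ η 3 ⊗ ι₁)
          ≈⟨ solve 3 (λ u c i → u :* (c :* i) := i :* (c :* u)) ≈-refl (η 2 ⊗ η 2 ⊗ η 12 ⊗ η 4) (η 3 ⊗ η 3 ⊗ η 3) ι₁ ⟩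
        ι₁ ⊗ (η 3 ⊗ η 3 ⊗ η 3 ⊗ (η 2 ⊗ η 2 ⊗ η 12 ⊗ η 4))
          ≈⟨ *-congˡ f₃³-dissect ⟩
        ι₁ ⊗ (η 1 ⊗ (η 4 ⊗ η 4 ⊗ η 4 ⊗ η 4 ⊗ η 6 ⊗ η 6 ⊕ q ⊗ (η 12 ⊗ η 12 ⊗ η 12 ⊗ η 12 ⊗ η 2 ⊗ η 2)))
          -- Besides cancelling f₁, this plants factors `𝟙` where f₂/f₂ (twice), f₁₂/f₁₂ and f₄/f₄
          -- are wanted next.
          ≈⟨ solve 7 (λ i a b d g h q → i :* (a :* (d :* d :* d :* d :* g :* g :+ q :* (h :* h :* h :* h :* b :* b)))
                       := (a :* i) :* (con 1ℤ :* con 1ℤ :* con 1ℤ :* (d :* d :* d :* d :* g :* g) :+ q :* (con 1ℤ :* (h :* h :* h :* h :* b :* b))))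
               ≈-refl ι₁ (η 1) (η 2) (η 4) (η 6) (η 12) q ⟩
        η 1 ⊗ ι₁ ⊗ (𝟙 ⊗ 𝟙 ⊗ 𝟙 ⊗ (η 4 ⊗ η 4 ⊗ η 4 ⊗ η 4 ⊗ η 6 ⊗ η 6) ⊕ q ⊗ (𝟙 ⊗ (η 12 ⊗ η 12 ⊗ η 12 ⊗ η 12 ⊗ η 2 ⊗ η 2)))
          ≈⟨ *-cong inv₁ (+-cong (*-congʳ (*-cong (*-cong (≈-sym inv₂) (≈-sym inv₂)) (≈-sym inv₁₂))) (*-congˡ (*-congʳ (≈-sym inv₄)))) ⟩
        𝟙 ⊗ ((η 2 ⊗ ι₂) ⊗ (η 2 ⊗ ι₂) ⊗ (η 12 ⊗ ι₁₂) ⊗ (η 4 ⊗ η 4 ⊗ η 4 ⊗ η 4 ⊗ η 6 ⊗ η 6) ⊕ q ⊗ ((η 4 ⊗ ι₄) ⊗ (η 12 ⊗ η 12 ⊗ η 12 ⊗ η 12 ⊗ η 2 ⊗ η 2)))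
          ≈⟨ solve 8 (λ b i d j g h k q → con 1ℤ :* ((b :* i) :* (b :* i) :* (h :* k) :* (d :* d :* d :* d :* g :* g) :+ q :* ((d :* j) :* (h :* h :* h :* h :* b :* b)))
                       := b :* b :* h :* d :* (d :* d :* d :* g :* g :* (i :* i :* k) :+ q :* (h :* h :* h :* j)))
               ≈-refl (η 2) ι₂ (η 4) ι₄ (η 6) (η 12) ι₁₂ q ⟩
        η 2 ⊗ η 2 ⊗ η 12 ⊗ η 4 ⊗ (E ⊕ q ⊗ C₄) ∎)
        where open ≈-Reasoning

      C₁²C₂² : ∀ {F} → F ⊗ (η 1 ^ 2 ⊗ η 2 ^ 2) ≈ η 3 ^ 6 ⊗ η 6 ^ 6 → F ≈ (C₁ ⊗ C₂) ⊗ (C₁ ⊗ C₂)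
      C₁²C₂² {F} F-eta = begin
        F
          ≈⟨ solve 1 (λ x → x := x :* (con 1ℤ :* con 1ℤ :* (con 1ℤ :* con 1ℤ))) ≈-refl F ⟩
        F ⊗ (𝟙 ⊗ 𝟙 ⊗ (𝟙 ⊗ 𝟙))
          ≈⟨ *-congˡ (*-cong (*-cong inv₁ inv₁) (*-cong inv₂ inv₂)) ⟨
        F ⊗ (η 1 ⊗ ι₁ ⊗ (η 1 ⊗ ι₁) ⊗ (η 2 ⊗ ι₂ ⊗ (η 2 ⊗ ι₂)))
          ≈⟨ solve 5 (λ x a i b j → x :* (a :* i :* (a :* i) :* (b :* j :* (b :* j))) := x :* ((a :* (a :* con 1ℤ)) :* (b :* (b :* con 1ℤ))) :* (i :* i :* (j :* j))) ≈-refl F (η 1) ι₁ (η 2) ι₂ ⟩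
        F ⊗ (η 1 ^ 2 ⊗ η 2 ^ 2) ⊗ (ι₁ ⊗ ι₁ ⊗ (ι₂ ⊗ ι₂))
          ≈⟨ *-congʳ F-eta ⟩
        η 3 ^ 6 ⊗ η 6 ^ 6 ⊗ (ι₁ ⊗ ι₁ ⊗ (ι₂ ⊗ ι₂))
          ≈⟨ solve 4 (λ c g i j → (c :* (c :* (c :* (c :* (c :* (c :* con 1ℤ)))))) :* (g :* (g :* (g :* (g :* (g :* (g :* con 1ℤ)))))) :* (i :* i :* (j :* j))
               := (c :* c :* c :* i :* (g :* g :* g :* j)) :* (c :* c :* c :* i :* (g :* g :* g :* j))) ≈-refl (η 3) (η 6) ι₁ ι₂ ⟩
        (C₁ ⊗ C₂) ⊗ (C₁ ⊗ C₂) ∎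
        where open ≈-Reasoning

      K : Carrier
      K = C₂ ⊗ C₂ ⊗ E ⊗ C₄

      -- The cross term is the only one with an odd power of q in front, and it carries the factor 2
      -- of both moduli.
      square-dissect : (C₁ ⊗ C₂) ⊗ (C₁ ⊗ C₂) ≈ C₂ ⊗ C₂ ⊗ (E ⊗ E ⊕ q ⊗ q ⊗ (C₄ ⊗ C₄)) ⊕ q ⊗ (⟦ + 2 ⟧ ⊗ K)
      square-dissect = ≈-trans (*-cong (*-congʳ C₁-dissect) (*-congʳ C₁-dissect))
        (solve 4 (λ e c₂ c₄ q → ((e :+ q :* c₄) :* c₂) :* ((e :+ q :* c₄) :* c₂)
           := c₂ :* c₂ :* (e :* e :+ q :* q :* (c₄ :* c₄)) :+ q :* (con (+ 2) :* (c₂ :* c₂ :* e :* c₄))) ≈-refl E C₂ C₄ q)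

      K-eta : K ⊗ (η 2 ⊗ η 2 ⊗ η 2 ⊗ η 2) ≈ η 4 ⊗ η 4 ⊗ (η 6 ⊗ η 6 ⊗ η 6 ⊗ η 6 ⊗ (η 6 ⊗ η 6 ⊗ η 6 ⊗ η 6)) ⊗ (η 12 ⊗ η 12)
      K-eta = begin
        K ⊗ (η 2 ⊗ η 2 ⊗ η 2 ⊗ η 2)
          ≈⟨ solve 7 (λ b i d j g h k →
               (g :* g :* g :* i) :* (g :* g :* g :* i) :* (d :* d :* d :* g :* g :* (i :* i :* k)) :* (h :* h :* h :* j) :* (b :* b :* b :* b)
               := (b :* i) :* (b :* i) :* (b :* i) :* (b :* i) :* (d :* j) :* (h :* k) :* (d :* d :* (g :* g :* g :* g :* (g :* g :* g :* g)) :* (h :* h)))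
               ≈-refl (η 2) ι₂ (η 4) ι₄ (η 6) (η 12) ι₁₂ ⟩
        (η 2 ⊗ ι₂) ⊗ (η 2 ⊗ ι₂) ⊗ (η 2 ⊗ ι₂) ⊗ (η 2 ⊗ ι₂) ⊗ (η 4 ⊗ ι₄) ⊗ (η 12 ⊗ ι₁₂) ⊗ W
          ≈⟨ *-congʳ (*-cong (*-cong (*-cong (*-cong (*-cong inv₂ inv₂) inv₂) inv₂) inv₄) inv₁₂) ⟩
        𝟙 ⊗ 𝟙 ⊗ 𝟙 ⊗ 𝟙 ⊗ 𝟙 ⊗ 𝟙 ⊗ W
          ≈⟨ solve 1 (λ w → con 1ℤ :* con 1ℤ :* con 1ℤ :* con 1ℤ :* con 1ℤ :* con 1ℤ :* w := w) ≈-refl W ⟩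
        W ∎
        where
        open ≈-Reasoning
        W = η 4 ⊗ η 4 ⊗ (η 6 ⊗ η 6 ⊗ η 6 ⊗ η 6 ⊗ (η 6 ⊗ η 6 ⊗ η 6 ⊗ η 6)) ⊗ (η 12 ⊗ η 12)

      -- By `gauss-square`, f₂⁴ = φ₂²f₄² and f₆⁸ = φ₆⁴f₁₂⁴. The f₄ cancel and f₁₂⁶ remains, written
      -- as a square because the parity of its coefficients comes from that.
      K-theta : let φ₂ = Θ (⊝ 𝟙) 2 2 ; φ₆ = Θ (⊝ 𝟙) 6 6 ; g = η 12 ⊗ η 12 ⊗ η 12 in
                K ⊗ (φ₂ ⊗ φ₂) ≈ φ₆ ⊗ φ₆ ⊗ φ₆ ⊗ φ₆ ⊗ (g ⊗ g)
      K-theta = unit-cancel (unit-⊗ (unit-⊗ d d) (unit-⊗ (unit-⊗ h h) (unit-⊗ h h))) (begin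
        η 4 ⊗ η 4 ⊗ (η 12 ⊗ η 12 ⊗ (η 12 ⊗ η 12)) ⊗ (K ⊗ (φ₂ ⊗ φ₂))
          ≈⟨ solve 4 (λ d h k p → d :* d :* (h :* h :* (h :* h)) :* (k :* (p :* p)) := k :* ((p :* d) :* (p :* d)) :* (h :* h :* (h :* h))) ≈-refl (η 4) (η 12) K φ₂ ⟩
        K ⊗ ((φ₂ ⊗ η 4) ⊗ (φ₂ ⊗ η 4)) ⊗ (η 12 ⊗ η 12 ⊗ (η 12 ⊗ η 12))
          ≈⟨ *-congʳ (*-congˡ (*-cong (gauss-square 2) (gauss-square 2))) ⟩
        K ⊗ ((η 2 ⊗ η 2) ⊗ (η 2 ⊗ η 2)) ⊗ (η 12 ⊗ η 12 ⊗ (η 12 ⊗ η 12))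
          ≈⟨ *-congʳ (≈-trans (*-congˡ (≈-sym (*-assoc _ _ _))) K-eta) ⟩
        η 4 ⊗ η 4 ⊗ (η 6 ⊗ η 6 ⊗ η 6 ⊗ η 6 ⊗ (η 6 ⊗ η 6 ⊗ η 6 ⊗ η 6)) ⊗ (η 12 ⊗ η 12) ⊗ (η 12 ⊗ η 12 ⊗ (η 12 ⊗ η 12))
          ≈⟨ solve 3 (λ d g h → d :* d :* (g :* g :* g :* g :* (g :* g :* g :* g)) :* (h :* h) :* (h :* h :* (h :* h))
                := d :* d :* ((g :* g) :* (g :* g) :* (g :* g) :* (g :* g)) :* ((h :* h :* h) :* (h :* h :* h))) ≈-refl (η 4) (η 6) (η 12) ⟩
        η 4 ⊗ η 4 ⊗ ((η 6 ⊗ η 6) ⊗ (η 6 ⊗ η 6) ⊗ (η 6 ⊗ η 6) ⊗ (η 6 ⊗ η 6)) ⊗ (g ⊗ g)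
          ≈⟨ *-congʳ (*-congˡ (*-cong (*-cong (*-cong (gauss-square 6) (gauss-square 6)) (gauss-square 6)) (gauss-square 6))) ⟨
        η 4 ⊗ η 4 ⊗ ((φ₆ ⊗ η 12) ⊗ (φ₆ ⊗ η 12) ⊗ (φ₆ ⊗ η 12) ⊗ (φ₆ ⊗ η 12)) ⊗ (g ⊗ g)
          ≈⟨ solve 4 (λ d h p g → d :* d :* ((p :* h) :* (p :* h) :* (p :* h) :* (p :* h)) :* (g :* g)
                := d :* d :* (h :* h :* (h :* h)) :* (p :* p :* p :* p :* (g :* g))) ≈-refl (η 4) (η 12) φ₆ g ⟩
        η 4 ⊗ η 4 ⊗ (η 12 ⊗ η 12 ⊗ (η 12 ⊗ η 12)) ⊗ (φ₆ ⊗ φ₆ ⊗ φ₆ ⊗ φ₆ ⊗ (g ⊗ g)) ∎)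
        where
        open ≈-Reasoning
        φ₂ = Θ (⊝ 𝟙) 2 2
        φ₆ = Θ (⊝ 𝟙) 6 6
        g = η 12 ⊗ η 12 ⊗ η 12
        d = ι₄ , inv₄
        h = ι₁₂ , inv₁₂

      -- With φ = 1 + 2h one has φ² = 1 + 4u, so multiplying K-theta by 1 - 4u isolates K modulo 16.
      K-mod-16 : let u = half 2 ⊕ half 2 ⊗ half 2 ; v = half 6 ⊕ half 6 ⊗ half 6 ; g = η 12 ⊗ η 12 ⊗ η 12 in
        ∃ λ w → K ≈ g ⊗ g ⊕ ⟦ - (+ 4) ⟧ ⊗ (g ⊗ g ⊗ u) ⊕ ⟦ + 8 ⟧ ⊗ (g ⊗ g ⊗ v) ⊕ ⟦ + 16 ⟧ ⊗ w
      K-mod-16 = w , (begin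
        K
          -- Since (1 - 4u)(1 + 4u) = 1 - 16u², the correction is a multiple of 16.
          ≈⟨ solve 3 (λ k s g → let u = s :+ s :* s ; p = con 1ℤ :+ con (+ 2) :* s in
               k := (con 1ℤ :+ con (- (+ 4)) :* u) :* (k :* (p :* p)) :+ con (+ 16) :* (k :* u :* u)) ≈-refl K (half 2) (g ⊗ g) ⟩
        (𝟙 ⊕ ⟦ - (+ 4) ⟧ ⊗ u) ⊗ (K ⊗ ((𝟙 ⊕ ⟦ + 2 ⟧ ⊗ half 2) ⊗ (𝟙 ⊕ ⟦ + 2 ⟧ ⊗ half 2))) ⊕ ⟦ + 16 ⟧ ⊗ (K ⊗ u ⊗ u)
          ≈⟨ +-congʳ (*-congˡ (≈-trans (*-congˡ (*-cong (≈-sym (Θ-half 2)) (≈-sym (Θ-half 2)))) (≈-trans K-theta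
               (*-congʳ (*-cong (*-cong (*-cong (Θ-half 6) (Θ-half 6)) (Θ-half 6)) (Θ-half 6)))))) ⟩
        (𝟙 ⊕ ⟦ - (+ 4) ⟧ ⊗ u) ⊗ (p₆ ⊗ p₆ ⊗ p₆ ⊗ p₆ ⊗ (g ⊗ g)) ⊕ ⟦ + 16 ⟧ ⊗ (K ⊗ u ⊗ u)
          -- Here p⁴ = (1 + 4v)² = 1 + 8v + 16v², and the mixed term -32uv also goes into `w`.
          ≈⟨ solve 4 (λ k u t g → let v = t :+ t :* t ; p = con 1ℤ :+ con (+ 2) :* t in
               (con 1ℤ :+ con (- (+ 4)) :* u) :* (p :* p :* p :* p :* g) :+ con (+ 16) :* (k :* u :* u)
               := g :+ con (- (+ 4)) :* (g :* u) :+ con (+ 8) :* (g :* v) :+ con (+ 16) :* (k :* u :* u :+ g :* (v :* v :+ con (- (+ 2)) :* (u :* v) :+ con (- (+ 4)) :* (u :* v :* v))))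
               ≈-refl K u (half 6) (g ⊗ g) ⟩
        g ⊗ g ⊕ ⟦ - (+ 4) ⟧ ⊗ (g ⊗ g ⊗ u) ⊕ ⟦ + 8 ⟧ ⊗ (g ⊗ g ⊗ v) ⊕ ⟦ + 16 ⟧ ⊗ w ∎)
        where
        open ≈-Reasoning
        g = η 12 ⊗ η 12 ⊗ η 12
        u = half 2 ⊕ half 2 ⊗ half 2
        v = half 6 ⊕ half 6 ⊗ half 6
        p₆ = 𝟙 ⊕ ⟦ + 2 ⟧ ⊗ half 6
        w = K ⊗ u ⊗ u ⊕ g ⊗ g ⊗ (v ⊗ v ⊕ ⟦ - (+ 2) ⟧ ⊗ (u ⊗ v) ⊕ ⟦ - (+ 4) ⟧ ⊗ (u ⊗ v ⊗ v))

      -- As f₆ = f₂³ - 3t, the product f₂f₆K is f₂⁴K minus 3f₂tK. The first is the eta product of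
      -- `K-eta`, in which f₄² = ψf₂; cancelling f₂f₆ leaves seven factors f₆ and the witness
      -- -Kt/f₆.
      K-mod-3 : ∃ λ w → K ≈ Θ 𝟙 2 6 ⊗ (η 6 ⊗ η 6 ⊗ η 6 ⊗ η 6 ⊗ (η 6 ⊗ η 6 ⊗ η 6) ⊗ (η 12 ⊗ η 12)) ⊕ ⟦ + 3 ⟧ ⊗ w
      K-mod-3 with η₂³-mod-3
      ... | t , η₂³ = ⊝ (K ⊗ t ⊗ ι₆) , unit-cancel (unit-⊗ (ι₂ , inv₂) (ι₆ , inv₆)) (begin
        b ⊗ g ⊗ K
          ≈⟨ solve 4 (λ b g k t → b :* g :* k := k :* ((g :+ con (+ 3) :* t) :* b) :+ :- (con (+ 3) :* (k :* b :* t) :* con 1ℤ)) ≈-refl b g K t ⟩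
        K ⊗ ((g ⊕ ⟦ + 3 ⟧ ⊗ t) ⊗ b) ⊕ ⊝ (⟦ + 3 ⟧ ⊗ (K ⊗ b ⊗ t) ⊗ 𝟙)
          ≈⟨ +-cong (≈-trans (*-congˡ (*-congʳ (≈-sym η₂³))) K-eta) (-‿cong (*-congˡ (≈-sym inv₆))) ⟩
        η 4 ⊗ η 4 ⊗ (g ⊗ g ⊗ g ⊗ g ⊗ (g ⊗ g ⊗ g ⊗ g)) ⊗ (η 12 ⊗ η 12) ⊕ ⊝ (⟦ + 3 ⟧ ⊗ (K ⊗ b ⊗ t) ⊗ (g ⊗ ι₆))
          ≈⟨ +-congʳ (*-congʳ (*-congʳ (≈-sym gauss-triangular))) ⟩
        ψ ⊗ b ⊗ (g ⊗ g ⊗ g ⊗ g ⊗ (g ⊗ g ⊗ g ⊗ g)) ⊗ (η 12 ⊗ η 12) ⊕ ⊝ (⟦ + 3 ⟧ ⊗ (K ⊗ b ⊗ t) ⊗ (g ⊗ ι₆))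
          ≈⟨ solve 7 (λ ψ b g h k t i → ψ :* b :* (g :* g :* g :* g :* (g :* g :* g :* g)) :* (h :* h) :+ :- (con (+ 3) :* (k :* b :* t) :* (g :* i))
               := b :* g :* (ψ :* (g :* g :* g :* g :* (g :* g :* g) :* (h :* h)) :+ con (+ 3) :* :- (k :* t :* i))) ≈-refl ψ b g (η 12) K t ι₆ ⟩
        b ⊗ g ⊗ (ψ ⊗ (g ⊗ g ⊗ g ⊗ g ⊗ (g ⊗ g ⊗ g) ⊗ (η 12 ⊗ η 12)) ⊕ ⟦ + 3 ⟧ ⊗ ⊝ (K ⊗ t ⊗ ι₆)) ∎)
        where
        open ≈-Reasoning
        b = η 2
        g = η 6
        ψ = Θ 𝟙 2 6
        ι₆ = proj₁ (η-unit 6)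
        inv₆ = proj₂ (η-unit 6)

-- The ring of formal power series

constS : ℤ → Series
constS c zero    = c
constS c (suc _) = 0ℤ

𝟙 : Series
𝟙 = constS 1ℤ

tail : Series → Series
tail a n = a (suc n)

shift : Series → Series
shift a zero    = 0ℤ
shift a (suc n) = a n

infixl 6 _⊕_
infix  8 ⊝_

_⊕_ : Series → Series → Series
(a ⊕ b) n = a n +ℤ b n

⊝_ : Series → Series
(⊝ a) n = - a n

scale : ℤ → Series → Series
scale c a n = c *ℤ a n

sum-cong : ∀ {g h : ℕ → ℤ} n → (∀ {k} → k < n → g k ≡ h k) → sumℤ (map g (upTo n)) ≡ sumℤ (map h (upTo n))
sum-cong n eq = cong sumℤ (map-cong-local (All.map eq (all-upTo n)))

-- Splitting off the term k = 0 leaves a convolution with the tail, a recursion on n from which the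
-- ring laws follow without reindexing sums.
⊛-suc : ∀ a b n → (a ⊛ b) (suc n) ≡ a 0 *ℤ b (suc n) +ℤ (tail a ⊛ b) n
⊛-suc a b n = cong (λ s → a 0 *ℤ b (suc n) +ℤ sumℤ s)
  (trans (map-applyUpTo suc (λ k → a k *ℤ b (suc n ∸ k)) (suc n)) (sym (map-upTo (λ k → a (suc k) *ℤ b (n ∸ k)) (suc n))))

⊛-zero : ∀ a b → (a ⊛ b) 0 ≡ a 0 *ℤ b 0
⊛-zero a b = ℤ.+-identityʳ _

⊛-cong≤ : ∀ {a a′ b b′} n → (∀ k → k ≤ n → a k ≡ a′ k) → (∀ k → k ≤ n → b k ≡ b′ k) →
          (a ⊛ b) n ≡ (a′ ⊛ b′) n
⊛-cong≤ n p q = sum-cong (suc n) (λ {k} k<n → cong₂ _*ℤ_ (p k (ℕ.≤-pred k<n)) (q (n ∸ k) (ℕ.m∸n≤m n k)))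

⊛-cong : ∀ {a a′ b b′} → a ≗ a′ → b ≗ b′ → a ⊛ b ≗ a′ ⊛ b′
⊛-cong p q n = ⊛-cong≤ n (λ k _ → p k) (λ k _ → q k)

-- The mirror image of `⊛-suc`: together they give commutativity, and in `square-even` they remove
-- both ends of a convolution.
⊛-last : ∀ a b n → (a ⊛ b) (suc n) ≡ (a ⊛ tail b) n +ℤ a (suc n) *ℤ b 0
⊛-last a b zero = begin
  (a ⊛ b) 1                          ≡⟨ ⊛-suc a b 0 ⟩
  a 0 *ℤ b 1 +ℤ (tail a ⊛ b) 0       ≡⟨ cong₂ _+ℤ_ (⊛-zero a (tail b)) (sym (⊛-zero (tail a) b)) ⟨
  (a ⊛ tail b) 0 +ℤ a 1 *ℤ b 0       ∎
  where open ≡-Reasoning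
⊛-last a b (suc n) = begin
  (a ⊛ b) (2 + n)                                                      ≡⟨ ⊛-suc a b (suc n) ⟩
  a 0 *ℤ b (2 + n) +ℤ (tail a ⊛ b) (suc n)                             ≡⟨ cong (a 0 *ℤ b (2 + n) +ℤ_) (⊛-last (tail a) b n) ⟩
  a 0 *ℤ b (2 + n) +ℤ ((tail a ⊛ tail b) n +ℤ a (2 + n) *ℤ b 0)        ≡⟨ ℤ.+-assoc (a 0 *ℤ b (2 + n)) _ _ ⟨
  a 0 *ℤ b (2 + n) +ℤ (tail a ⊛ tail b) n +ℤ a (2 + n) *ℤ b 0          ≡⟨ cong (_+ℤ a (2 + n) *ℤ b 0) (⊛-suc a (tail b) n) ⟨
  (a ⊛ tail b) (suc n) +ℤ a (2 + n) *ℤ b 0                             ∎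
  where open ≡-Reasoning

⊛-comm : ∀ a b → a ⊛ b ≗ b ⊛ a
⊛-comm a b zero = begin
  (a ⊛ b) 0   ≡⟨ ⊛-zero a b ⟩
  a 0 *ℤ b 0  ≡⟨ ℤ.*-comm (a 0) (b 0) ⟩
  b 0 *ℤ a 0  ≡⟨ ⊛-zero b a ⟨
  (b ⊛ a) 0   ∎
  where open ≡-Reasoning
⊛-comm a b (suc n) = begin
  (a ⊛ b) (suc n)                        ≡⟨ ⊛-suc a b n ⟩
  a 0 *ℤ b (suc n) +ℤ (tail a ⊛ b) n     ≡⟨ cong₂ _+ℤ_ (ℤ.*-comm (a 0) _) (⊛-comm (tail a) b n) ⟩
  b (suc n) *ℤ a 0 +ℤ (b ⊛ tail a) n     ≡⟨ ℤ.+-comm (b (suc n) *ℤ a 0) _ ⟩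
  (b ⊛ tail a) n +ℤ b (suc n) *ℤ a 0     ≡⟨ ⊛-last b a n ⟨
  (b ⊛ a) (suc n)                        ∎
  where open ≡-Reasoning

⊛-distribʳ : ∀ a b c → (b ⊕ c) ⊛ a ≗ b ⊛ a ⊕ c ⊛ a
⊛-distribʳ a b c zero = begin
  ((b ⊕ c) ⊛ a) 0               ≡⟨ ⊛-zero (b ⊕ c) a ⟩
  (b 0 +ℤ c 0) *ℤ a 0           ≡⟨ ℤ.*-distribʳ-+ (a 0) (b 0) (c 0) ⟩
  b 0 *ℤ a 0 +ℤ c 0 *ℤ a 0      ≡⟨ cong₂ _+ℤ_ (⊛-zero b a) (⊛-zero c a) ⟨
  (b ⊛ a) 0 +ℤ (c ⊛ a) 0        ∎
  where open ≡-Reasoning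
⊛-distribʳ a b c (suc n) = begin
  ((b ⊕ c) ⊛ a) (suc n)                                               ≡⟨ ⊛-suc (b ⊕ c) a n ⟩
  (b 0 +ℤ c 0) *ℤ a (suc n) +ℤ ((tail b ⊕ tail c) ⊛ a) n              ≡⟨ cong ((b 0 +ℤ c 0) *ℤ a (suc n) +ℤ_) (⊛-distribʳ a (tail b) (tail c) n) ⟩
  (b 0 +ℤ c 0) *ℤ a (suc n) +ℤ ((tail b ⊛ a) n +ℤ (tail c ⊛ a) n)     ≡⟨ lemma (b 0) (c 0) (a (suc n)) ((tail b ⊛ a) n) ((tail c ⊛ a) n) ⟩
  (b 0 *ℤ a (suc n) +ℤ (tail b ⊛ a) n) +ℤ (c 0 *ℤ a (suc n) +ℤ (tail c ⊛ a) n)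
    ≡⟨ cong₂ _+ℤ_ (⊛-suc b a n) (⊛-suc c a n) ⟨
  (b ⊛ a) (suc n) +ℤ (c ⊛ a) (suc n)                                  ∎
  where
  open ≡-Reasoning
  lemma : ∀ x y z u v → (x +ℤ y) *ℤ z +ℤ (u +ℤ v) ≡ (x *ℤ z +ℤ u) +ℤ (y *ℤ z +ℤ v)
  lemma = ℤ.solve-∀

scale-⊛ : ∀ c a b → scale c a ⊛ b ≗ scale c (a ⊛ b)
scale-⊛ c a b zero = begin
  (scale c a ⊛ b) 0       ≡⟨ ⊛-zero (scale c a) b ⟩
  c *ℤ a 0 *ℤ b 0         ≡⟨ ℤ.*-assoc c (a 0) (b 0) ⟩
  c *ℤ (a 0 *ℤ b 0)       ≡⟨ cong (c *ℤ_) (⊛-zero a b) ⟨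
  c *ℤ (a ⊛ b) 0          ∎
  where open ≡-Reasoning
scale-⊛ c a b (suc n) = begin
  (scale c a ⊛ b) (suc n)                                    ≡⟨ ⊛-suc (scale c a) b n ⟩
  c *ℤ a 0 *ℤ b (suc n) +ℤ (scale c (tail a) ⊛ b) n          ≡⟨ cong₂ _+ℤ_ (ℤ.*-assoc c (a 0) _) (scale-⊛ c (tail a) b n) ⟩
  c *ℤ (a 0 *ℤ b (suc n)) +ℤ c *ℤ (tail a ⊛ b) n             ≡⟨ ℤ.*-distribˡ-+ c _ _ ⟨
  c *ℤ (a 0 *ℤ b (suc n) +ℤ (tail a ⊛ b) n)                  ≡⟨ cong (c *ℤ_) (⊛-suc a b n) ⟨
  c *ℤ (a ⊛ b) (suc n)                                       ∎
  where open ≡-Reasoning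

⊛-assoc : ∀ a b c → (a ⊛ b) ⊛ c ≗ a ⊛ (b ⊛ c)
⊛-assoc a b c zero = begin
  ((a ⊛ b) ⊛ c) 0          ≡⟨ trans (⊛-zero (a ⊛ b) c) (cong (_*ℤ c 0) (⊛-zero a b)) ⟩
  a 0 *ℤ b 0 *ℤ c 0        ≡⟨ ℤ.*-assoc (a 0) (b 0) (c 0) ⟩
  a 0 *ℤ (b 0 *ℤ c 0)      ≡⟨ trans (⊛-zero a (b ⊛ c)) (cong (a 0 *ℤ_) (⊛-zero b c)) ⟨
  (a ⊛ (b ⊛ c)) 0          ∎
  where open ≡-Reasoning
⊛-assoc a b c (suc n) = begin
  ((a ⊛ b) ⊛ c) (suc n)
    ≡⟨ ⊛-suc (a ⊛ b) c n ⟩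
  (a ⊛ b) 0 *ℤ c (suc n) +ℤ (tail (a ⊛ b) ⊛ c) n
    ≡⟨ cong₂ _+ℤ_ (cong (_*ℤ c (suc n)) (⊛-zero a b)) (trans (⊛-cong {b = c} (⊛-suc a b) (λ _ → refl) n) (⊛-distribʳ c (scale (a 0) (tail b)) (tail a ⊛ b) n)) ⟩
  a 0 *ℤ b 0 *ℤ c (suc n) +ℤ ((scale (a 0) (tail b) ⊛ c) n +ℤ ((tail a ⊛ b) ⊛ c) n)
    ≡⟨ cong (a 0 *ℤ b 0 *ℤ c (suc n) +ℤ_) (cong₂ _+ℤ_ (scale-⊛ (a 0) (tail b) c n) (⊛-assoc (tail a) b c n)) ⟩
  a 0 *ℤ b 0 *ℤ c (suc n) +ℤ (a 0 *ℤ (tail b ⊛ c) n +ℤ (tail a ⊛ (b ⊛ c)) n)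
    ≡⟨ lemma (a 0) (b 0) (c (suc n)) ((tail b ⊛ c) n) ((tail a ⊛ (b ⊛ c)) n) ⟩
  a 0 *ℤ (b 0 *ℤ c (suc n) +ℤ (tail b ⊛ c) n) +ℤ (tail a ⊛ (b ⊛ c)) n
    ≡⟨ trans (⊛-suc a (b ⊛ c) n) (cong (λ s → a 0 *ℤ s +ℤ (tail a ⊛ (b ⊛ c)) n) (⊛-suc b c n)) ⟨
  (a ⊛ (b ⊛ c)) (suc n) ∎
  where
  open ≡-Reasoning
  lemma : ∀ x y z u v → x *ℤ y *ℤ z +ℤ (x *ℤ u +ℤ v) ≡ x *ℤ (y *ℤ z +ℤ u) +ℤ v
  lemma = ℤ.solve-∀

constS-⊛ : ∀ c a → constS c ⊛ a ≗ scale c a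
constS-⊛ c a zero    = ⊛-zero (constS c) a
constS-⊛ c a (suc n) = trans (⊛-suc (constS c) a n)
  (trans (cong (c *ℤ a (suc n) +ℤ_) (zero-⊛ n)) (ℤ.+-identityʳ _))
  where
  zero-⊛ : ∀ n → ((λ _ → 0ℤ) ⊛ a) n ≡ 0ℤ
  zero-⊛ zero    = ⊛-zero (λ _ → 0ℤ) a
  zero-⊛ (suc n) = trans (⊛-suc (λ _ → 0ℤ) a n) (trans (ℤ.+-identityˡ _) (zero-⊛ n))

⊛-identityˡ : ∀ a → 𝟙 ⊛ a ≗ a
⊛-identityˡ a n = trans (constS-⊛ 1ℤ a n) (ℤ.*-identityˡ (a n))

shift-⊛ : ∀ a b → shift a ⊛ b ≗ shift (a ⊛ b)
shift-⊛ a b zero    = ⊛-zero (shift a) b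
shift-⊛ a b (suc n) = trans (⊛-suc (shift a) b n) (ℤ.+-identityˡ _)

-- The coefficient lookup used by inv is private to Defs; unification in inv-suc recovers it.
mutual
  lookupD′ : List ℤ → ℕ → ℤ
  lookupD′ = _

  inv-suc : ∀ a n → inv a (suc n) ≡ - sumℤ (map (λ k → a (suc k) *ℤ lookupD′ (invList a n) k) (upTo (suc n)))
  inv-suc a n with invList a n
  ... | xs = refl

lookupD′-invList : ∀ a n {k} → k ≤ n → lookupD′ (invList a n) k ≡ inv a (n ∸ k)
lookupD′-invList a n       z≤n     = refl
lookupD′-invList a (suc n) (s≤s p) = lookupD′-invList a n p

⊛-inv : ∀ a → a 0 ≡ 1ℤ → a ⊛ inv a ≗ 𝟙
⊛-inv a a₀ zero = trans (⊛-zero a (inv a)) (cong (_*ℤ 1ℤ) a₀)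
⊛-inv a a₀ (suc n) = begin
  (a ⊛ inv a) (suc n)                        ≡⟨ ⊛-suc a (inv a) n ⟩
  a 0 *ℤ inv a (suc n) +ℤ (tail a ⊛ inv a) n ≡⟨ cong (λ c → c *ℤ inv a (suc n) +ℤ (tail a ⊛ inv a) n) a₀ ⟩
  1ℤ *ℤ inv a (suc n) +ℤ (tail a ⊛ inv a) n  ≡⟨ cong (_+ℤ (tail a ⊛ inv a) n) (ℤ.*-identityˡ (inv a (suc n))) ⟩
  inv a (suc n) +ℤ (tail a ⊛ inv a) n        ≡⟨ cong (_+ℤ (tail a ⊛ inv a) n) (trans (inv-suc a n) (cong -_ (sum-cong (suc n)
                                                  (λ {k} k<n → cong (a (suc k) *ℤ_) (lookupD′-invList a n (ℕ.≤-pred k<n)))))) ⟩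
  - (tail a ⊛ inv a) n +ℤ (tail a ⊛ inv a) n ≡⟨ ℤ.+-inverseˡ ((tail a ⊛ inv a) n) ⟩
  0ℤ                                         ∎
  where open ≡-Reasoning

-- Power series modulo q^M

record _≈[_]_ (a : Series) (M : ℕ) (b : Series) : Set where
  constructor below
  field coeff : ∀ k → k < M → a k ≡ b k
open _≈[_]_

pointwise : ∀ {M a b} → a ≗ b → a ≈[ M ] b
pointwise eq = below (λ k _ → eq k)

truncatedSeries : ℕ → CommutativeRing 0ℓ 0ℓ
truncatedSeries M = record
  { Carrier = Series ; _≈_ = _≈[ M ]_ ; _+_ = _⊕_ ; _*_ = _⊛_ ; -_ = ⊝_ ; 0# = constS 0ℤ ; 1# = 𝟙
  ; isCommutativeRing = record
    { isRing = record
      { +-isAbelianGroup = record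
        { isGroup = record
          { isMonoid = record
            { isSemigroup = record
              { isMagma = record
                { isEquivalence = record
                  { refl  = pointwise (λ _ → refl)
                  ; sym   = λ p → below (λ k l → sym (coeff p k l))
                  ; trans = λ p q → below (λ k l → trans (coeff p k l) (coeff q k l))
                  }
                ; ∙-cong = λ p q → below (λ k l → cong₂ _+ℤ_ (coeff p k l) (coeff q k l))
                }
              ; assoc = λ a b c → pointwise (λ k → ℤ.+-assoc (a k) (b k) (c k))
              }
            ; identity = (λ a → pointwise (λ { zero → ℤ.+-identityˡ _ ; (suc k) → ℤ.+-identityˡ _ }))
                       , (λ a → pointwise (λ { zero → ℤ.+-identityʳ _ ; (suc k) → ℤ.+-identityʳ _ }))
            }
          ; inverse = (λ a → pointwise (λ { zero → ℤ.+-inverseˡ (a 0) ; (suc k) → ℤ.+-inverseˡ (a (suc k)) }))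
                    , (λ a → pointwise (λ { zero → ℤ.+-inverseʳ (a 0) ; (suc k) → ℤ.+-inverseʳ (a (suc k)) }))
          ; ⁻¹-cong = λ p → below (λ k l → cong -_ (coeff p k l))
          }
        ; comm = λ a b → pointwise (λ k → ℤ.+-comm (a k) (b k))
        }
      ; *-cong = λ p q → below (λ k l → ⊛-cong≤ k (λ j j≤k → coeff p j (ℕ.≤-<-trans j≤k l))
                                                  (λ j j≤k → coeff q j (ℕ.≤-<-trans j≤k l)))
      ; *-assoc = λ a b c → pointwise (⊛-assoc a b c)
      ; *-identity = (λ a → pointwise (⊛-identityˡ a))
                   , (λ a → pointwise (λ k → trans (⊛-comm a 𝟙 k) (⊛-identityˡ a k)))
      ; distrib = (λ a b c → pointwise (λ k → trans (⊛-comm a (b ⊕ c) k)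
                     (trans (⊛-distribʳ a b c k) (cong₂ _+ℤ_ (⊛-comm b a k) (⊛-comm c a k)))))
                , (λ a b c → pointwise (⊛-distribʳ a b c))
      }
    ; *-comm = λ a b → pointwise (⊛-comm a b)
    }
  }

constants : ∀ M → +-*-rawRing -Raw-AlmostCommutative⟶ fromCommutativeRing (truncatedSeries M)
constants M = record
  { ⟦_⟧    = constS
  ; +-homo = λ c d → pointwise (λ { zero → refl ; (suc k) → refl })
  ; *-homo = λ c d → pointwise (λ { zero → sym (constS-⊛ c (constS d) 0)
                                  ; (suc k) → sym (trans (constS-⊛ c (constS d) (suc k)) (ℤ.*-zeroʳ c)) })
  ; -‿homo = λ c → pointwise (λ { zero → refl ; (suc k) → refl })
  ; 0-homo = pointwise (λ _ → refl)
  ; 1-homo = pointwise (λ _ → refl)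
  }

-- Divisibility and supports of coefficients

∣-⊛ : ∀ p a b n → (∀ k l → k + l ≡ n → p ∣ℤ a k *ℤ b l) → p ∣ℤ (a ⊛ b) n
∣-⊛ p a b zero    d = subst (p ∣ℤ_) (sym (⊛-zero a b)) (d 0 0 refl)
∣-⊛ p a b (suc n) d = subst (p ∣ℤ_) (sym (⊛-suc a b n))
  (ℤ∣.∣m∣n⇒∣m+n (d 0 (suc n) refl) (∣-⊛ p (tail a) b n (λ k l k+l≡n → d (suc k) l (cong suc k+l≡n))))

-- The products at k and 2m - k coincide, and the unpaired a(m)² is zero. Removing both ends of the
-- sum replaces a by its tail and m by m - 1.
square-even : ∀ a m → a m ≡ 0ℤ → + 2 ∣ℤ (a ⊛ a) (m + m)
square-even a zero a₀≡0 = dividesℤ 0ℤ (trans (⊛-zero a a) (cong (_*ℤ a 0) a₀≡0))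
square-even a (suc m) aₘ≡0 = subst (+ 2 ∣ℤ_) (sym split)
  (ℤ∣.∣m∣n⇒∣m+n (dividesℤ (a 0 *ℤ a (2 + (m + m))) (twice (a 0) (a (2 + (m + m))))) (square-even (tail a) m aₘ≡0))
  where
  open ≡-Reasoning
  twice : ∀ x y → x *ℤ y +ℤ y *ℤ x ≡ x *ℤ y *ℤ + 2
  twice = ℤ.solve-∀
  regroup : ∀ x y z → x +ℤ (y +ℤ z) ≡ x +ℤ z +ℤ y
  regroup = ℤ.solve-∀
  split : (a ⊛ a) (suc m + suc m) ≡ a 0 *ℤ a (2 + (m + m)) +ℤ a (2 + (m + m)) *ℤ a 0 +ℤ (tail a ⊛ tail a) (m + m)
  split = begin
    (a ⊛ a) (suc m + suc m)
      ≡⟨ cong (λ k → (a ⊛ a) (suc k)) (ℕ.+-suc m m) ⟩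
    (a ⊛ a) (2 + (m + m))
      ≡⟨ ⊛-suc a a (suc (m + m)) ⟩
    a 0 *ℤ a (2 + (m + m)) +ℤ (tail a ⊛ a) (suc (m + m))
      ≡⟨ cong (a 0 *ℤ a (2 + (m + m)) +ℤ_) (⊛-last (tail a) a (m + m)) ⟩
    a 0 *ℤ a (2 + (m + m)) +ℤ ((tail a ⊛ tail a) (m + m) +ℤ a (2 + (m + m)) *ℤ a 0)
      ≡⟨ regroup (a 0 *ℤ a (2 + (m + m))) _ _ ⟩
    a 0 *ℤ a (2 + (m + m)) +ℤ a (2 + (m + m)) *ℤ a 0 +ℤ (tail a ⊛ tail a) (m + m) ∎

-- The disjunction supplies a witness of P wherever the coefficient is not shown to be zero, so
-- supports given by existentials, such as twice a square, pass through products.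
record Supported (P : ℕ → Set) (a : Series) : Set where
  field at : ∀ k → a k ≡ 0ℤ ⊎ P k
open Supported

_⊞_ : (ℕ → Set) → (ℕ → Set) → ℕ → Set
(P ⊞ Q) n = ∃₂ λ k l → P k × Q l × k + l ≡ n

supported-mono : ∀ {P Q : ℕ → Set} {a} → (∀ {k} → P k → Q k) → Supported P a → Supported Q a
at (supported-mono f s) k with at s k
... | inj₁ z = inj₁ z
... | inj₂ p = inj₂ (f p)

outside : ∀ {P a k} → Supported P a → ¬ P k → a k ≡ 0ℤ
outside {k = k} s ¬p with at s k
... | inj₁ z = z
... | inj₂ p = ⊥-elim (¬p p)

supported-⊕ : ∀ {P a b} → Supported P a → Supported P b → Supported P (a ⊕ b)
at (supported-⊕ s t) k with at s k | at t k
... | inj₁ x | inj₁ y = inj₁ (cong₂ _+ℤ_ x y)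
... | inj₂ p | _      = inj₂ p
... | _      | inj₂ p = inj₂ p

supported-⊝ : ∀ {P a} → Supported P a → Supported P (⊝ a)
at (supported-⊝ s) k with at s k
... | inj₁ z = inj₁ (cong -_ z)
... | inj₂ p = inj₂ p

supported-constS : ∀ c → Supported (_≡ 0) (constS c)
at (supported-constS c) zero    = inj₂ refl
at (supported-constS c) (suc k) = inj₁ refl

supported-tail : ∀ {P a} → Supported P a → Supported (P ∘ suc) (tail a)
at (supported-tail s) k = at s (suc k)

supported-⊛ : ∀ {P Q a b} → Supported P a → Supported Q b → Supported (P ⊞ Q) (a ⊛ b)
at (supported-⊛ {a = a} {b} s t) zero with at s 0 | at t 0
... | inj₁ z | _      = inj₁ (trans (⊛-zero a b) (cong (_*ℤ b 0) z))
... | inj₂ _ | inj₁ z = inj₁ (trans (⊛-zero a b) (trans (cong (a 0 *ℤ_) z) (ℤ.*-zeroʳ (a 0))))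
... | inj₂ p | inj₂ r = inj₂ (0 , 0 , p , r , refl)
at (supported-⊛ {a = a} {b} s t) (suc n) with at (supported-⊛ (supported-tail s) t) n | at s 0 | at t (suc n)
... | inj₂ (k , l , p , r , eq) | _ | _           = inj₂ (suc k , l , p , r , cong suc eq)
... | inj₁ _ | inj₂ p | inj₂ r = inj₂ (0 , suc n , p , r , refl)
... | inj₁ y | inj₁ z | _      = inj₁ (trans (⊛-suc a b n) (cong₂ _+ℤ_ (cong (_*ℤ b (suc n)) z) y))
... | inj₁ y | inj₂ _ | inj₁ z = inj₁ (trans (⊛-suc a b n) (cong₂ _+ℤ_ (trans (cong (a 0 *ℤ_) z) (ℤ.*-zeroʳ (a 0))) y))

multiples-⊛ : ∀ {d a b} → Supported (d ∣ℕ_) a → Supported (d ∣ℕ_) b → Supported (d ∣ℕ_) (a ⊛ b)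
multiples-⊛ s t = supported-mono (λ { (_ , _ , p , r , refl) → ∣ℕ-+ p r }) (supported-⊛ s t)

multiples-constS : ∀ d c → Supported (d ∣ℕ_) (constS c)
multiples-constS d c = supported-mono (λ { refl → d ℕ∣.∣0 }) (supported-constS c)

-- In the recurrence for the inverse at an index not divisible by d, each term has two indices with
-- that sum, so one of them is not a multiple of d; strong induction covers the inverse's side.
multiples-inv : ∀ {d a} → a 0 ≡ 1ℤ → Supported (d ∣ℕ_) a → Supported (d ∣ℕ_) (inv a)
at (multiples-inv {d} {a} a₀ s) = <-rec _ step
  where
  open ≡-Reasoning
  step : ∀ n → (∀ {k} → k < n → inv a k ≡ 0ℤ ⊎ d ∣ℕ k) → inv a n ≡ 0ℤ ⊎ d ∣ℕ n
  step zero    _   = inj₂ (d ℕ∣.∣0)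
  step (suc n) rec with d ℕ∣.∣? suc n
  ... | yes d∣n = inj₂ d∣n
  ... | no  d∤n = inj₁ (begin
    inv a (suc n)                                     ≡⟨ ℤ.+-identityʳ _ ⟨
    -- Divisibility by 0 expresses that the convolution vanishes because all its terms do.
    inv a (suc n) +ℤ 0ℤ                               ≡⟨ cong (inv a (suc n) +ℤ_) (ℤ∣.0∣⇒≡0 (∣-⊛ 0ℤ (tail a) (inv a) n terms)) ⟨
    inv a (suc n) +ℤ (tail a ⊛ inv a) n               ≡⟨ cong (_+ℤ (tail a ⊛ inv a) n) (trans (cong (_*ℤ inv a (suc n)) a₀) (ℤ.*-identityˡ _)) ⟨
    a 0 *ℤ inv a (suc n) +ℤ (tail a ⊛ inv a) n        ≡⟨ ⊛-suc a (inv a) n ⟨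
    (a ⊛ inv a) (suc n)                               ≡⟨ ⊛-inv a a₀ (suc n) ⟩
    0ℤ                                                ∎)
    where
    terms : ∀ k l → k + l ≡ n → 0ℤ ∣ℤ a (suc k) *ℤ inv a l
    terms k l refl with at s (suc k) | rec {l} (s≤s (ℕ.m≤n+m l k))
    ... | inj₁ z | _      = dividesℤ 0ℤ (cong (_*ℤ inv a l) z)
    ... | inj₂ _ | inj₁ z = dividesℤ 0ℤ (trans (cong (a (suc k) *ℤ_) z) (ℤ.*-zeroʳ (a (suc k))))
    ... | inj₂ p | inj₂ r = ⊥-elim (d∤n (∣ℕ-+ p r))

-- The concrete q, and the supports of eta and theta series

𝕢 : Series
𝕢 = shift 𝟙

𝕢-⊛ : ∀ a n → (𝕢 ⊛ a) (suc n) ≡ a n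
𝕢-⊛ a n = trans (shift-⊛ 𝟙 a (suc n)) (⊛-identityˡ a n)

oneMinusQ^-low : ∀ d k → k < d → oneMinusQ^ d k ≡ 𝟙 k
oneMinusQ^-low (suc d) zero    _         = refl
oneMinusQ^-low (suc d) (suc k) (s≤s k<d) = cong (λ b → if b then - 1ℤ else 0ℤ) (≢⇒≡ᵇ≡false k d k<d)
  where
  ≢⇒≡ᵇ≡false : ∀ k d → k < d → (k ≡ᵇ d) ≡ false
  ≢⇒≡ᵇ≡false zero    (suc d) _         = refl
  ≢⇒≡ᵇ≡false (suc k) (suc d) (s≤s k<d) = ≢⇒≡ᵇ≡false k d k<d

-- Justifies the diagonal definition of `f`: a factor beyond the k-th differs from 1 only at an
-- exponent greater than k.
partialEta-stable : ∀ m .{{_ : NonZero m}} {k n} → k ≤ n → partialEta m k k ≡ partialEta m n k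
partialEta-stable m {k} {n} k≤n = trans (extend (n ∸ k)) (cong (λ n → partialEta m n k) (ℕ.m∸n+n≡m k≤n))
  where
  open ≡-Reasoning
  extend : ∀ j → partialEta m k k ≡ partialEta m (j + k) k
  extend zero    = refl
  extend (suc j) = begin
    partialEta m k k                                              ≡⟨ extend j ⟩
    partialEta m (j + k) k                                        ≡⟨ ⊛-identityˡ (partialEta m (j + k)) k ⟨
    (𝟙 ⊛ partialEta m (j + k)) k                                  ≡⟨ ⊛-comm 𝟙 (partialEta m (j + k)) k ⟩
    (partialEta m (j + k) ⊛ 𝟙) k                                  ≡⟨ ⊛-cong≤ {a = partialEta m (j + k)} k (λ _ _ → refl) (λ l l≤k → oneMinusQ^-low (m * suc (j + k)) l
                                                                       (ℕ.<-≤-trans (s≤s (ℕ.≤-trans l≤k (ℕ.m≤n+m k j))) (ℕ.m≤n*m (suc (j + k)) m))) ⟨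
    partialEta m (suc j + k) k                                    ∎

module Series-mod-q^ (M : ℕ) where
  open Nilpotent (truncatedSeries M) (constants M) public hiding (_⊕_; ⊝_; 𝟙)

  supported-𝕢^ : ∀ n → Supported (_≡ n) (𝕢 ^ n)
  supported-𝕢^ zero    = supported-constS 1ℤ
  supported-𝕢^ (suc n) = supported-mono (λ { (_ , _ , refl , refl , refl) → refl }) (supported-⊛ supported-𝕢 (supported-𝕢^ n))
    where
    supported-𝕢 : Supported (_≡ 1) 𝕢
    at supported-𝕢 zero          = inj₁ refl
    at supported-𝕢 (suc zero)    = inj₂ refl
    at supported-𝕢 (suc (suc k)) = inj₁ refl

  𝕢^M≈0 : 𝕢 ^ M ≈ constS 0ℤ
  𝕢^M≈0 = below (λ k k<M → trans (outside (supported-𝕢^ M) (ℕ.<⇒≢ k<M)) (sym (zeros k)))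
    where
    zeros : ∀ k → constS 0ℤ k ≡ 0ℤ
    zeros zero    = refl
    zeros (suc k) = refl

  open Truncated 𝕢 M 𝕢^M≈0 public

  𝕢^-coeff : ∀ d n → (𝕢 ^ d) n ≡ (if n ≡ᵇ d then 1ℤ else 0ℤ)
  𝕢^-coeff zero    zero    = refl
  𝕢^-coeff zero    (suc n) = refl
  𝕢^-coeff (suc d) zero    = ⊛-zero 𝕢 (𝕢 ^ d)
  𝕢^-coeff (suc d) (suc n) = trans (𝕢-⊛ (𝕢 ^ d) n) (𝕢^-coeff d n)

  oneMinusQ^-𝕢^ : ∀ d → oneMinusQ^ (suc d) ≈ 𝟙 ⊕ ⊝ 𝟙 ⊛ 𝕢 ^ suc d
  oneMinusQ^-𝕢^ d = ≈-trans (pointwise coefficients) (+-congˡ {𝟙} (≈-sym negate))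
    where
    negate : ⊝ 𝟙 ⊛ 𝕢 ^ suc d ≈ ⊝ 𝕢 ^ suc d
    negate = Solver.solve 1 (λ x → Solver.:- Solver.con 1ℤ Solver.:* x Solver.:= Solver.:- x) ≈-refl (𝕢 ^ suc d)
    coefficients : ∀ n → oneMinusQ^ (suc d) n ≡ 𝟙 n +ℤ - ((𝕢 ^ suc d) n)
    coefficients zero    = sym (cong (λ c → 1ℤ +ℤ - c) (𝕢^-coeff (suc d) 0))
    coefficients (suc n) = trans (if-neg (n ≡ᵇ d)) (sym (cong (λ c → 0ℤ +ℤ - c) (𝕢^-coeff (suc d) (suc n))))
      where
      if-neg : ∀ b → (if b then - 1ℤ else 0ℤ) ≡ 0ℤ +ℤ - (if b then 1ℤ else 0ℤ)
      if-neg true  = refl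
      if-neg false = refl

  oneS≈𝟙 : oneS ≈ 𝟙
  oneS≈𝟙 = pointwise (λ { zero → refl ; (suc _) → refl })

  partialEta-∏ : ∀ m .{{_ : NonZero m}} n → partialEta m n ≈ ∏ n (factor (⊝ 𝟙) m m)
  partialEta-∏ m         zero    = oneS≈𝟙
  partialEta-∏ m@(suc d) (suc n) = *-cong (partialEta-∏ m n) (≈-trans (oneMinusQ^-𝕢^ (n + d * suc n))
    (≈-reflexive (cong (λ e → 𝟙 ⊕ ⊝ 𝟙 ⊛ 𝕢 ^ e) (ℕ.*-suc m n))))

  ^S-^ : ∀ {a b} n → a ≈ b → a ^S n ≈ b ^ n
  ^S-^ zero    p = oneS≈𝟙
  ^S-^ (suc n) p = *-cong p (^S-^ n p)

  multiples-η : ∀ m → Supported (m ∣ℕ_) (η m)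
  multiples-η m = go M
    where
    go : ∀ n → Supported (m ∣ℕ_) (∏ n (factor (⊝ 𝟙) m m))
    go zero    = multiples-constS m 1ℤ
    go (suc n) = multiples-⊛ (go n) (supported-⊕ (multiples-constS m 1ℤ) (multiples-⊛ (supported-⊝ (multiples-constS m 1ℤ))
      (supported-mono (λ { refl → ∣ℕ-+ ℕ∣.∣-refl (ℕ∣.m∣m*n n) }) (supported-𝕢^ (m + m * n)))))

  supported-θ : ∀ {s} → Supported (_≡ 0) s → ∀ r r′ i → Supported (_≡ exponent r r′ i) (θ s r r′ i)
  supported-θ {s} s₀ r r′ i = supported-mono (λ { (_ , _ , refl , refl , refl) → refl }) (supported-⊛ (power₀ ∣ i ∣) (supported-𝕢^ (exponent r r′ i)))
    where
    power₀ : ∀ n → Supported (_≡ 0) (s ^ n)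
    power₀ zero    = supported-constS 1ℤ
    power₀ (suc n) = supported-mono (λ { (_ , _ , refl , refl , refl) → refl }) (supported-⊛ s₀ (power₀ n))

  supported-∑ : ∀ {P} n g → (∀ i → Supported P (g i)) → Supported P (∑ n g)
  at (supported-∑ zero    g s) zero    = inj₁ refl
  at (supported-∑ zero    g s) (suc _) = inj₁ refl
  supported-∑ (suc n) g s = supported-⊕ (supported-∑ n g s) (s n)

  exponent-square : ∀ m i → exponent m m (+ i) ≡ m * (i * i)
  exponent-square m zero    = sym (ℕ.*-zeroʳ m)
  exponent-square m (suc i) = trans (cong (_+_ (m + (m + m) * i)) (exponent-square m i)) (step m i)
    where
    step : ∀ m i → m + (m + m) * i + m * (i * i) ≡ m * (suc i * suc i)
    step = solve-∀

  supported-half : ∀ m → Supported (λ k → ∃ λ i → k ≡ m * (i * i)) (half m)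
  supported-half m = supported-∑ M (λ i → θ (⊝ 𝟙) m m (+ suc i)) (λ i →
    supported-mono (λ k≡e → suc i , trans k≡e (exponent-square m (suc i))) (supported-θ (supported-⊝ (supported-constS 1ℤ)) m m (+ suc i)))

  -- Modulo 3 the exponent 4i² - 2i depends only on i modulo 3, hence three base cases and a step of
  -- three for each sign; the residues met are 0 and 2.
  exponent-mod-3 : ∀ i → exponent 2 6 i % 3 ≢ 1
  exponent-mod-3 (+ 0)                  = λ ()
  exponent-mod-3 (+ 1)                  = λ ()
  exponent-mod-3 (+ 2)                  = λ ()
  exponent-mod-3 (+ suc (suc (suc i)))  = exponent-mod-3 (+ i) ∘ trans (sym (trans (cong (_% 3) (step i (exponent 2 6 (+ i)))) ([m+kn]%n≡m%n (exponent 2 6 (+ i)) (10 + 8 * i) 3)))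
    where
    step : ∀ i e → 2 + 8 * (2 + i) + (2 + 8 * (1 + i) + (2 + 8 * i + e)) ≡ e + (10 + 8 * i) * 3
    step = solve-∀
  exponent-mod-3 -[1+ 0 ]               = λ ()
  exponent-mod-3 -[1+ 1 ]               = λ ()
  exponent-mod-3 -[1+ 2 ]               = λ ()
  exponent-mod-3 -[1+ suc (suc (suc i)) ] = exponent-mod-3 -[1+ i ] ∘ trans (sym (trans (cong (_% 3) (step i (exponent 2 6 -[1+ i ]))) ([m+kn]%n≡m%n (exponent 2 6 -[1+ i ]) (22 + 8 * i) 3)))
    where
    step : ∀ i e → 6 + 8 * (3 + i) + (6 + 8 * (2 + i) + (6 + 8 * (1 + i) + e)) ≡ e + (22 + 8 * i) * 3
    step = solve-∀

  supported-ψ : Supported (λ k → k % 3 ≢ 1) (Θ 𝟙 2 6)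
  supported-ψ = supported-∑ M (λ i → θ 𝟙 2 6 (+ i) ⊕ θ 𝟙 2 6 -[1+ i ]) (λ i → supported-⊕ (term (+ i)) (term -[1+ i ]))
    where
    term : ∀ i → Supported (λ k → k % 3 ≢ 1) (θ 𝟙 2 6 i)
    term i = supported-mono (λ { refl → exponent-mod-3 i }) (supported-θ (supported-constS 1ℤ) 2 6 i)

  f-η : ∀ m .{{_ : NonZero m}} → f m ≈ η m
  f-η m = ≈-trans (below (λ k k<M → partialEta-stable m (ℕ.<⇒≤ k<M))) (partialEta-∏ m M)

-- Residues of squares and parity of convolutions

square≢5 : ∀ i s → i * i ≢ 5 + s * 6
square≢5 i s eq = toWitness {a? = ℕ.allUpTo? (λ r → ¬? ((r * r) % 6 ≟ 5)) 6} _ (m%n<n i 6)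
  (trans (sym (%-distribˡ-* i i 6)) (trans (cong (_% 6) eq) ([m+kn]%n≡m%n 5 s 6)))

-- Modulo 4 the right side is 3, while squares are 0 or 1; the residue pairs are checked by
-- evaluation.
sum-of-squares≢11 : ∀ i j s → i * i + j * j ≢ 11 + s * 12
sum-of-squares≢11 i j s eq = toWitness {a? = ℕ.allUpTo? (λ a → ℕ.allUpTo? (λ b → ¬? (((a * a) % 4 + (b * b) % 4) % 4 ≟ 3)) 4) 4} _ (m%n<n i 4) (m%n<n j 4)
  (trans (cong₂ (λ x y → (x + y) % 4) (sym (%-distribˡ-* i i 4)) (sym (%-distribˡ-* j j 4))) (trans (sym (%-distribˡ-+ (i * i) (j * j) 4))
    (trans (cong (_% 4) (trans eq (shape s))) ([m+kn]%n≡m%n 3 (2 + s * 3) 4))))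
  where
  shape : ∀ s → 11 + s * 12 ≡ 3 + (2 + s * 3) * 4
  shape = solve-∀

residue : ∀ {r} m .{{_ : NonZero m}} c l t → r < m → c * m + l ≡ r + t * m → l ≡ r + (l / m) * m
residue {r} m c l t r<m eq = trans (m≡m%n+[m/n]*n l m) (cong (_+ (l / m) * m) (begin
  l % m               ≡⟨ [m+kn]%n≡m%n l c m ⟨
  (l + c * m) % m     ≡⟨ cong (_% m) (trans (ℕ.+-comm l (c * m)) eq) ⟩
  (r + t * m) % m     ≡⟨ [m+kn]%n≡m%n r t m ⟩
  r % m               ≡⟨ m<n⇒m%n≡m r<m ⟩
  r                   ∎))
  where open ≡-Reasoning

module _ {h : Series} (squares : Supported (λ k → ∃ λ i → k ≡ 2 * (i * i)) h) where

  half-vanishes : ∀ s → h (10 + s * 12) ≡ 0ℤ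
  half-vanishes s = outside squares λ { (i , eq) → square≢5 i s (ℕ.*-cancelˡ-≡ (i * i) (5 + s * 6) 2 (trans (sym eq) (double s))) }
    where
    double : ∀ s → 10 + s * 12 ≡ 2 * (5 + s * 6)
    double = solve-∀

  -- The linear term is zero. In h² the middle index 5 + 6s is odd, hence outside the support of h,
  -- so the coefficient is even by pairing.
  u-even : ∀ s → + 2 ∣ℤ (h ⊕ h ⊛ h) (10 + s * 12)
  u-even s = ℤ∣.∣m∣n⇒∣m+n (dividesℤ 0ℤ (half-vanishes s)) (subst (λ k → + 2 ∣ℤ (h ⊛ h) k) (double s)
    (square-even h (5 + s * 6) (outside squares λ { (i , eq) → odd (i * i) s (sym eq) })))
    where
    double : ∀ s → (5 + s * 6) + (5 + s * 6) ≡ 10 + s * 12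
    double = solve-∀
    odd : ∀ x s → 2 * x ≢ 5 + s * 6
    odd x s eq with trans (sym (trans (cong (_% 2) (shape s)) ([m+kn]%n≡m%n 1 (2 + s * 3) 2))) (trans (cong (_% 2) (sym eq)) (trans (cong (_% 2) (ℕ.*-comm 2 x)) ([m+kn]%n≡m%n 0 x 2)))
      where
      shape : ∀ s → 5 + s * 6 ≡ 1 + (2 + s * 3) * 2
      shape = solve-∀
    ... | ()

  -- Such an exponent is 10 modulo 12, so h is zero there, and half of it is 3 modulo 4, hence no
  -- sum of two squares.
  u-vanishes : ∀ s → (h ⊕ h ⊛ h) (22 + s * 24) ≡ 0ℤ
  u-vanishes s = cong₂ _+ℤ_ (trans (cong h (shape s)) (half-vanishes (1 + s * 2)))
    (outside (supported-⊛ squares squares) λ { (_ , _ , (i , refl) , (j , refl) , eq) →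
      sum-of-squares≢11 i j s (ℕ.*-cancelˡ-≡ (i * i + j * j) (11 + s * 12) 2 (trans (ℕ.*-distribˡ-+ 2 (i * i) (j * j)) (trans eq (double s)))) })
    where
    shape : ∀ s → 22 + s * 24 ≡ 10 + (1 + s * 2) * 12
    shape = solve-∀
    double : ∀ s → 22 + s * 24 ≡ 2 * (11 + s * 12)
    double = solve-∀

-- The middle index 6 + 12c is not a multiple of 12.
square-of-multiples : ∀ {g} → Supported (12 ∣ℕ_) g → ∀ c → + 2 ∣ℤ (g ⊛ g) (12 + c * 24)
square-of-multiples {g} 12∣g c = subst (λ k → + 2 ∣ℤ (g ⊛ g) k) (double c) (square-even g (6 + c * 12) (outside 12∣g λ { (dividesℕ q eq) → absurd q (sym eq) }))
  where
  double : ∀ c → (6 + c * 12) + (6 + c * 12) ≡ 12 + c * 24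
  double = solve-∀
  absurd : ∀ q → q * 12 ≢ 6 + c * 12
  absurd q eq with trans (sym ([m+kn]%n≡m%n 0 q 12)) (trans (cong (_% 12) eq) ([m+kn]%n≡m%n 6 c 12))
  ... | ()

module _ {a b : Series} (12∣a : Supported (12 ∣ℕ_) a) where

  even-convolution : (∀ s → + 2 ∣ℤ b (10 + s * 12)) → ∀ t → + 2 ∣ℤ (a ⊛ b) (10 + t * 12)
  even-convolution b-even t = ∣-⊛ (+ 2) a b (10 + t * 12) term
    where
    term : ∀ k l → k + l ≡ 10 + t * 12 → + 2 ∣ℤ a k *ℤ b l
    term k l eq with at 12∣a k
    ... | inj₁ z = dividesℤ 0ℤ (cong (_*ℤ b l) z)
    ... | inj₂ (dividesℕ c refl) = ℤ∣.∣n⇒∣m*n (a (c * 12)) (subst (λ l → + 2 ∣ℤ b l) (sym (residue 12 c l t (ℕ.m<m+n 10 {2} (s≤s z≤n)) eq)) (b-even (l / 12)))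

  -- Write k = 12c. For even c the complementary index is 22 modulo 24, where b vanishes; for odd c
  -- it is still 10 modulo 12, and both factors are even.
  convolution-divisible-by-4 : (∀ c → + 2 ∣ℤ a (12 + c * 24)) → (∀ s → + 2 ∣ℤ b (10 + s * 12)) → (∀ s → b (22 + s * 24) ≡ 0ℤ) →
    ∀ t → + 4 ∣ℤ (a ⊛ b) (22 + t * 24)
  convolution-divisible-by-4 a-even b-even b-vanishes t = ∣-⊛ (+ 4) a b (22 + t * 24) term
    where
    even : ∀ h → h * 2 * 12 ≡ h * 24
    even = solve-∀
    odd : ∀ h → (1 + h * 2) * 12 ≡ 12 + h * 24
    odd = solve-∀
    shape : ∀ t → 22 + t * 24 ≡ 10 + (1 + t * 2) * 12
    shape = solve-∀
    ∣-* : ∀ {x y} → + 2 ∣ℤ x → + 2 ∣ℤ y → + 4 ∣ℤ x *ℤ y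
    ∣-* (dividesℤ a refl) (dividesℤ b refl) = dividesℤ (a *ℤ b) (four a b)
      where
      four : ∀ a b → a *ℤ + 2 *ℤ (b *ℤ + 2) ≡ a *ℤ b *ℤ + 4
      four = ℤ.solve-∀
    term : ∀ k l → k + l ≡ 22 + t * 24 → + 4 ∣ℤ a k *ℤ b l
    term k l eq with at 12∣a k
    ... | inj₁ z = dividesℤ 0ℤ (cong (_*ℤ b l) z)
    ... | inj₂ (dividesℕ c refl) with c % 2 | m%n<n c 2 | m≡m%n+[m/n]*n c 2
    ... | 0 | _ | c≡ = dividesℤ 0ℤ (trans (cong (a (c * 12) *ℤ_) (trans (cong b l≡) (b-vanishes (l / 24)))) (ℤ.*-zeroʳ (a (c * 12))))
      where
      l≡ : l ≡ 22 + (l / 24) * 24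
      l≡ = residue 24 (c / 2) l t (ℕ.m<m+n 22 {2} (s≤s z≤n)) (trans (cong (_+ l) (sym (trans (cong (_* 12) c≡) (even (c / 2))))) eq)
    ... | 1 | _ | c≡ = ∣-* (subst (λ k → + 2 ∣ℤ a k) (sym (trans (cong (_* 12) c≡) (odd (c / 2)))) (a-even (c / 2)))
                           (subst (λ l → + 2 ∣ℤ b l) (sym (residue 12 c l (1 + t * 2) (ℕ.m<m+n 10 {2} (s≤s z≤n)) (trans eq (shape t)))) (b-even (l / 12)))
    ... | suc (suc _) | s≤s (s≤s ()) | _

-- Coefficients of K and of the generating function

module Coefficients (M : ℕ) where
  open Series-mod-q^ M

  private
    -- The recursively computed inverse is preferred to the witness of `η-unit` because
    -- `multiples-inv` gives its support.
    ι : ℕ → Series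
    ι m = inv (η m)

  module _ (0<M : 0 < M) where

    η-0 : ∀ m .{{_ : NonZero m}} → η m 0 ≡ 1ℤ
    η-0 m = sym (coeff (f-η m) 0 0<M)

    η-ι : ∀ m .{{_ : NonZero m}} → η m ⊛ ι m ≈ 𝟙
    η-ι m = pointwise (⊛-inv (η m) (η-0 m))

    multiples-ι : ∀ m .{{_ : NonZero m}} → Supported (m ∣ℕ_) (ι m)
    multiples-ι m = multiples-inv (η-0 m) (multiples-η m)

    CP3-eta : CP3 ⊛ (η 1 ^ 2 ⊛ η 2 ^ 2) ≈ η 3 ^ 6 ⊛ η 6 ^ 6
    CP3-eta = quotient-* {N = (f 3 ^S 6) ⊛ (f 6 ^S 6)} {(f 1 ^S 2) ⊛ (f 2 ^S 2)} {inv ((f 1 ^S 2) ⊛ (f 2 ^S 2))}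
      (*-cong (^S-^ 6 (f-η 3)) (^S-^ 6 (f-η 6))) (*-cong (^S-^ 2 (f-η 1)) (^S-^ 2 (f-η 2))) (pointwise (⊛-inv ((f 1 ^S 2) ⊛ (f 2 ^S 2)) refl))

    open Dissection (ι 1) (ι 2) (ι 4) (ι 12) (η-ι 1) (η-ι 2) (η-ι 4) (η-ι 12)

    even-η : ∀ m → 2 ∣ℕ m → Supported (2 ∣ℕ_) (η m)
    even-η m 2∣m = supported-mono (ℕ∣.∣-trans 2∣m) (multiples-η m)

    even-ι : ∀ m .{{_ : NonZero m}} → 2 ∣ℕ m → Supported (2 ∣ℕ_) (ι m)
    even-ι m 2∣m = supported-mono (ℕ∣.∣-trans 2∣m) (multiples-ι m)

    CP3-odd : ∀ {d} → 2 ∣ℕ d → suc d < M → CP3 (suc d) ≡ + 2 *ℤ K d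
    CP3-odd {d} 2∣d d<M = begin
      CP3 (suc d)                                    ≡⟨ coeff (≈-trans (C₁²C₂² {CP3} CP3-eta) square-dissect) (suc d) d<M ⟩
      evenPart (suc d) +ℤ (𝕢 ⊛ (constS (+ 2) ⊛ K)) (suc d)     ≡⟨ cong₂ _+ℤ_ (outside {k = suc d} even-evenPart odd) (𝕢-⊛ (constS (+ 2) ⊛ K) d) ⟩
      0ℤ +ℤ (constS (+ 2) ⊛ K) d                     ≡⟨ ℤ.+-identityˡ _ ⟩
      (constS (+ 2) ⊛ K) d                           ≡⟨ constS-⊛ (+ 2) K d ⟩
      + 2 *ℤ K d                                     ∎
      where
      open ≡-Reasoning
      evenPart : Series
      evenPart = C₂ ⊛ C₂ ⊛ (E ⊛ E ⊕ 𝕢 ⊛ 𝕢 ⊛ (C₄ ⊛ C₄))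
      odd : ¬ 2 ∣ℕ suc d
      odd 2∣1+d with ℕ∣.∣1⇒≡1 (∣ℕ-cancel (subst (2 ∣ℕ_) (ℕ.+-comm 1 d) 2∣1+d) 2∣d)
      ... | ()
      2∣4 = dividesℕ 2 refl
      2∣6 = dividesℕ 3 refl
      2∣12 = dividesℕ 6 refl
      infixl 7 _·_
      _·_ = multiples-⊛ {2}
      even-C₂ : Supported (2 ∣ℕ_) C₂
      even-C₂ = even-η 6 2∣6 · even-η 6 2∣6 · even-η 6 2∣6 · even-ι 2 ℕ∣.∣-refl
      even-C₄ : Supported (2 ∣ℕ_) C₄
      even-C₄ = even-η 12 2∣12 · even-η 12 2∣12 · even-η 12 2∣12 · even-ι 4 2∣4
      even-E : Supported (2 ∣ℕ_) E
      even-E = even-η 4 2∣4 · even-η 4 2∣4 · even-η 4 2∣4 · even-η 6 2∣6 · even-η 6 2∣6 · (even-ι 2 ℕ∣.∣-refl · even-ι 2 ℕ∣.∣-refl · even-ι 12 2∣12)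
      even-𝕢² : Supported (2 ∣ℕ_) (𝕢 ⊛ 𝕢)
      at even-𝕢² zero                = inj₁ refl
      at even-𝕢² (suc zero)          = inj₁ refl
      at even-𝕢² (suc (suc zero))    = inj₂ ℕ∣.∣-refl
      at even-𝕢² (suc (suc (suc k))) = inj₁ (trans (𝕢-⊛ 𝕢 (suc (suc k))) refl)
      even-evenPart : Supported (2 ∣ℕ_) evenPart
      even-evenPart = even-C₂ · even-C₂ · supported-⊕ (even-E · even-E) (even-𝕢² · (even-C₄ · even-C₄))

    -- The cofactor of ψ has exponents divisible by 3, so a contributing exponent of ψ would have to
    -- be 1 modulo 3 like d.
    K-divisible-by-3 : ∀ {d} → d % 3 ≡ 1 → d < M → + 3 ∣ℤ K d
    K-divisible-by-3 {d} d%3≡1 d<M = dividesℤ (w d) (begin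
      K d                                          ≡⟨ coeff (proj₂ K-mod-3) d d<M ⟩
      (ψ ⊛ X) d +ℤ (constS (+ 3) ⊛ w) d            ≡⟨ cong₂ _+ℤ_ (outside (supported-⊛ supported-ψ 3∣X) (λ { (k , _ , k%3≢1 , dividesℕ c refl , k+l≡d) →
                                                        k%3≢1 (trans (sym ([m+kn]%n≡m%n k c 3)) (trans (cong (_% 3) k+l≡d) d%3≡1)) })) (constS-⊛ (+ 3) w d) ⟩
      0ℤ +ℤ + 3 *ℤ w d                             ≡⟨ ℤ.+-identityˡ _ ⟩
      + 3 *ℤ w d                                   ≡⟨ ℤ.*-comm (+ 3) (w d) ⟩
      w d *ℤ + 3                                   ∎)
      where
      open ≡-Reasoning
      ψ X w : Series
      w = proj₁ K-mod-3
      ψ = Θ 𝟙 2 6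
      X = η 6 ⊛ η 6 ⊛ η 6 ⊛ η 6 ⊛ (η 6 ⊛ η 6 ⊛ η 6) ⊛ (η 12 ⊛ η 12)
      infixl 7 _·_
      _·_ = multiples-⊛ {3}
      3∣η : ∀ m → 3 ∣ℕ m → Supported (3 ∣ℕ_) (η m)
      3∣η m 3∣m = supported-mono (ℕ∣.∣-trans 3∣m) (multiples-η m)
      6′ = 3∣η 6 (dividesℕ 2 refl)
      12′ = 3∣η 12 (dividesℕ 4 refl)
      3∣X : Supported (3 ∣ℕ_) X
      3∣X = 6′ · 6′ · 6′ · 6′ · (6′ · 6′ · 6′) · (12′ · 12′)

    g u v : Series
    g = η 12 ⊛ η 12 ⊛ η 12
    u = half 2 ⊕ half 2 ⊛ half 2
    v = half 6 ⊕ half 6 ⊛ half 6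

    multiples-g : Supported (12 ∣ℕ_) g
    multiples-g = multiples-⊛ (multiples-⊛ (multiples-η 12) (multiples-η 12)) (multiples-η 12)

    -- Both g² and g²v are supported on multiples of 6, so outside them only the term in u survives
    -- modulo 16.
    K-coeff : ∀ {d} → ¬ 6 ∣ℕ d → d < M → ∃ λ w → K d ≡ - (+ 4) *ℤ (g ⊛ g ⊛ u) d +ℤ + 16 *ℤ w
    K-coeff {d} 6∤d d<M = w d , (begin
      K d
        ≡⟨ coeff (proj₂ K-mod-16) d d<M ⟩
      (g ⊛ g) d +ℤ (constS (- (+ 4)) ⊛ (g ⊛ g ⊛ u)) d +ℤ (constS (+ 8) ⊛ (g ⊛ g ⊛ v)) d +ℤ (constS (+ 16) ⊛ w) d
        ≡⟨ cong₂ _+ℤ_ (cong₂ _+ℤ_ (cong₂ _+ℤ_ (outside 6∣g² 6∤d) (constS-⊛ (- (+ 4)) (g ⊛ g ⊛ u) d))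
             (trans (constS-⊛ (+ 8) (g ⊛ g ⊛ v) d) (cong (+ 8 *ℤ_) (outside (multiples-⊛ 6∣g² 6∣v) 6∤d)))) (constS-⊛ (+ 16) w d) ⟩
      0ℤ +ℤ - (+ 4) *ℤ (g ⊛ g ⊛ u) d +ℤ + 8 *ℤ 0ℤ +ℤ + 16 *ℤ w d
        ≡⟨ tidy (- (+ 4) *ℤ (g ⊛ g ⊛ u) d) (+ 16 *ℤ w d) ⟩
      - (+ 4) *ℤ (g ⊛ g ⊛ u) d +ℤ + 16 *ℤ w d ∎)
      where
      open ≡-Reasoning
      w : Series
      w = proj₁ K-mod-16
      tidy : ∀ x y → 0ℤ +ℤ x +ℤ + 8 *ℤ 0ℤ +ℤ y ≡ x +ℤ y
      tidy = ℤ.solve-∀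
      6∣g² : Supported (6 ∣ℕ_) (g ⊛ g)
      6∣g² = supported-mono (ℕ∣.∣-trans (dividesℕ 2 refl)) (multiples-⊛ multiples-g multiples-g)
      6∣half : Supported (6 ∣ℕ_) (half 6)
      6∣half = supported-mono (λ { (i , refl) → ℕ∣.m∣m*n (i * i) }) (supported-half 6)
      6∣v : Supported (6 ∣ℕ_) v
      6∣v = supported-⊕ 6∣half (multiples-⊛ 6∣half 6∣half)

    g²u-even : ∀ t → + 2 ∣ℤ (g ⊛ g ⊛ u) (10 + t * 12)
    g²u-even = even-convolution {g ⊛ g} {u} (multiples-⊛ multiples-g multiples-g) (u-even {half 2} (supported-half 2))

    g²u-divisible-by-4 : ∀ t → + 4 ∣ℤ (g ⊛ g ⊛ u) (22 + t * 24)
    g²u-divisible-by-4 = convolution-divisible-by-4 {g ⊛ g} {u} (multiples-⊛ multiples-g multiples-g) (square-of-multiples {g} multiples-g)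
      (u-even {half 2} (supported-half 2)) (u-vanishes {half 2} (supported-half 2))

    K-divisible-by-8 : ∀ {d} t → d ≡ 10 + t * 12 → ¬ 6 ∣ℕ d → d < M → + 8 ∣ℤ K d
    K-divisible-by-8 {d} t d≡ 6∤d d<M = combine {K d} {(g ⊛ g ⊛ u) d} (K-coeff 6∤d d<M) (subst (λ d → + 2 ∣ℤ (g ⊛ g ⊛ u) d) (sym d≡) (g²u-even t))
      where
      combine : ∀ {x y} → (∃ λ w → x ≡ - (+ 4) *ℤ y +ℤ + 16 *ℤ w) → + 2 ∣ℤ y → + 8 ∣ℤ x
      combine (w , refl) (dividesℤ y refl) = dividesℤ (- y +ℤ + 2 *ℤ w) (regroup y w)
        where
        regroup : ∀ y w → - (+ 4) *ℤ (y *ℤ + 2) +ℤ + 16 *ℤ w ≡ (- y +ℤ + 2 *ℤ w) *ℤ + 8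
        regroup = ℤ.solve-∀

    K-divisible-by-16 : ∀ {d} t → d ≡ 22 + t * 24 → ¬ 6 ∣ℕ d → d < M → + 16 ∣ℤ K d
    K-divisible-by-16 {d} t d≡ 6∤d d<M = combine {K d} {(g ⊛ g ⊛ u) d} (K-coeff 6∤d d<M) (subst (λ d → + 4 ∣ℤ (g ⊛ g ⊛ u) d) (sym d≡) (g²u-divisible-by-4 t))
      where
      combine : ∀ {x y} → (∃ λ w → x ≡ - (+ 4) *ℤ y +ℤ + 16 *ℤ w) → + 4 ∣ℤ y → + 16 ∣ℤ x
      combine (w , refl) (dividesℤ y refl) = dividesℤ (- y +ℤ w) (regroup y w)
        where
        regroup : ∀ y w → - (+ 4) *ℤ (y *ℤ + 4) +ℤ + 16 *ℤ w ≡ (- y +ℤ w) *ℤ + 16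
        regroup = ℤ.solve-∀

-- Combining the moduli

not-multiple : ∀ {m r} t .{{_ : NonZero m}} → 0 < r → r < m → ¬ m ∣ℕ r + t * m
not-multiple {m} {r} t 0<r r<m m∣ = ℕ.<⇒≢ 0<r (sym (begin
  r                  ≡⟨ m<n⇒m%n≡m r<m ⟨
  r % m              ≡⟨ [m+kn]%n≡m%n r t m ⟨
  (r + t * m) % m    ≡⟨ ℕ∣.n∣m⇒m%n≡0 (r + t * m) m m∣ ⟩
  0                  ∎))
  where open ≡-Reasoning

CP3-divisible-by-48 : ∀ {d} t → d ≡ 10 + t * 12 → 2 ∣ℕ d → d % 3 ≡ 1 → ¬ 6 ∣ℕ d → + 48 ∣ℤ CP3 (suc d)
CP3-divisible-by-48 {d} t d≡ 2∣d d%3≡1 6∤d = subst (+ 48 ∣ℤ_) (sym (CP3-odd (s≤s z≤n) 2∣d ℕ.≤-refl))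
  (combine (K-divisible-by-3 (s≤s z≤n) d%3≡1 d<M) (K-divisible-by-8 (s≤s z≤n) t d≡ 6∤d d<M))
  where
  -- The least truncation order that still sees the coefficient of q^(d+1).
  open Coefficients (2 + d)
  d<M : d < 2 + d
  d<M = s≤s (ℕ.n≤1+n d)
  combine : ∀ {x} → + 3 ∣ℤ x → + 8 ∣ℤ x → + 48 ∣ℤ + 2 *ℤ x
  -- From 1 = 9 - 8: with 9x taken at x = 8b and 8x at x = 3a, both parts are multiples of 24.
  combine {x} (dividesℤ a x≡3a) (dividesℤ b x≡8b) = dividesℤ (+ 3 *ℤ b +ℤ - a) (begin
    + 2 *ℤ x                                           ≡⟨ split x ⟩
    + 2 *ℤ (+ 9 *ℤ x +ℤ - (+ 8 *ℤ x))                  ≡⟨ cong₂ (λ y z → + 2 *ℤ (+ 9 *ℤ y +ℤ - (+ 8 *ℤ z))) x≡8b x≡3a ⟩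
    + 2 *ℤ (+ 9 *ℤ (b *ℤ + 8) +ℤ - (+ 8 *ℤ (a *ℤ + 3))) ≡⟨ collect a b ⟩
    (+ 3 *ℤ b +ℤ - a) *ℤ + 48                          ∎)
    where
    open ≡-Reasoning
    split : ∀ x → + 2 *ℤ x ≡ + 2 *ℤ (+ 9 *ℤ x +ℤ - (+ 8 *ℤ x))
    split = ℤ.solve-∀
    collect : ∀ a b → + 2 *ℤ (+ 9 *ℤ (b *ℤ + 8) +ℤ - (+ 8 *ℤ (a *ℤ + 3))) ≡ (+ 3 *ℤ b +ℤ - a) *ℤ + 48
    collect = ℤ.solve-∀

CP3-divisible-by-96 : ∀ {d} t → d ≡ 22 + t * 24 → 2 ∣ℕ d → d % 3 ≡ 1 → ¬ 6 ∣ℕ d → + 96 ∣ℤ CP3 (suc d)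
CP3-divisible-by-96 {d} t d≡ 2∣d d%3≡1 6∤d = subst (+ 96 ∣ℤ_) (sym (CP3-odd (s≤s z≤n) 2∣d ℕ.≤-refl))
  (combine (K-divisible-by-3 (s≤s z≤n) d%3≡1 d<M) (K-divisible-by-16 (s≤s z≤n) t d≡ 6∤d d<M))
  where
  open Coefficients (2 + d)
  d<M : d < 2 + d
  d<M = s≤s (ℕ.n≤1+n d)
  combine : ∀ {x} → + 3 ∣ℤ x → + 16 ∣ℤ x → + 96 ∣ℤ + 2 *ℤ x
  -- From 1 = 16 - 15: with 16x taken at x = 3a and 15x at x = 16b, both parts are multiples of 48.
  combine {x} (dividesℤ a x≡3a) (dividesℤ b x≡16b) = dividesℤ (a +ℤ - (+ 5 *ℤ b)) (begin
    + 2 *ℤ x                                                  ≡⟨ split x ⟩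
    + 2 *ℤ (+ 16 *ℤ x +ℤ - (+ 15 *ℤ x))                       ≡⟨ cong₂ (λ y z → + 2 *ℤ (+ 16 *ℤ y +ℤ - (+ 15 *ℤ z))) x≡3a x≡16b ⟩
    + 2 *ℤ (+ 16 *ℤ (a *ℤ + 3) +ℤ - (+ 15 *ℤ (b *ℤ + 16)))    ≡⟨ collect a b ⟩
    (a +ℤ - (+ 5 *ℤ b)) *ℤ + 96                               ∎)
    where
    open ≡-Reasoning
    split : ∀ x → + 2 *ℤ x ≡ + 2 *ℤ (+ 16 *ℤ x +ℤ - (+ 15 *ℤ x))
    split = ℤ.solve-∀
    collect : ∀ a b → + 2 *ℤ (+ 16 *ℤ (a *ℤ + 3) +ℤ - (+ 15 *ℤ (b *ℤ + 16))) ≡ (a +ℤ - (+ 5 *ℤ b)) *ℤ + 96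
    collect = ℤ.solve-∀

theorem3p8 : (n : ℕ) → ((+ 48) ∣ CP3 (24 * n + 11)) × ((+ 96) ∣ CP3 (24 * n + 23))
theorem3p8 n = ℤ∣.∣⇒∣ᵤ (subst (λ k → + 48 ∣ℤ CP3 k) (sym (ℕ.+-suc (24 * n) 10)) part₁)
             , ℤ∣.∣⇒∣ᵤ (subst (λ k → + 96 ∣ℤ CP3 k) (sym (ℕ.+-suc (24 * n) 22)) part₂)
  where
  mod-12 : ∀ n → 24 * n + 10 ≡ 10 + 2 * n * 12
  mod-12 = solve-∀
  mod-24 : ∀ n → 24 * n + 22 ≡ 22 + n * 24
  mod-24 = solve-∀
  even : ∀ r k → r ≡ k * 2 → 24 * n + r ≡ (12 * n + k) * 2
  even _ k refl = shape n k
    where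
    shape : ∀ n k → 24 * n + k * 2 ≡ (12 * n + k) * 2
    shape = solve-∀
  1-mod-3 : ∀ r k → r ≡ 1 + k * 3 → (24 * n + r) % 3 ≡ 1
  1-mod-3 _ k refl = trans (cong (_% 3) (shape n k)) ([m+kn]%n≡m%n 1 (8 * n + k) 3)
    where
    shape : ∀ n k → 24 * n + (1 + k * 3) ≡ 1 + (8 * n + k) * 3
    shape = solve-∀
  4-mod-6 : ∀ r k → r ≡ 4 + k * 6 → ¬ 6 ∣ℕ 24 * n + r
  4-mod-6 _ k refl = subst (λ k → ¬ 6 ∣ℕ k) (shape n k) (not-multiple (4 * n + k) (s≤s z≤n) (ℕ.m<m+n 4 {2} (s≤s z≤n)))
    where
    shape : ∀ n k → 4 + (4 * n + k) * 6 ≡ 24 * n + (4 + k * 6)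
    shape = solve-∀
  part₁ : + 48 ∣ℤ CP3 (suc (24 * n + 10))
  part₁ = CP3-divisible-by-48 (2 * n) (mod-12 n) (dividesℕ (12 * n + 5) (even 10 5 refl)) (1-mod-3 10 3 refl) (4-mod-6 10 1 refl)
  part₂ : + 96 ∣ℤ CP3 (suc (24 * n + 22))
  part₂ = CP3-divisible-by-96 n (mod-24 n) (dividesℕ (12 * n + 11) (even 22 11 refl)) (1-mod-3 22 7 refl) (4-mod-6 22 3 refl)
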